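{- Let $i\in[n]$, let $f,s_if,fs_i,s_ifs_i\in\mathbf{B}_{k,n}$ with $s_if>f$, and let $P\in\mathcal{P}_{k,n}$ with $P_i=\mathrm R$ and $P_{i+1}=\mathrm U$ (so $s_iP\in\mathcal{P}_{k,n}$). Then for every $r$ there are bijections $$\mathcal{A}^r_{f,P}\cong\begin{cases}\mathcal{A}^r_{s_ifs_i,\,s_iP}, & fs_i<f;\\ \mathcal{A}^{r-1}_{s_if,\,s_iP}\sqcup\mathcal{A}^r_{s_ifs_i,\,s_iP}, & fs_i>f.\end{cases}$$
   Context: Let $n\ge 2$, $0\le k\le n$, $[n]=\{1,\dots,n\}$. An $n$-periodic affine permutation is a bijection $f:\mathbb{Z}\to\mathbb{Z}$ with $f(i+n)=f(i)+n$ for all $i$. Products are read left to right: $(fg)(a)=g(f(a))$. $\mathbf{B}_{k,n}$ is the set of those with $\frac1n\sum_{i=1}^n(f(i)-i)=k$ and $i\le f(i)\le i+n$ for all $i$. Length: $\ell(f)=\#\{(a,b): a\in[n],\,b\in\mathbb{Z},\,a<b,\,f(a)>f(b)\}$. $s_i$ exchanges $i+mn$ and $i+1+mn$ for all $m$ and fixes all other integers. $s_if>f$ means $\ell(s_if)>\ell(f)$, and similarly for the other comparisons. Lattice paths: $\mathcal{P}_{k,n}$ is the set of lattice paths $P$ from $(0,0)$ to $(n-k,k)$ with unit steps $P_1,\dots,P_n\in\{\mathrm R,\mathrm U\}$; $s_iP$ is obtained by swapping $P_i$ and $P_{i+1}$, indices modulo $n$. Extend $P$ to a bi-infinite path with steps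 indexed by $\mathbb{Z}$ via $P_{i+n}=P_i$ (step $1$ starts at $(0,0)$), invariant under translation by $(n-k,k)$. The strip of $P$ is the region between the extended path $P$ (southern boundary) and $P+(0,k)$ (northern boundary). The southern edge labeled $i\in\mathbb{Z}$ is step $i$ of $P$, and the northern edge labeled $i$ is its translate by $(0,k)$. A periodic filling assigns to each unit box of the strip a crossing or an elbow, invariantly under translation by $(n-k,k)$. Strands enter at northern edges and travel right/down: in a crossing, left goes to right and top goes to bottom; in an elbow, a strand entering from the left exits at the bottom and one entering from the top exits right. The strand permutation sends $i$ to $j$ if the strand entering at northern edge $i$ exits at southern edge $j$. An $(f,P)$-affine Deogram is a periodic filling with strand permutation $f$ such that whenever two strands form an elbow, they have crossed each other an even number of times before it (counting from the northern boundary). $\mathcal{A}^r_{f,P}$ is the set of $(f,P)$-affine Deograms with exactly $r$ elbows modulo translation by $(n-k,k)$ (equivalently, distinguished $f$-subwords, with exactly $r$ unselected letters, of the reduced word obtained by reading the boxes of the strip from northwest to southeast); $\mathcal{A}^{r}_{f,P}=\varnothing$ for $r<0$. -}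

module Defs where

open import Data.Fin.Base using (Fin; toℕ; fromℕ<)
open import Data.Fin.Permutation using (transpose; _⟨$⟩ʳ_)
open import Data.Integer.Base using (ℤ; +_; -[1+_]; _+_; _-_; _*_; -_; _≤_; _<_; 0ℤ; 1ℤ)
open import Data.Integer.Divisibility.Signed using (_∣_; _∣?_; ∣⇒∣ᵤ; ∣m∣n⇒∣m+n; ∣m+n∣m⇒∣n; ∣-refl)
open import Data.Integer.DivMod using (_%ℕ_; n%ℕd<d)
open import Data.Integer.Properties using (_≟_; +-0-commutativeMonoid)
open import Data.Integer.Tactic.RingSolver using (solve-∀)
open import Data.List.Base using (List; []; _∷_; length; filter)
import Data.List.Membership.DecPropositional as DecMembership
open import Data.Nat.Base as ℕ using (ℕ; zero; suc; NonTrivial; NonZero; nonTrivial⇒nonZero)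
import Data.Nat.Divisibility as ℕ
open import Data.Product.Base using (∃₂; ∃-syntax; Σ-syntax; _×_; _,_; proj₁)
open import Data.Product.Properties using (≡-dec)
open import Function.Base using (_∘_)
open import Function.Bundles using (_↔_; mk↔ₛ′; Inverse)
open import Function.Construct.Composition using (_↔-∘_)
open import Level using (0ℓ)
open import Relation.Binary.Bundles using (Setoid)
open import Relation.Binary.PropositionalEquality using (_≡_; refl; sym; trans; cong; setoid)
open import Relation.Nullary using (¬_; yes; no; contradiction)

import Algebra.Properties.CommutativeMonoid.Sum as Sum
open Sum +-0-commutativeMonoid using (sum; sum-permute)

private
  instance
    nonZero : ∀ {n} .{{_ : NonTrivial n}} → NonZero n
    nonZero {n} = nonTrivial⇒nonZero n

-- The index set [n] = {1,…,n} is Fin n; lab sends an index to the integer it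
-- stands for, and residue sends an integer to its representative in [n] mod n.

lab : ∀ {n} → Fin n → ℤ
lab i = + suc (toℕ i)

residue : ∀ {n} .{{_ : NonTrivial n}} → ℤ → Fin n
residue {n} a = fromℕ< (n%ℕd<d (a - 1ℤ) n)

------------------------------------------------------------------------
-- Affine permutations

record AffinePerm (n : ℕ) : Set where
  field
    perm     : ℤ ↔ ℤ
    periodic : ∀ a → Inverse.to perm (a + + n) ≡ Inverse.to perm a + + n

infixl 20 _$_
_$_ : ∀ {n} → AffinePerm n → ℤ → ℤ
f $ a = Inverse.to (AffinePerm.perm f) a

-- Products are read from left to right: (f · g) $ a = g $ (f $ a).
infixl 21 _·_
_·_ : ∀ {n} → AffinePerm n → AffinePerm n → AffinePerm n
_·_ {n} f g = record
  { perm     = AffinePerm.perm g ↔-∘ AffinePerm.perm f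
  ; periodic = λ a → trans (cong (g $_) (AffinePerm.periodic f a))
                           (AffinePerm.periodic g (f $ a))
  }

-- For n ≥ 2 the first two cases are mutually exclusive.
swapAt : ℕ → ℤ → ℤ → ℤ
swapAt n i a with + n ∣? a - i | + n ∣? a - (i + 1ℤ)
... | yes _ | _     = a + 1ℤ
... | no  _ | yes _ = a - 1ℤ
... | no  _ | no  _ = a

private
  module _ {n : ℕ} .{{_ : NonTrivial n}} (i : ℤ) where

    n∤1 : ¬ (+ n ∣ 1ℤ)
    n∤1 d = ℕ.nonTrivial⇒≢1 {n} (ℕ.∣1⇒≡1 (∣⇒∣ᵤ d))

    shift-∣ : ∀ {a b} → a ≡ b → + n ∣ a → + n ∣ b
    shift-∣ refl d = d

    e₁ : ∀ a i → a + 1ℤ - i ≡ (a - i) + 1ℤ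
    e₁ = solve-∀

    e₂ : ∀ a i → (a - i) ≡ a + 1ℤ - (i + 1ℤ)
    e₂ = solve-∀

    e₃ : ∀ a i → a - (i + 1ℤ) ≡ a - 1ℤ - i
    e₃ = solve-∀

    e₄ : ∀ a → a + 1ℤ - 1ℤ ≡ a
    e₄ = solve-∀

    e₅ : ∀ a → a - 1ℤ + 1ℤ ≡ a
    e₅ = solve-∀

    e₆ : ∀ a i m → (a - i) + m ≡ a + m - i
    e₆ = solve-∀

    e₇ : ∀ a m → a + m + 1ℤ ≡ a + 1ℤ + m
    e₇ = solve-∀

    e₈ : ∀ a m → a + m - 1ℤ ≡ a - 1ℤ + m
    e₈ = solve-∀

    up : ∀ a → + n ∣ a - i → swapAt n i a ≡ a + 1ℤ
    up a d with + n ∣? a - i | + n ∣? a - (i + 1ℤ)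
    ... | yes _ | _ = refl
    ... | no ¬d | _ = contradiction d ¬d

    down : ∀ a → + n ∣ a - (i + 1ℤ) → swapAt n i a ≡ a - 1ℤ
    down a d with + n ∣? a - i | + n ∣? a - (i + 1ℤ)
    ... | yes d′ | _     = contradiction (∣m+n∣m⇒∣n (shift-∣ (split a i) d′) d) n∤1
      where
      split : ∀ a i → a - i ≡ (a - (i + 1ℤ)) + 1ℤ
      split = solve-∀
    ... | no _   | yes _ = refl
    ... | no _   | no ¬d = contradiction d ¬d

    stay : ∀ a → ¬ (+ n ∣ a - i) → ¬ (+ n ∣ a - (i + 1ℤ)) → swapAt n i a ≡ a
    stay a ¬d ¬d′ with + n ∣? a - i | + n ∣? a - (i + 1ℤ)
    ... | yes d | _     = contradiction d ¬d
    ... | no _  | yes d = contradiction d ¬d′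
    ... | no _  | no _  = refl

    swapAt-involutive : ∀ a → swapAt n i (swapAt n i a) ≡ a
    swapAt-involutive a with + n ∣? a - i | + n ∣? a - (i + 1ℤ)
    ... | yes d | _     = trans (down (a + 1ℤ) (shift-∣ (e₂ a i) d)) (e₄ a)
    ... | no _  | yes d = trans (up (a - 1ℤ) (shift-∣ (e₃ a i) d)) (e₅ a)
    ... | no ¬d | no ¬e = stay a ¬d ¬e

    +n : ∀ a j → + n ∣ a - j → + n ∣ a + + n - j
    +n a j d = shift-∣ (e₆ a j (+ n)) (∣m∣n⇒∣m+n d ∣-refl)

    -n : ∀ a j → + n ∣ a + + n - j → + n ∣ a - j
    -n a j d = ∣m+n∣m⇒∣n (shift-∣ (comm′ a j (+ n)) d) ∣-refl
      where
      comm′ : ∀ a i m → a + m - i ≡ m + (a - i)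
      comm′ = solve-∀

    swapAt-periodic : ∀ a → swapAt n i (a + + n) ≡ swapAt n i a + + n
    swapAt-periodic a with + n ∣? a - i | + n ∣? a - (i + 1ℤ)
    ... | yes d | _     = trans (up (a + + n) (+n a i d)) (e₇ a (+ n))
    ... | no _  | yes d = trans (down (a + + n) (+n a (i + 1ℤ) d)) (e₈ a (+ n))
    ... | no ¬d | no ¬e = stay (a + + n) (¬d ∘ -n a i) (¬e ∘ -n a (i + 1ℤ))

s : ∀ {n} .{{_ : NonTrivial n}} → Fin n → AffinePerm n
s {n} i = record
  { perm     = mk↔ₛ′ (swapAt n (lab i)) (swapAt n (lab i))
                     (swapAt-involutive (lab i)) (swapAt-involutive (lab i))
  ; periodic = swapAt-periodic (lab i)
  }

record 𝐁 (k n : ℕ) (f : AffinePerm n) : Set where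
  field
    -- The condition that the average of f(i) - i is k, multiplied by n.
    average : sum {n} (λ i → f $ lab i - lab i) ≡ + n * + k
    lower   : ∀ a → a ≤ f $ a
    upper   : ∀ a → f $ a ≤ a + + n

Inversion : ∀ {n} → AffinePerm n → Set
Inversion {n} f = Σ[ a ∈ Fin n ] Σ[ b ∈ ℤ ] (lab a < b × f $ b < f $ lab a)

-- ℓ f ≔ m  says that the length of f is m.  Every affine permutation has
-- exactly one length, so _≻_ is the comparison of lengths.
ℓ_≔_ : ∀ {n} → AffinePerm n → ℕ → Set
ℓ f ≔ m = Fin m ↔ Inversion f

infix 4 _≻_
_≻_ : ∀ {n} → AffinePerm n → AffinePerm n → Set
g ≻ f = ∃₂ λ l m → (ℓ g ≔ l) × (ℓ f ≔ m) × m ℕ.< l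

------------------------------------------------------------------------
-- Lattice paths

data Step : Set where
  R U : Step

dx dy : Step → ℤ
dx R = 1ℤ
dx U = 0ℤ
dy R = 0ℤ
dy U = 1ℤ

record 𝒫 (k n : ℕ) : Set where
  field
    step : Fin n → Step
    endX : sum (dx ∘ step) ≡ + n - + k
    endY : sum (dy ∘ step) ≡ + k

module _ {k n : ℕ} .{{_ : NonTrivial n}} where

  infixr 21 _•_
  _•_ : Fin n → 𝒫 k n → 𝒫 k n
  i • P = record
    { step = step ∘ (π ⟨$⟩ʳ_)
    ; endX = trans (sym (sum-permute (dx ∘ step) π)) endX
    ; endY = trans (sym (sum-permute (dy ∘ step) π)) endY
    }
    where
    open 𝒫 P
    π = transpose i (residue (lab i + 1ℤ))

  infix 22 _at_
  _at_ : 𝒫 k n → ℤ → Step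
  P at j = 𝒫.step P (residue j)

-- The function vanishing at 0 with increment g j from j - 1 to j.
partialSum : (ℤ → ℤ) → ℤ → ℤ
partialSum g (+ zero)      = 0ℤ
partialSum g (+ suc m)     = partialSum g (+ m) + g (+ suc m)
partialSum g -[1+ zero ]   = - g 0ℤ
partialSum g -[1+ suc m ]  = partialSum g -[1+ m ] - g -[1+ m ]

-- horizontal x y joins (x , y) to (x + 1 , y); vertical x y joins (x , y) to (x , y + 1).
data Edge : Set where
  horizontal vertical : ℤ → ℤ → Edge

------------------------------------------------------------------------
-- The strip and its fillings

data Tile : Set where
  crossing elbow : Tile

data Side : Set where
  left top : Side

module Strip {k n : ℕ} .{{_ : NonTrivial n}} (P : 𝒫 k n) where

  -- Step j of the extended path goes from (px (j - 1) , py (j - 1)) to (px j , py j).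
  px py : ℤ → ℤ
  px = partialSum (dx ∘ (P at_))
  py = partialSum (dy ∘ (P at_))

  edgeOf : Step → ℤ → ℤ → Edge
  edgeOf R = horizontal
  edgeOf U = vertical

  south north : ℤ → Edge
  south j = edgeOf (P at j) (px (j - 1ℤ)) (py (j - 1ℤ))
  north j = edgeOf (P at j) (px (j - 1ℤ)) (py (j - 1ℤ) + + k)

  -- The unit box with lower left corner (x , y) lies in the strip iff it lies
  -- above the R-step of P in its column and below the translate of that step.
  InStrip : ℤ → ℤ → Set
  InStrip x y = ∃[ j ] P at j ≡ R × px (j - 1ℤ) ≡ x
                     × py (j - 1ℤ) ≤ y × y < py (j - 1ℤ) + + k

  record Box : Set where
    constructor box
    field
      x y     : ℤ
      .inside : InStrip x y

  open Box public

  infix 4 _∼_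
  _∼_ : Box → Box → Set
  b ∼ c = ∃[ m ] x c ≡ x b + m * (+ n - + k) × y c ≡ y b + m * + k

  record Filling : Set where
    field
      tile     : Box → Tile
      periodic : ∀ b c → b ∼ c → tile b ≡ tile c

  open Filling public

  entry : Box → Side → Edge
  entry b left = vertical (x b) (y b)
  entry b top  = horizontal (x b) (y b + 1ℤ)

  right bottom : Box → Edge
  right  b = vertical (x b + 1ℤ) (y b)
  bottom b = horizontal (x b) (y b)

  exit : Tile → Box → Side → Edge
  exit crossing b left = right b
  exit crossing b top  = bottom b
  exit elbow    b left = bottom b
  exit elbow    b top  = right b

  -- Strand F a e is the initial segment, running from northern edge a to the
  -- edge e, of the strand that enters at northern edge a.
  data Strand (F : Filling) (a : ℤ) : Edge → Set where
    enter : Strand F a (north a)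
    pass  : (b : Box) (σ : Side) → Strand F a (entry b σ) →
            Strand F a (exit (tile F b) b σ)

  module _ {F : Filling} where

    crossingsOn : ∀ {a e} → Strand F a e → List (ℤ × ℤ)
    crossingsOn enter        = []
    crossingsOn (pass b σ w) with tile F b
    ... | crossing = (x b , y b) ∷ crossingsOn w
    ... | elbow    = crossingsOn w

    open DecMembership (≡-dec _≟_ _≟_) using (_∈?_)

    -- Distinct strands through a common box enter it from different sides, so
    -- they cross there iff its tile is a crossing.
    #crossings : ∀ {a b e e′} → Strand F a e → Strand F b e′ → ℕ
    #crossings v w = length (filter (_∈? crossingsOn w) (crossingsOn v))

  HasStrandPermutation : Filling → AffinePerm n → Set
  HasStrandPermutation F f = ∀ a → Strand F a (south (f $ a))

  Distinguished : Filling → Set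
  Distinguished F = ∀ a b (c : Box) → tile F c ≡ elbow →
    (v : Strand F a (entry c left)) (w : Strand F b (entry c top)) →
    2 ℕ.∣ #crossings v w

  -- Elbows of F modulo translation.
  Elbows : Filling → Setoid 0ℓ 0ℓ
  Elbows F = record
    { Carrier       = Σ[ b ∈ Box ] tile F b ≡ elbow
    ; _≈_           = λ b c → proj₁ b ∼ proj₁ c
    ; isEquivalence = record
      { refl  = λ {b} → 0ℤ , null (x (proj₁ b)) (+ n - + k) , null (y (proj₁ b)) (+ k)
      ; sym   = λ {b} (m , p , q) →
                  - m , neg (x (proj₁ b)) m _ p , neg (y (proj₁ b)) m _ q
      ; trans = λ {b} (m , p , q) (m′ , p′ , q′) →
                  m + m′ , add (x (proj₁ b)) m m′ _ p p′ , add (y (proj₁ b)) m m′ _ q q′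
      }
    }
    where
    null : ∀ u t → u ≡ u + 0ℤ * t
    null = solve-∀

    neg′ : ∀ u m t → u ≡ u + m * t + - m * t
    neg′ = solve-∀

    neg : ∀ u {v} m t → v ≡ u + m * t → u ≡ v + - m * t
    neg u m t refl = neg′ u m t

    add′ : ∀ u m m′ t → u + m * t + m′ * t ≡ u + (m + m′) * t
    add′ = solve-∀

    add : ∀ u {v w} m m′ t → v ≡ u + m * t → w ≡ v + m′ * t → w ≡ u + (m + m′) * t
    add u m m′ t refl refl = add′ u m m′ t

  HasElbows : Filling → ℕ → Set
  HasElbows F m = Inverse (setoid (Fin m)) (Elbows F)

-- There are none when r is negative.
record Deogram {k n : ℕ} .{{_ : NonTrivial n}}
               (r : ℤ) (f : AffinePerm n) (P : 𝒫 k n) : Set where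
  open Strip P
  field
    filling       : Filling
    strandPerm    : HasStrandPermutation filling f
    distinguished : Distinguished filling
    elbows        : ∃[ m ] r ≡ + m × HasElbows filling m

-- Deograms are identified when they have the same tiles.
𝒜 : ∀ {k n} .{{_ : NonTrivial n}} → ℤ → AffinePerm n → 𝒫 k n → Setoid 0ℓ 0ℓ
𝒜 r f P = record
  { Carrier       = Deogram r f P
  ; _≈_           = λ D E → ∀ b → tile (filling D) b ≡ tile (filling E) b
  ; isEquivalence = record
    { refl  = λ b → refl
    ; sym   = λ p b → sym (p b)
    ; trans = λ p q b → trans (p b) (q b)
    }
  }
  where
  open Strip P
  open Deogram

{-# OPTIONS --safe #-}

-- The strip of P is read as a word of corner flips leading from the northern
-- boundary down to P; on each antidiagonal the position of an edge of a path is
-- its index, so the strands met by the current path form an affine permutation.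
-- Two strands have crossed an even number of times iff they still appear in their
-- original order, so a Deogram is a distinguished subword: an elbow at the
-- positions j, j + 1 requires the label at j to be smaller than the one at j + 1.
--
-- If w leads from the northern boundary to P with its corner at i raised, then P
-- has the word w s_i and s_i P the word s_{i+k} w, where the new first letter
-- acts on labels as s_i. Removing the last letter of w s_i and the first letter
-- of s_{i+k} w reduces the lemma to the left recursion of the R-polynomials,
-- which is made bijective by induction on w, following the strands i and i + 1.

module Submission where

open import Defs
import Algebra.Properties.CommutativeMonoid.Sum as Sum
open import Data.Fin.Base using (Fin; zero; suc)
open import Data.Fin.Permutation using (↔⇒≡)
import Data.Fin.Permutation.Components as Fin
open import Data.Fin.Properties as Fin
  using (any?; injective⇒≤; toℕ-inject₁; toℕ-fromℕ; toℕ<n; toℕ-fromℕ<; toℕ-injective)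
open import Data.Integer.Base
  using (ℤ; +_; -[1+_]; _+_; _-_; _*_; -_; 0ℤ; 1ℤ; ∣_∣; +≤+; -≤+; +<+)
open import Data.Integer.DivMod using (_/ℕ_; _%ℕ_; n%ℕd<d; a≡a%ℕn+[a/ℕn]*n)
open import Data.Integer.Divisibility.Signed
  using (_∣_; _∣?_; divides; ∣⇒∣ᵤ; ∣m⇒∣-m; ∣m∣n⇒∣m+n)
open import Data.Integer.Properties
open import Data.Integer.Tactic.RingSolver using (solve-∀)
open import Data.List.Base using (List; []; _∷_; _∷ʳ_; filter; length)
import Data.List.Membership.DecPropositional as DecMembership
open import Data.List.Membership.Propositional using (_∈_; _∉_)
open import Data.List.Properties using (filter-reject; filter-accept)
open import Data.List.Relation.Unary.All as All using (All; []; _∷_)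
open import Data.List.Relation.Unary.Any using (here; there)
open import Data.Nat.Base as ℕ using (ℕ; NonTrivial; NonZero; nonTrivial⇒nonZero)
import Data.Nat.Divisibility as ℕ
import Data.Nat.Properties as ℕ
open import Data.Product.Base using (Σ-syntax; ∃-syntax; _×_; _,_; proj₁; proj₂)
open import Data.Product.Properties using (≡-dec)
open import Data.Sum.Base using (_⊎_; inj₁; inj₂; [_,_]; map; swap)
open import Data.Sum.Function.Setoid using (_⊎-inverse_)
open import Data.Sum.Relation.Binary.Pointwise using (_⊎ₛ_; inj₁; inj₂)
open import Data.Vec.Base using (Vec; []; _∷_)
open import Function.Base using (_∘_; id)
open import Function.Bundles using (Inverse; mk↔ₛ′)
import Function.Construct.Composition as Composition
import Function.Construct.Identity as Identity
import Function.Construct.Symmetry as Symmetry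
open import Function.Definitions using (Injective)
open import Level using (0ℓ)
open import Relation.Binary.Bundles using (Setoid)
open import Relation.Binary.PropositionalEquality
  using (_≡_; _≢_; refl; sym; trans; cong; cong₂; subst; subst₂; setoid; module ≡-Reasoning)
open import Relation.Nullary using (¬_; yes; no; contradiction; Dec)
open import Relation.Nullary.Decidable
  using (_×-dec_; decidable-stable; dec-true; dec-false; map′; recompute)

open Sum +-0-commutativeMonoid using (sum; sum-init-last; sum-cong-≗)
open Sum ℕ.+-0-commutativeMonoid using () renaming (sum to sumℕ)

-- Raising the corner of P at i by one box also raises the translated corner of the northern
-- boundary. Hence, modulo translation, the strips of P and s_i P differ by one box each, at the
-- bottom of the first and at the top of the second, and one `w` serves both: two words for the same
-- region never have to be compared. The northern copy of position i lies k antidiagonals further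
-- on, whence the letter i + k. The left recursion does not close under induction. Where the strands
-- i and i + 1 meet, a crossing replaces the labelling `u` by `u · s i`, so subwords starting from
-- `u · s i` need a statement of their own, `left-symmetry`, proved in the same induction. The
-- recursion is applied to `f · s i`, and in the ascending case also to `f`. For `f · s i` it
-- requires values increasing from i to i + 1, which can fail only if `s i` exchanges f(i) and f(i +
-- 1); the bounds on `f` and `s i · f` exclude that.

-- Bijections of setoids

infix 1 _≃_
_≃_ : Setoid 0ℓ 0ℓ → Setoid 0ℓ 0ℓ → Set
A ≃ B = Inverse A B

infixr 2 _⨾_
_⨾_ : ∀ {A B C : Setoid 0ℓ 0ℓ} → A ≃ B → B ≃ C → A ≃ C
_⨾_ = Composition.inverse

≃-sym : ∀ {A B : Setoid 0ℓ 0ℓ} → A ≃ B → B ≃ A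
≃-sym = Symmetry.inverse

≃-refl : ∀ {A : Setoid 0ℓ 0ℓ} → A ≃ A
≃-refl {A} = Identity.inverse A

module _ {A B : Setoid 0ℓ 0ℓ} where
  private
    module A = Setoid A
    module B = Setoid B

  mk≃ : (to : A.Carrier → B.Carrier) (from : B.Carrier → A.Carrier) →
        (∀ {x y} → x A.≈ y → to x B.≈ to y) → (∀ {x y} → x B.≈ y → from x A.≈ from y) →
        (∀ y → to (from y) B.≈ y) → (∀ x → from (to x) A.≈ x) → A ≃ B
  mk≃ to from to-cong from-cong to∘from from∘to = record
    { to        = to
    ; from      = from
    ; to-cong   = to-cong
    ; from-cong = from-cong
    ; inverse   = (λ p → B.trans (to-cong p) (to∘from _)) , (λ p → A.trans (from-cong p) (from∘to _))
    }

⊎-emptyʳ : ∀ {A B : Setoid 0ℓ 0ℓ} → ¬ Setoid.Carrier B → A ≃ A ⊎ₛ B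
⊎-emptyʳ {A} ¬B = mk≃ inj₁ [ id , (λ b → contradiction b ¬B) ] inj₁
  (λ { (inj₁ p) → p ; {inj₂ b} → contradiction b ¬B })
  (λ { (inj₁ _) → inj₁ A.refl ; (inj₂ b) → contradiction b ¬B })
  (λ _ → A.refl)
  where module A = Setoid A

⊎-interchange : ∀ {A B C D : Setoid 0ℓ 0ℓ} → (A ⊎ₛ B) ⊎ₛ (C ⊎ₛ D) ≃ (A ⊎ₛ C) ⊎ₛ (B ⊎ₛ D)
⊎-interchange {A} {B} {C} {D} = mk≃ to to (to-cong {A} {B} {C} {D}) (to-cong {A} {C} {B} {D})
  (λ { (inj₁ (inj₁ _)) → inj₁ (inj₁ A.refl) ; (inj₁ (inj₂ _)) → inj₁ (inj₂ C.refl)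
     ; (inj₂ (inj₁ _)) → inj₂ (inj₁ B.refl) ; (inj₂ (inj₂ _)) → inj₂ (inj₂ D.refl) })
  (λ { (inj₁ (inj₁ _)) → inj₁ (inj₁ A.refl) ; (inj₁ (inj₂ _)) → inj₁ (inj₂ B.refl)
     ; (inj₂ (inj₁ _)) → inj₂ (inj₁ C.refl) ; (inj₂ (inj₂ _)) → inj₂ (inj₂ D.refl) })
  where
  module A = Setoid A
  module B = Setoid B
  module C = Setoid C
  module D = Setoid D
  to : ∀ {A B C D : Set} → (A ⊎ B) ⊎ (C ⊎ D) → (A ⊎ C) ⊎ (B ⊎ D)
  to (inj₁ (inj₁ a)) = inj₁ (inj₁ a)
  to (inj₁ (inj₂ b)) = inj₂ (inj₁ b)
  to (inj₂ (inj₁ c)) = inj₁ (inj₂ c)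
  to (inj₂ (inj₂ d)) = inj₂ (inj₂ d)
  to-cong : ∀ {A B C D : Setoid 0ℓ 0ℓ} {x y} →
            Setoid._≈_ ((A ⊎ₛ B) ⊎ₛ (C ⊎ₛ D)) x y → Setoid._≈_ ((A ⊎ₛ C) ⊎ₛ (B ⊎ₛ D)) (to x) (to y)
  to-cong (inj₁ (inj₁ a)) = inj₁ (inj₁ a)
  to-cong (inj₁ (inj₂ b)) = inj₂ (inj₁ b)
  to-cong (inj₂ (inj₁ c)) = inj₁ (inj₂ c)
  to-cong (inj₂ (inj₂ d)) = inj₂ (inj₂ d)

⊎-comm : ∀ {A B : Setoid 0ℓ 0ℓ} → A ⊎ₛ B ≃ B ⊎ₛ A
⊎-comm {A} {B} = mk≃ swap swap (λ { (inj₁ p) → inj₂ p ; (inj₂ p) → inj₁ p })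
  (λ { (inj₁ p) → inj₂ p ; (inj₂ p) → inj₁ p })
  (λ { (inj₁ _) → inj₁ (Setoid.refl B) ; (inj₂ _) → inj₂ (Setoid.refl A) })
  (λ { (inj₁ _) → inj₁ (Setoid.refl A) ; (inj₂ _) → inj₂ (Setoid.refl B) })

module Affine (n : ℕ) .{{nt : NonTrivial n}} where

  open import Data.Integer.Base using (_≤_; _<_)

  instance
    nonZero : NonZero n
    nonZero = nonTrivial⇒nonZero n

  -- An inequality follows from others once the slacks add up.

  lin₁ : ∀ {a b x y} → a ≤ b → y - x ≡ b - a → x ≤ y
  lin₁ p e = 0≤i-j⇒j≤i (subst (0ℤ ≤_) (sym e) (i≤j⇒0≤j-i p))

  lin₂ : ∀ {a b c d x y} → a ≤ b → c ≤ d → y - x ≡ (b - a) + (d - c) → x ≤ y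
  lin₂ p q e = 0≤i-j⇒j≤i (subst (0ℤ ≤_) (sym e) (+-mono-≤ (i≤j⇒0≤j-i p) (i≤j⇒0≤j-i q)))

  lin₃ : ∀ {a b c d u v x y} → a ≤ b → c ≤ d → u ≤ v →
         y - x ≡ (b - a) + (d - c) + (v - u) → x ≤ y
  lin₃ p q r e = 0≤i-j⇒j≤i (subst (0ℤ ≤_) (sym e)
    (+-mono-≤ (+-mono-≤ (i≤j⇒0≤j-i p) (i≤j⇒0≤j-i q)) (i≤j⇒0≤j-i r)))

  <⇒+1≤ : ∀ {a b} → a < b → a + 1ℤ ≤ b
  <⇒+1≤ {a} p = subst (_≤ _) (+-comm 1ℤ a) (i<j⇒suc[i]≤j p)

  +1≤⇒< : ∀ {a b} → a + 1ℤ ≤ b → a < b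
  +1≤⇒< {a} p = suc[i]≤j⇒i<j (subst (_≤ _) (+-comm a 1ℤ) p)

  a<a+1 : ∀ a → a < a + 1ℤ
  a<a+1 a = +1≤⇒< ≤-refl

  a-1<a : ∀ a → a - 1ℤ < a
  a-1<a a = +1≤⇒< (≤-reflexive (e a))
    where e : ∀ a → a - 1ℤ + 1ℤ ≡ a
          e = solve-∀

  -1+1 : ∀ a → a - 1ℤ + 1ℤ ≡ a
  -1+1 = solve-∀

  +1-1 : ∀ a → a + 1ℤ - 1ℤ ≡ a
  +1-1 = solve-∀

  ≮⇒> : ∀ {a b} → ¬ (a < b) → a ≢ b → b < a
  ≮⇒> p q = ≤∧≢⇒< (≮⇒≥ p) (q ∘ sym)

  -- Congruence modulo n

  infix 4 _≋_ _≋?_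
  -- A record instead of a synonym for `+ n ∣ a - b`: unification recovers `a` and `b` from the
  -- record type, but not from their difference.
  record _≋_ (a b : ℤ) : Set where
    constructor mod
    field divisible : + n ∣ a - b

  _≋?_ : ∀ a b → Dec (a ≋ b)
  a ≋? b = map′ mod _≋_.divisible (+ n ∣? a - b)

  ≋-intro : ∀ {a b} q → a ≡ b + q * + n → a ≋ b
  ≋-intro {b = b} q refl = mod (divides q (e b (q * + n)))
    where e : ∀ b m → b + m - b ≡ m
          e = solve-∀

  ≋-elim : ∀ {a b} → a ≋ b → ∃[ q ] a ≡ b + q * + n
  ≋-elim {a} {b} (mod (divides q p)) = q , trans (e a b) (cong (_+_ b) p)
    where e : ∀ a b → a ≡ b + (a - b)
          e = solve-∀

  ≋-reflexive : ∀ {a b} → a ≡ b → a ≋ b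
  ≋-reflexive {a} refl = ≋-intro 0ℤ (sym (+-identityʳ a))

  ≋-refl : ∀ {a} → a ≋ a
  ≋-refl = ≋-reflexive refl

  ≋-sym : ∀ {a b} → a ≋ b → b ≋ a
  ≋-sym {a} {b} (mod p) = mod (subst (+ n ∣_) (e a b) (∣m⇒∣-m p))
    where e : ∀ a b → - (a - b) ≡ b - a
          e = solve-∀

  ≋-trans : ∀ {a b c} → a ≋ b → b ≋ c → a ≋ c
  ≋-trans {a} {b} {c} (mod p) (mod q) = mod (subst (+ n ∣_) (e a b c) (∣m∣n⇒∣m+n p q))
    where e : ∀ a b c → (a - b) + (b - c) ≡ a - c
          e = solve-∀

  ≋-+ : ∀ {a b} c → a ≋ b → a + c ≋ b + c
  ≋-+ {a} {b} c (mod p) = mod (subst (+ n ∣_) (e a b c) p)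
    where e : ∀ a b c → a - b ≡ a + c - (b + c)
          e = solve-∀

  ≋-+⁻ : ∀ {a b} c → a + c ≋ b + c → a ≋ b
  ≋-+⁻ {a} {b} c (mod p) = mod (subst (+ n ∣_) (e a b c) p)
    where e : ∀ a b c → a + c - (b + c) ≡ a - b
          e = solve-∀

  ≋-shift : ∀ a q → a + q * + n ≋ a
  ≋-shift a q = ≋-intro q refl

  a+1≋̸a : ∀ {a} → ¬ (a + 1ℤ ≋ a)
  a+1≋̸a {a} (mod d) = ℕ.nonTrivial⇒≢1 {n} (ℕ.∣1⇒≡1 (∣⇒∣ᵤ (subst (+ n ∣_) (e a) d)))
    where e : ∀ a → a + 1ℤ - a ≡ 1ℤ
          e = solve-∀

  2≤n : + 2 ≤ + n
  2≤n = +≤+ (ℕ.nonTrivial⇒n>1 n)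

  -- The difference is a positive multiple `q * + n`, and positivity leaves only `q ≥ 1`.
  gap : ∀ {a b} → a ≋ b → a < b → a + + n ≤ b
  gap {a} {b} p a<b with ≋-elim (≋-sym p)
  ... | q , refl = +-monoʳ-≤ a (go q (pos (subst (_< a + q * + n) (sym (+-identityʳ a)) a<b)))
    where
    pos : a + 0ℤ < a + q * + n → 0ℤ < q * + n
    pos p = +1≤⇒< (lin₁ (<⇒+1≤ p) (e a (q * + n)))
      where e : ∀ a m → m - (0ℤ + 1ℤ) ≡ a + m - (a + 0ℤ + 1ℤ)
            e = solve-∀
    go : ∀ q → 0ℤ < q * + n → + n ≤ q * + n
    go (+ 0)       0<  = contradiction 0< (<-irrefl refl)
    go (+ ℕ.suc m) 0<  = subst (+ n ≤_) (pos-* (ℕ.suc m) n) (+≤+ (ℕ.m≤m+n n (m ℕ.* n)))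
    go -[1+ m ]    0<  = contradiction (<-≤-trans 0< (*-monoʳ-≤-nonNeg (+ n) (-≤+ {m} {0}))) (<-irrefl refl)

  lab-residue : ∀ a → a ≋ lab {n} (residue a)
  lab-residue a = ≋-intro ((a - 1ℤ) /ℕ n) (begin
    a                                     ≡⟨ -1+1 a ⟨
    a - 1ℤ + 1ℤ                           ≡⟨ cong (_+ 1ℤ) (a≡a%ℕn+[a/ℕn]*n (a - 1ℤ) n) ⟩
    + r + q * + n + 1ℤ                    ≡⟨ e (+ r) (q * + n) ⟩
    1ℤ + + r + q * + n                    ≡⟨ cong (λ t → + ℕ.suc t + q * + n) (toℕ-fromℕ< (n%ℕd<d (a - 1ℤ) n)) ⟨
    lab {n} (residue a) + q * + n         ∎)
    where
    open ≡-Reasoning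
    q = (a - 1ℤ) /ℕ n
    r = (a - 1ℤ) %ℕ n
    e : ∀ r m → r + m + 1ℤ ≡ 1ℤ + r + m
    e = solve-∀

  lab≤n : ∀ (i : Fin n) → lab i ≤ + n
  lab≤n i = +≤+ (toℕ<n i)

  1≤lab : ∀ (i : Fin n) → 1ℤ ≤ lab i
  1≤lab i = +≤+ (ℕ.s≤s ℕ.z≤n)

  lab-injective : ∀ {i j : Fin n} → lab i ≡ lab j → i ≡ j
  lab-injective e = toℕ-injective (ℕ.suc-injective (+-injective e))

  private
    lab≋-≮ : ∀ {i j : Fin n} → lab i ≋ lab j → ¬ (lab i < lab j)
    lab≋-≮ {i} {j} p q = contradiction (lin₃ {x = 1ℤ} {0ℤ} (gap p q) (lab≤n j) (1≤lab i) (e (lab i) (lab j) (+ n))) λ { (+≤+ ()) }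
      where e : ∀ a b n → 0ℤ - 1ℤ ≡ (b - (a + n)) + (n - b) + (a - 1ℤ)
            e = solve-∀

  lab-≋-injective : ∀ {i j : Fin n} → lab i ≋ lab j → i ≡ j
  lab-≋-injective p = lab-injective (≤-antisym (≮⇒≥ (lab≋-≮ (≋-sym p))) (≮⇒≥ (lab≋-≮ p)))

  residue-cong : ∀ {a b} → a ≋ b → residue {n} a ≡ residue b
  residue-cong {a} {b} p = lab-≋-injective
    (≋-trans (≋-sym (lab-residue a)) (≋-trans p (lab-residue b)))

  residue-lab : ∀ (i : Fin n) → residue (lab i) ≡ i
  residue-lab i = lab-≋-injective (≋-sym (lab-residue (lab i)))

  -- Simple reflections

  -- Indexed by the value, so that one match decides the residue class and replaces `swapAt n i a`
  -- at the same time.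
  data SwapView (i a : ℤ) : ℤ → Set where
    up   : a ≋ i → SwapView i a (a + 1ℤ)
    down : a ≋ i + 1ℤ → SwapView i a (a - 1ℤ)
    stay : ¬ (a ≋ i) → ¬ (a ≋ i + 1ℤ) → SwapView i a a

  swapView : ∀ i a → SwapView i a (swapAt n i a)
  swapView i a with + n ∣? a - i | + n ∣? a - (i + 1ℤ)
  ... | yes p | _     = up (mod p)
  ... | no  _ | yes q = down (mod q)
  ... | no ¬p | no ¬q = stay (¬p ∘ _≋_.divisible) (¬q ∘ _≋_.divisible)

  swap-up : ∀ {i a} → a ≋ i → swapAt n i a ≡ a + 1ℤ
  swap-up {i} {a} p with swapAt n i a | swapView i a
  ... | _ | up _      = refl
  ... | _ | down q    = contradiction (≋-trans (≋-sym q) p) a+1≋̸a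
  ... | _ | stay ¬p _ = contradiction p ¬p

  swap-down : ∀ {i a} → a ≋ i + 1ℤ → swapAt n i a ≡ a - 1ℤ
  swap-down {i} {a} p with swapAt n i a | swapView i a
  ... | _ | up q      = contradiction (≋-trans (≋-sym p) q) a+1≋̸a
  ... | _ | down q    = refl
  ... | _ | stay _ ¬p = contradiction p ¬p

  swap-stay : ∀ {i a} → ¬ (a ≋ i) → ¬ (a ≋ i + 1ℤ) → swapAt n i a ≡ a
  swap-stay {i} {a} ¬p ¬q with swapAt n i a | swapView i a
  ... | _ | up p     = contradiction p ¬p
  ... | _ | down q   = contradiction q ¬q
  ... | _ | stay _ _ = refl

  swap-cong : ∀ {i j} → i ≋ j → ∀ a → swapAt n i a ≡ swapAt n j a
  swap-cong {i} {j} p a with swapAt n i a | swapView i a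
  ... | _ | up q       = sym (swap-up (≋-trans q p))
  ... | _ | down q     = sym (swap-down (≋-trans q (≋-+ 1ℤ p)))
  ... | _ | stay ¬q ¬r = sym (swap-stay (λ q → ¬q (≋-trans q (≋-sym p)))
                                        (λ q → ¬r (≋-trans q (≋-+ 1ℤ (≋-sym p)))))

  -- Each argument moves by at most one. The tight case is `a` moving up and `b` moving down: then
  -- `a + 1` and `b` are congruent, and unless equal they are at least `n ≥ 2` apart, which leaves
  -- room for both moves.
  swap-mono : ∀ {i a b} → a < b → ¬ (a ≋ i × b ≡ a + 1ℤ) → swapAt n i a < swapAt n i b
  swap-mono {i} {a} {b} a<b ¬m with swapAt n i a | swapView i a | swapAt n i b | swapView i b
  ... | _ | up p    | _ | up q   = +-monoˡ-< 1ℤ a<b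
  ... | _ | up p    | _ | down q = +1≤⇒< (lin₂ (gap (≋-trans (≋-+ 1ℤ p) (≋-sym q)) a+1<b) 2≤n (e a b (+ n)))
    where
    a+1<b : a + 1ℤ < b
    a+1<b = ≤∧≢⇒< (<⇒+1≤ a<b) λ e → ¬m (p , sym e)
    e : ∀ a b n → b - 1ℤ - (a + 1ℤ + 1ℤ) ≡ (b - (a + 1ℤ + n)) + (n - (1ℤ + 1ℤ))
    e = solve-∀
  ... | _ | up p     | _ | stay _ _  = ≤∧≢⇒< (<⇒+1≤ a<b) λ e → ¬m (p , sym e)
  ... | _ | down p   | _ | up q      = <-trans (a-1<a a) (<-trans a<b (a<a+1 b))
  ... | _ | down p   | _ | down q    = +-monoˡ-< (- 1ℤ) a<b
  ... | _ | down p   | _ | stay _ _  = <-trans (a-1<a a) a<b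
  ... | _ | stay _ _ | _ | up q      = <-trans a<b (a<a+1 b)
  ... | _ | stay ¬p _ | _ | down q   = ≤∧≢⇒< (subst (_≤ b - 1ℤ) (+1-1 a) (+-monoˡ-≤ (- 1ℤ) (<⇒+1≤ a<b)))
    λ e → ¬p (≋-+⁻ 1ℤ (subst (_≋ i + 1ℤ) (trans (sym (-1+1 b)) (cong (_+ 1ℤ) (sym e))) q))
  ... | _ | stay _ _ | _ | stay _ _  = a<b

  swap-involutive : ∀ i a → swapAt n i (swapAt n i a) ≡ a
  swap-involutive i a with swapAt n i a | swapView i a
  ... | _ | up p       = trans (swap-down (≋-+ 1ℤ p)) (+1-1 a)
  ... | _ | down p     = trans (swap-up (≋-+⁻ 1ℤ (subst (_≋ i + 1ℤ) (sym (-1+1 a)) p))) (-1+1 a)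
  ... | _ | stay ¬p ¬q = swap-stay ¬p ¬q

  -- Affine permutations

  module _ (f : AffinePerm n) where

    $-injective : ∀ {a b} → f $ a ≡ f $ b → a ≡ b
    $-injective {a} {b} e = trans (sym (inv a)) (trans (cong (Inverse.from (AffinePerm.perm f)) e) (inv b))
      where inv = Inverse.strictlyInverseʳ (AffinePerm.perm f)

    $-+ : ∀ a m → f $ (a + + m * + n) ≡ (f $ a) + + m * + n
    $-+ a 0         = trans (cong (f $_) (+-identityʳ a)) (sym (+-identityʳ (f $ a)))
    $-+ a (ℕ.suc m) = begin
      (f $ (a + + ℕ.suc m * + n))         ≡⟨ cong (f $_) (e a m) ⟩
      (f $ (a + + m * + n + + n))         ≡⟨ AffinePerm.periodic f _ ⟩
      (f $ (a + + m * + n)) + + n         ≡⟨ cong (_+ + n) ($-+ a m) ⟩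
      (f $ a) + + m * + n + + n           ≡⟨ e (f $ a) m ⟨
      (f $ a) + + ℕ.suc m * + n           ∎
      where
      open ≡-Reasoning
      e′ : ∀ a m n → a + (1ℤ + m) * n ≡ a + m * n + n
      e′ = solve-∀
      e : ∀ a m → a + + ℕ.suc m * + n ≡ a + + m * + n + + n
      e a m = e′ a (+ m) (+ n)

    $-shift : ∀ a q → f $ (a + q * + n) ≡ (f $ a) + q * + n
    $-shift a (+ m)    = $-+ a m
    $-shift a -[1+ m ] = begin
      (f $ (a + -[1+ m ] * + n))                               ≡⟨ e₁ (f $ (a + -[1+ m ] * + n)) (+ ℕ.suc m * + n) ⟩
      (f $ (a + -[1+ m ] * + n)) + + ℕ.suc m * + n - + ℕ.suc m * + n ≡⟨ cong (_- + ℕ.suc m * + n) ($-+ _ (ℕ.suc m)) ⟨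
      (f $ (a + -[1+ m ] * + n + + ℕ.suc m * + n)) - + ℕ.suc m * + n ≡⟨ cong (λ t → (f $ t) - + ℕ.suc m * + n) (e₂ a (+ ℕ.suc m) (+ n)) ⟩
      (f $ a) - + ℕ.suc m * + n                                ≡⟨ e₃ (f $ a) (+ ℕ.suc m) (+ n) ⟩
      (f $ a) + -[1+ m ] * + n                                 ∎
      where
      open ≡-Reasoning
      e₁ : ∀ a b → a ≡ a + b - b
      e₁ = solve-∀
      e₂ : ∀ a m n → a + (- m) * n + m * n ≡ a
      e₂ = solve-∀
      e₃ : ∀ a m n → a - m * n ≡ a + (- m) * n
      e₃ = solve-∀

    $-cong-≋ : ∀ {a b} → a ≋ b → f $ a ≋ f $ b
    $-cong-≋ {a} {b} p with ≋-elim p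
    ... | q , refl = ≋-intro q ($-shift b q)

    $-injective-≋ : ∀ {a b} → f $ a ≋ f $ b → a ≋ b
    $-injective-≋ {a} {b} p with ≋-elim p
    ... | q , e = ≋-intro q ($-injective (trans e (sym ($-shift b q))))

  -- Distinguished subwords

  Word : Set
  Word = List (Fin n)

  #elbows : ∀ {m} → Vec Tile m → ℕ
  #elbows []             = 0
  #elbows (crossing ∷ t) = #elbows t
  #elbows (elbow ∷ t)    = ℕ.suc (#elbows t)

  -- u sends a position to the strand that is currently there; a crossing at the
  -- letter j exchanges the strands at the positions j and j + 1.
  Valid : AffinePerm n → (w : Word) → Vec Tile (length w) → AffinePerm n → Set
  Valid u []      []             f = ∀ a → u $ (f $ a) ≡ a
  Valid u (j ∷ w) (crossing ∷ t) f = Valid (s j · u) w t f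
  Valid u (j ∷ w) (elbow ∷ t)    f = ((u $ lab j) < (u $ (lab j + 1ℤ))) × Valid u w t f

  record Subword (u : AffinePerm n) (w : Word) (f : AffinePerm n) (r : ℤ) : Set where
    constructor subword
    field
      tiles : Vec Tile (length w)
      valid : Valid u w tiles f
      count : r ≡ + #elbows tiles

  𝒟 : AffinePerm n → Word → AffinePerm n → ℤ → Setoid 0ℓ 0ℓ
  𝒟 u w f r = record
    { Carrier       = Subword u w f r
    ; _≈_           = λ x y → Subword.tiles x ≡ Subword.tiles y
    ; isEquivalence = record { refl = refl ; sym = sym ; trans = trans }
    }

  infix 4 _≗ₚ_
  _≗ₚ_ : AffinePerm n → AffinePerm n → Set
  u ≗ₚ v = ∀ a → u $ a ≡ v $ a

  Valid-cong : ∀ {u v f g} w t → u ≗ₚ v → f ≗ₚ g → Valid u w t f → Valid v w t g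
  Valid-cong {v = v} [] [] p q h a = trans (cong (v $_) (sym (q a))) (trans (sym (p _)) (h a))
  Valid-cong {u} {v} {f} {g} (j ∷ w) (crossing ∷ t) p q h =
    Valid-cong {s j · u} {s j · v} {f} {g} w t (λ a → p (swapAt n (lab j) a)) q h
  Valid-cong {u} {v} {f} {g} (j ∷ w) (elbow ∷ t) p q (l , h) =
    subst₂ _<_ (p _) (p _) l , Valid-cong {u} {v} {f} {g} w t p q h

  𝒟-map : ∀ {u v f g w r} → (∀ t → Valid u w t f → Valid v w t g) →
          (∀ t → Valid v w t g → Valid u w t f) → 𝒟 u w f r ≃ 𝒟 v w g r
  𝒟-map p q = mk≃ (λ (subword t h e) → subword t (p t h) e) (λ (subword t h e) → subword t (q t h) e)
    id id (λ _ → refl) (λ _ → refl)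

  𝒟-cong : ∀ {u v f g w r} → u ≗ₚ v → f ≗ₚ g → 𝒟 u w f r ≃ 𝒟 v w g r
  𝒟-cong {u} {v} {f} {g} {w} p q =
    𝒟-map (λ t → Valid-cong {u} {v} {f} {g} w t p q)
          (λ t → Valid-cong {v} {u} {g} {f} w t (sym ∘ p) (sym ∘ q))

  private
    r-1⇒ : ∀ {r m} → r ≡ + ℕ.suc m → r - 1ℤ ≡ + m
    r-1⇒ {m = m} refl = refl

    r-1⇐ : ∀ {r m} → r - 1ℤ ≡ + m → r ≡ + ℕ.suc m
    r-1⇐ {r} {m} e = trans (sym (-1+1 r)) (trans (cong (_+ 1ℤ) e) (+-comm (+ m) 1ℤ))

  module _ (u : AffinePerm n) {j : Fin n} {w : Word} {f : AffinePerm n} {r : ℤ} where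

    𝒟-∷-< : (u $ lab j) < (u $ (lab j + 1ℤ)) →
            𝒟 u (j ∷ w) f r ≃ 𝒟 (s j · u) w f r ⊎ₛ 𝒟 u w f (r - 1ℤ)
    𝒟-∷-< l = mk≃
      (λ { (subword (crossing ∷ t) h e)     → inj₁ (subword t h e)
         ; (subword (elbow ∷ t) (_ , h) e)  → inj₂ (subword t h (r-1⇒ e)) })
      (λ { (inj₁ (subword t h e)) → subword (crossing ∷ t) h e
         ; (inj₂ (subword t h e)) → subword (elbow ∷ t) (l , h) (r-1⇐ {r} e) })
      (λ { {subword (crossing ∷ _) _ _} {subword (crossing ∷ _) _ _} refl → inj₁ refl
         ; {subword (elbow ∷ _) _ _} {subword (elbow ∷ _) _ _} refl → inj₂ refl })
      (λ { (inj₁ refl) → refl ; (inj₂ refl) → refl })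
      (λ { (inj₁ _) → inj₁ refl ; (inj₂ _) → inj₂ refl })
      (λ { (subword (crossing ∷ _) _ _) → refl ; (subword (elbow ∷ _) _ _) → refl })

    𝒟-∷-≮ : ¬ (u $ lab j) < (u $ (lab j + 1ℤ)) → 𝒟 u (j ∷ w) f r ≃ 𝒟 (s j · u) w f r
    𝒟-∷-≮ ¬l = mk≃
      (λ { (subword (crossing ∷ t) h e)     → subword t h e
         ; (subword (elbow ∷ t) (l , h) e)  → contradiction l ¬l })
      (λ (subword t h e) → subword (crossing ∷ t) h e)
      (λ { {subword (crossing ∷ _) _ _} {subword (crossing ∷ _) _ _} refl → refl
         ; {subword (elbow ∷ _) (l , _) _} → contradiction l ¬l
         ; {_} {subword (elbow ∷ _) (l , _) _} → contradiction l ¬l })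
      (λ { refl → refl })
      (λ _ → refl)
      (λ { (subword (crossing ∷ _) _ _) → refl ; (subword (elbow ∷ _) (l , _) _) → contradiction l ¬l })

  -- Removing the last letter

  infix 4 _before_in[_]
  -- The order of the preimages of `p` and `q`, stated for arbitrary preimages so that it can be
  -- tested by evaluating `f` alone. For i and i + 1 it decides which of `f` and `f · s i` is
  -- longer.
  _before_in[_] : ℤ → ℤ → AffinePerm n → Set
  p before q in[ f ] = ∀ a b → f $ a ≡ p → f $ b ≡ q → a < b

  module _ (f : AffinePerm n) where

    preimage : ∀ b → ∃[ a ] f $ a ≡ b
    preimage b = Inverse.from (AffinePerm.perm f) b , Inverse.strictlyInverseˡ (AffinePerm.perm f) b

    before-inverse : ∀ {u : AffinePerm n} {p q} → (∀ a → u $ (f $ a) ≡ a) → p before q in[ f ] → (u $ p) < (u $ q)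
    before-inverse {p = p} {q} h l with preimage p | preimage q
    ... | a , refl | b , refl = subst₂ _<_ (sym (h a)) (sym (h b)) (l a b refl refl)

  module _ (f : AffinePerm n) (j : Fin n) where

    private
      𝒟-last : ∀ u {r} → 𝒟 (s j · u) [] f r ≃ 𝒟 u [] (f · s j) r
      𝒟-last u = 𝒟-map (λ { [] h → h }) (λ { [] h → h })

    -- Induction on `w` reduces to a single letter. There `u` must be inverse to `f` if the letter
    -- is an elbow and to `f · s j` if it is a crossing. By hypothesis an inverse of `f` ascends at
    -- `j`, so the elbow is legal whenever it gives the right permutation.
    𝒟-∷ʳ-< : ∀ u w {r} → lab j before lab j + 1ℤ in[ f ] →
             𝒟 u (w ∷ʳ j) f r ≃ 𝒟 u w (f · s j) r ⊎ₛ 𝒟 u w f (r - 1ℤ)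
    𝒟-∷ʳ-< u [] l with (u $ lab j) <? (u $ (lab j + 1ℤ))
    ... | yes m = 𝒟-∷-< u m ⨾ (𝒟-last u ⊎-inverse ≃-refl)
    ... | no ¬m = 𝒟-∷-≮ u ¬m ⨾ 𝒟-last u ⨾ ⊎-emptyʳ λ { (subword [] h _) → ¬m (before-inverse f {u} h l) }
    𝒟-∷ʳ-< u (i ∷ w) l with (u $ lab i) <? (u $ (lab i + 1ℤ))
    ... | yes m = 𝒟-∷-< u m ⨾ (𝒟-∷ʳ-< (s i · u) w l ⊎-inverse 𝒟-∷ʳ-< u w l) ⨾ ⊎-interchange
                ⨾ ≃-sym (𝒟-∷-< u m ⊎-inverse 𝒟-∷-< u m)
    ... | no ¬m = 𝒟-∷-≮ u ¬m ⨾ 𝒟-∷ʳ-< (s i · u) w l ⨾ ≃-sym (𝒟-∷-≮ u ¬m ⊎-inverse 𝒟-∷-≮ u ¬m)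

    -- Now an inverse of `f` descends at `j`, so a final elbow is never legal.
    𝒟-∷ʳ-> : ∀ u w {r} → lab j + 1ℤ before lab j in[ f ] →
             𝒟 u (w ∷ʳ j) f r ≃ 𝒟 u w (f · s j) r
    𝒟-∷ʳ-> u [] l with (u $ lab j) <? (u $ (lab j + 1ℤ))
    ... | yes m = 𝒟-∷-< u m ⨾ (𝒟-last u ⊎-inverse ≃-refl)
                ⨾ ≃-sym (⊎-emptyʳ λ { (subword [] h _) → <-asym m (before-inverse f {u} h l) })
    ... | no ¬m = 𝒟-∷-≮ u ¬m ⨾ 𝒟-last u
    𝒟-∷ʳ-> u (i ∷ w) l with (u $ lab i) <? (u $ (lab i + 1ℤ))
    ... | yes m = 𝒟-∷-< u m ⨾ (𝒟-∷ʳ-> (s i · u) w l ⊎-inverse 𝒟-∷ʳ-> u w l) ⨾ ≃-sym (𝒟-∷-< u m)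
    ... | no ¬m = 𝒟-∷-≮ u ¬m ⨾ 𝒟-∷ʳ-> (s i · u) w l ⨾ ≃-sym (𝒟-∷-≮ u ¬m)

  -- Multiplication by s i on the left

  module _ (i : Fin n) where

    -- `u` maps positions to strands, so this says that the strands i and i + 1 still appear in
    -- their original order.
    Up : AffinePerm n → Set
    Up u = lab i before lab i + 1ℤ in[ u ]

    -- The labels must be exact neighbours, not just congruent to i and i + 1: only then does
    -- multiplication by `s i` exchange them with each other.
    Meet : AffinePerm n → Fin n → Set
    Meet u j = ((u $ lab j) ≋ lab i) × ((u $ (lab j + 1ℤ)) ≡ (u $ lab j) + 1ℤ)

    meet? : ∀ u j → Dec (Meet u j)
    meet? u j = ((u $ lab j) ≋? lab i) ×-dec ((u $ (lab j + 1ℤ)) ≟ ((u $ lab j) + 1ℤ))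

    module _ (u : AffinePerm n) (j : Fin n) where

      Up⇒before : Up u → ∀ {a b} → u $ a ≋ lab i → u $ b ≡ (u $ a) + 1ℤ → a < b
      Up⇒before h {a} {b} p e with ≋-elim p
      ... | q , e′ = +1≤⇒< (lin₁ (<⇒+1≤ (h (a + - q * + n) (b + - q * + n)
          (trans ($-shift u a (- q)) (trans (cong (_+ - q * + n) e′) (cancel (lab i) q (+ n))))
          (trans ($-shift u b (- q)) (trans (cong (_+ - q * + n) (trans e (cong (_+ 1ℤ) e′))) (cancel′ (lab i) q (+ n))))))
          (slack a b (- q * + n)))
        where
        cancel : ∀ i q n → i + q * n + - q * n ≡ i
        cancel = solve-∀
        cancel′ : ∀ i q n → i + q * n + 1ℤ + - q * n ≡ i + 1ℤ
        cancel′ = solve-∀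
        slack : ∀ a b m → b - (a + 1ℤ) ≡ b + m - (a + m + 1ℤ)
        slack = solve-∀

      Meet⇒< : Up u → Meet u j → (u $ lab j) < (u $ (lab j + 1ℤ))
      Meet⇒< h (p , e) = subst ((u $ lab j) <_) (sym e) (a<a+1 _)

      Meet⇒≮ : Meet u j → ¬ ((u · s i) $ lab j) < ((u · s i) $ (lab j + 1ℤ))
      Meet⇒≮ (p , e) l = <-asym l (subst₂ _<_ (sym e₂) (sym e₁) (a<a+1 _))
        where
        e₁ : swapAt n (lab i) (u $ lab j) ≡ (u $ lab j) + 1ℤ
        e₁ = swap-up p
        e₂ : swapAt n (lab i) (u $ (lab j + 1ℤ)) ≡ (u $ lab j)
        e₂ = trans (swap-down (subst (_≋ lab i + 1ℤ) (sym e) (≋-+ 1ℤ p))) (trans (cong (_- 1ℤ) e) (+1-1 _))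

      -- At a meeting, exchanging the two positions is the same as exchanging the two labels. By
      -- injectivity modulo n no other position carries a label that `s i` moves.
      Meet⇒comm : Meet u j → s j · u ≗ₚ u · s i
      Meet⇒comm (p , e) a with swapAt n (lab j) a | swapView (lab j) a
      ... | _ | up q with ≋-elim q
      ...   | m , refl = trans (trans (cong (u $_) (swap⁺ (lab j) (m * + n) 1ℤ)) ($-shift u (lab j + 1ℤ) m))
                         (trans (cong (_+ m * + n) e) (trans (swap⁺ (u $ lab j) 1ℤ (m * + n))
                           (trans (cong (_+ 1ℤ) (sym ($-shift u (lab j) m)))
                           (sym (swap-up (≋-trans ($-cong-≋ u q) p))))))
        where swap⁺ : ∀ a b c → a + b + c ≡ a + c + b
              swap⁺ = solve-∀
      Meet⇒comm (p , e) a | _ | down q with ≋-elim q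
      ...   | m , refl = trans (trans (cong (u $_) (shuffle (lab j) (m * + n))) ($-shift u (lab j) m))
                         (trans (shuffle′ (u $ lab j) (m * + n))
                         (trans (cong (λ t → t + m * + n - 1ℤ) (sym e))
                         (trans (cong (_- 1ℤ) (sym ($-shift u (lab j + 1ℤ) m)))
                         (sym (swap-down (≋-trans ($-cong-≋ u q) (subst (_≋ lab i + 1ℤ) (sym e) (≋-+ 1ℤ p))))))))
        where shuffle : ∀ a b → a + 1ℤ + b - 1ℤ ≡ a + b
              shuffle = solve-∀
              shuffle′ : ∀ a b → a + b ≡ a + 1ℤ + b - 1ℤ
              shuffle′ = solve-∀
      Meet⇒comm (p , e) a | _ | stay ¬q ¬r = sym (swap-stay
        (λ q → ¬q ($-injective-≋ u (≋-trans q (≋-sym p))))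
        (λ q → ¬r ($-injective-≋ u (≋-trans q (subst (lab i + 1ℤ ≋_) (sym e) (≋-sym (≋-+ 1ℤ p)))))))

      Meet⇒cancel : Meet u j → s j · (u · s i) ≗ₚ u
      Meet⇒cancel m a = $-injective (s i) (trans (cong (swapAt n (lab i)) (sym (Meet⇒comm m (swapAt n (lab j) a))))
                                                (cong (λ t → swapAt n (lab i) (u $ t)) (swap-involutive (lab j) a)))

      module _ (h : Up u) (¬m : ¬ Meet u j) where

        -- A crossing reverses only neighbouring positions congruent to j and j + 1. Were these the
        -- positions of i and i + 1, periodicity would move them to `lab j` and `lab j + 1ℤ`, which
        -- is a meeting.
        Up-s : Up (s j · u)
        Up-s a b e e′ = subst₂ _<_ (swap-involutive (lab j) a) (swap-involutive (lab j) b)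
          (swap-mono (h _ _ e e′) λ (p , eq) → ¬m (meet e e′ p eq))
          where
          meet : ∀ {a b} → u $ a ≡ lab i → u $ b ≡ lab i + 1ℤ → a ≋ lab j → b ≡ a + 1ℤ → Meet u j
          meet {a} {b} e e′ p eq with ≋-elim (≋-sym p)
          ... | q , eq′ = ≋-trans ($-cong-≋ u (≋-sym p)) (≋-reflexive e)
            , (begin
                (u $ (lab j + 1ℤ))          ≡⟨ cong (λ t → u $ (t + 1ℤ)) eq′ ⟩
                (u $ (a + q * + n + 1ℤ))    ≡⟨ cong (u $_) (trans (swap⁺ a (q * + n) 1ℤ) (cong (_+ q * + n) (sym eq))) ⟩
                (u $ (b + q * + n))         ≡⟨ $-shift u b q ⟩
                (u $ b) + q * + n           ≡⟨ cong (_+ q * + n) e′ ⟩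
                lab i + 1ℤ + q * + n        ≡⟨ swap⁺ (lab i) 1ℤ (q * + n) ⟩
                lab i + q * + n + 1ℤ        ≡⟨ cong (λ t → t + q * + n + 1ℤ) e ⟨
                (u $ a) + q * + n + 1ℤ      ≡⟨ cong (_+ 1ℤ) ($-shift u a q) ⟨
                (u $ (a + q * + n)) + 1ℤ    ≡⟨ cong (λ t → (u $ t) + 1ℤ) eq′ ⟨
                (u $ lab j) + 1ℤ            ∎)
            where
            open ≡-Reasoning
            swap⁺ : ∀ a b c → a + b + c ≡ a + c + b
            swap⁺ = solve-∀

        <⇒s< : (u $ lab j) < (u $ (lab j + 1ℤ)) → ((u · s i) $ lab j) < ((u · s i) $ (lab j + 1ℤ))
        <⇒s< l = swap-mono l ¬m

        ≮⇒s≮ : ¬ (u $ lab j) < (u $ (lab j + 1ℤ)) → ¬ ((u · s i) $ lab j) < ((u · s i) $ (lab j + 1ℤ))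
        -- The exception of `swap-mono` would put i + 1 (up to translation) directly before i,
        -- against `Up`.
        ≮⇒s≮ ¬l l = <-asym l (swap-mono (≮⇒> ¬l (λ e → <⇒≢ (a<a+1 _) ($-injective u e)))
          λ (p , e) → <-asym (a<a+1 (lab j)) (Up⇒before h p e))

    module _ (f : AffinePerm n) (f↑ : (f $ lab i) < (f $ (lab i + 1ℤ))) where

      private
        reassoc : ∀ u v x {w g r} → 𝒟 (u · v · x) w g r ≃ 𝒟 (u · (v · x)) w g r
        reassoc u v x = 𝒟-cong (λ _ → refl) (λ _ → refl)

        reassoc⁻ : ∀ u v x {w g r} → 𝒟 (u · (v · x)) w g r ≃ 𝒟 (u · v · x) w g r
        reassoc⁻ u v x = 𝒟-cong (λ _ → refl) (λ _ → refl)

      -- Bijective forms of the two cases of the recursion of R-polynomials at a left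
      -- descent; a letter at which the strands i and i + 1 meet turns each into the other.
      left-recursion : ∀ u w r → Up u → 𝒟 u w f r ≃ 𝒟 (u · s i) w (s i · f) r ⊎ₛ 𝒟 u w (s i · f) (r - 1ℤ)
      left-symmetry : ∀ u w r → Up u → 𝒟 (u · s i) w f r ≃ 𝒟 u w (s i · f) r

      left-recursion u [] r h = 𝒟-map
          (λ { [] v a → trans (cong σ (v (σ a))) (σσ a) })
          (λ { [] v a → trans (sym (σσ (u $ (f $ a)))) (trans
               (cong σ (trans (cong (λ t → σ (u $ (f $ t))) (sym (σσ a))) (v (σ a)))) (σσ a)) })
        -- If `u` were inverse to `s i · f`, the strands i and i + 1 would sit at f(i + 1) and f(i),
        -- so `Up` would contradict `f↑`.
        ⨾ ⊎-emptyʳ λ { (subword [] v _) → <-asym f↑ (h _ _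
            (trans (cong (λ t → u $ (f $ t)) (sym (swap-up {lab i} ≋-refl))) (v (lab i)))
            (trans (cong (λ t → u $ (f $ t)) (sym (trans (swap-down {lab i} ≋-refl) (+1-1 (lab i))))) (v (lab i + 1ℤ)))) }
        where
        σ = swapAt n (lab i)
        σσ = swap-involutive (lab i)
      left-recursion u (j ∷ w) r h with meet? u j | (u $ lab j) <? (u $ (lab j + 1ℤ))
      -- Both sides become the same three sets over `w`, all for `s i · f`: from `u` with `r`, from
      -- `u · s i` with `r - 1ℤ`, and from `u` with two elbows fewer.
      ... | yes m | _     = 𝒟-∷-< u (Meet⇒< u j h m)
        ⨾ ((𝒟-cong (Meet⇒comm u j m) (λ _ → refl) ⨾ left-symmetry u w r h) ⊎-inverse left-recursion u w (r - 1ℤ) h)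
        ⨾ ≃-sym (
            (𝒟-∷-≮ (u · s i) (Meet⇒≮ u j m) ⨾ 𝒟-cong (Meet⇒cancel u j m) (λ _ → refl))
            ⊎-inverse
            (𝒟-∷-< u (Meet⇒< u j h m) ⨾ (𝒟-cong (Meet⇒comm u j m) (λ _ → refl) ⊎-inverse ≃-refl)))
      ... | no ¬m | yes l = 𝒟-∷-< u l
        ⨾ ((left-recursion (s j · u) w r (Up-s u j h ¬m) ⨾ (reassoc (s j) u (s i) ⊎-inverse ≃-refl)) ⊎-inverse left-recursion u w (r - 1ℤ) h)
        ⨾ ⊎-interchange ⨾ ≃-sym (𝒟-∷-< (u · s i) (<⇒s< u j h ¬m l) ⊎-inverse 𝒟-∷-< u l)
      ... | no ¬m | no ¬l = 𝒟-∷-≮ u ¬l ⨾ left-recursion (s j · u) w r (Up-s u j h ¬m) ⨾ (reassoc (s j) u (s i) ⊎-inverse ≃-refl)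
        ⨾ ≃-sym (𝒟-∷-≮ (u · s i) (≮⇒s≮ u j h ¬m ¬l) ⊎-inverse 𝒟-∷-≮ u ¬l)

      left-symmetry u [] r h = 𝒟-map
        (λ { [] v a → trans (sym (σσ (u $ (f $ σ a)))) (trans (cong σ (v (σ a))) (σσ a)) })
        (λ { [] v a → trans (cong (λ t → σ (u $ (f $ t))) (sym (σσ a))) (trans (cong σ (v (σ a))) (σσ a)) })
        where
        σ = swapAt n (lab i)
        σσ = swap-involutive (lab i)
      left-symmetry u (j ∷ w) r h with meet? u j | (u $ lab j) <? (u $ (lab j + 1ℤ))
      -- The forced crossing cancels `s i`. The two summands of the left recursion are then the two
      -- tiles that the other side allows at this letter.
      ... | yes m | _     = 𝒟-∷-≮ (u · s i) (Meet⇒≮ u j m)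
        ⨾ 𝒟-cong (Meet⇒cancel u j m) (λ _ → refl) ⨾ left-recursion u w r h
        ⨾ ≃-sym (𝒟-∷-< u (Meet⇒< u j h m) ⨾ (𝒟-cong (Meet⇒comm u j m) (λ _ → refl) ⊎-inverse ≃-refl))
      ... | no ¬m | yes l = 𝒟-∷-< (u · s i) (<⇒s< u j h ¬m l)
        ⨾ ((reassoc⁻ (s j) u (s i) ⨾ left-symmetry (s j · u) w r (Up-s u j h ¬m)) ⊎-inverse left-symmetry u w (r - 1ℤ) h)
        ⨾ ≃-sym (𝒟-∷-< u l)
      ... | no ¬m | no ¬l = 𝒟-∷-≮ (u · s i) (≮⇒s≮ u j h ¬m ¬l)
        ⨾ reassoc⁻ (s j) u (s i) ⨾ left-symmetry (s j · u) w r (Up-s u j h ¬m) ⨾ ≃-sym (𝒟-∷-≮ u ¬l)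

  -- Lengths

  -- Turns a comparison of lengths into a pointwise inequality by contradiction: if the inequality
  -- failed, the inversions would inject the wrong way.
  ≻⇒no-injection : ∀ (f g : AffinePerm n) → f ≻ g →
    (φ : Inversion f → Inversion g) → ¬ Injective _≡_ _≡_ φ
  ≻⇒no-injection f g (l , m , F , G , m<l) φ φ-injective = ℕ.<⇒≱ m<l (injective⇒≤
    λ e → Inverse-injective F (φ-injective (from-injective G e)))
    where
    Inverse-injective : ∀ {A B : Set} (I : Inverse (setoid A) (setoid B)) {x y} → Inverse.to I x ≡ Inverse.to I y → x ≡ y
    Inverse-injective I e = trans (sym (Inverse.strictlyInverseʳ I _)) (trans (cong (Inverse.from I) e) (Inverse.strictlyInverseʳ I _))
    from-injective : ∀ {A B : Set} (I : Inverse (setoid A) (setoid B)) {x y} → Inverse.from I x ≡ Inverse.from I y → x ≡ y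
    from-injective I e = trans (sym (Inverse.strictlyInverseˡ I _)) (trans (cong (Inverse.to I) e) (Inverse.strictlyInverseˡ I _))

  Inversion-≡ : ∀ (f : AffinePerm n) {x y : Inversion f} →
    proj₁ x ≡ proj₁ y → proj₁ (proj₂ x) ≡ proj₁ (proj₂ y) → x ≡ y
  Inversion-≡ f {x = _ , _ , p , q} {_ , _ , p′ , q′} refl refl =
    cong₂ (λ p q → _ , _ , p , q) (<-irrelevant p p′) (<-irrelevant q q′)

  private
    -- The multiple of n that carries `p` into [n]; every affine permutation commutes with this
    -- shift.
    anchor : ℤ → ℤ
    anchor p = lab {n} (residue p) - p

    +anchor : ∀ p → p + anchor p ≡ lab {n} (residue p)
    +anchor p = e p (lab {n} (residue p))
      where e : ∀ p a → p + (a - p) ≡ a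
            e = solve-∀

    $-difference : ∀ (f : AffinePerm n) {a b} q → b ≋ a → f $ (q + (b - a)) ≡ (f $ q) + (b - a)
    $-difference f {a} q p with ≋-elim p
    ... | t , refl = subst (λ m → f $ (q + m) ≡ (f $ q) + m) (e a (t * + n)) ($-shift f q t)
      where e : ∀ a b → b ≡ a + b - a
            e = solve-∀

    $-anchor : ∀ (f : AffinePerm n) p q → f $ (q + anchor p) ≡ (f $ q) + anchor p
    $-anchor f p q = $-difference f q (≋-sym (lab-residue p))

  normalise : ∀ (f : AffinePerm n) p q → p < q → (f $ q) < (f $ p) → Inversion f
  normalise f p q l m = residue p , q + anchor p
    , subst (_< q + anchor p) (+anchor p) (+-monoˡ-< (anchor p) l)
    , subst₂ _<_ (sym ($-anchor f p q)) (trans (sym ($-anchor f p p)) (cong (f $_) (+anchor p))) (+-monoˡ-< (anchor p) m)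

  normalise-≋ : ∀ {p p′} → residue {n} p ≡ residue p′ → p ≋ p′
  normalise-≋ {p} {p′} e = ≋-trans (lab-residue p) (subst (λ i → lab i ≋ p′) (sym e) (≋-sym (lab-residue p′)))

  anchor-cancel : ∀ {p q p′ q′} → q + anchor p ≡ q′ + anchor p′ → p ≡ p′ → q ≡ q′
  anchor-cancel {p} {q} {q′ = q′} e refl = trans (e₁ q (anchor p)) (trans (cong (_- anchor p) e) (sym (e₁ q′ (anchor p))))
    where
    e₁ : ∀ a b → a ≡ a + b - b
    e₁ = solve-∀

  module _ {f : AffinePerm n} {i : Fin n} where

    -- Otherwise applying `s i` to both positions injects the inversions of `s i · f` into those of
    -- `f`. The one pair whose order it would destroy is (i, i + 1), and that is no inversion of
    -- `s i · f` when f(i) is not below f(i + 1).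
    ≻⇒<ˡ : s i · f ≻ f → (f $ lab i) < (f $ (lab i + 1ℤ))
    ≻⇒<ˡ f≻ = decidable-stable (_ <? _) λ ¬l → ≻⇒no-injection (s i · f) f f≻ (φ ¬l)
      λ {x} {y} → φ-injective ¬l x y
      where
      σ = swapAt n (lab i)
      module _ (¬l : ¬ (f $ lab i) < (f $ (lab i + 1ℤ))) where
        mono : ∀ a b → lab a < b → (f $ σ b) < (f $ σ (lab a)) → σ (lab a) < σ b
        mono a b p q = swap-mono p λ (c , d) → ¬l (subst₂ (λ x y → (f $ x) < (f $ y))
          (trans (trans (swap-down (subst (_≋ lab i + 1ℤ) (sym d) (≋-+ 1ℤ c))) (cong (_- 1ℤ) d))
                 (trans (+1-1 (lab a)) (cong lab (lab-≋-injective c))))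
          (trans (swap-up c) (cong (λ j → lab j + 1ℤ) (lab-≋-injective c))) q)
        φ : Inversion (s i · f) → Inversion f
        φ (a , b , p , q) = normalise f (σ (lab a)) (σ b) (mono a b p q) q
        φ-injective : ∀ x y → φ x ≡ φ y → x ≡ y
        φ-injective (a , b , p , q) (a′ , b′ , p′ , q′) e = Inversion-≡ (s i · f) a≡a′
          ($-injective (s i) (anchor-cancel {σ (lab a)} (cong (proj₁ ∘ proj₂) e) (cong (σ ∘ lab) a≡a′)))
          where
          a≡a′ : a ≡ a′
          a≡a′ = lab-≋-injective ($-injective-≋ (s i) {lab a} {lab a′} (normalise-≋ {σ (lab a)} {σ (lab a′)} (cong proj₁ e)))

    private
      translate : ∀ {a b x y} → f $ a ≡ lab i → f $ b ≡ lab i + 1ℤ →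
                  f $ x ≋ lab i → f $ y ≡ (f $ x) + 1ℤ → ∃[ m ] (x ≡ a + m × y ≡ b + m)
      translate {a} {b} {x} {y} refl′ e p e′ with ≋-elim p
      ... | q , d = q * + n , $-injective f (trans d (trans (cong (_+ q * + n) (sym refl′)) (sym ($-shift f a q))))
        , $-injective f (trans e′ (trans (cong (_+ 1ℤ) d) (trans (shuffle (lab i) (q * + n))
            (trans (cong (_+ q * + n) (sym e)) (sym ($-shift f b q))))))
        where shuffle : ∀ a b → a + b + 1ℤ ≡ a + 1ℤ + b
              shuffle = solve-∀

      +-cancel-< : ∀ {a b} m → a + m < b + m → a < b
      +-cancel-< {a} {b} m p = +1≤⇒< (lin₁ (<⇒+1≤ p) (e a b m))
        where e : ∀ a b m → b - (a + 1ℤ) ≡ b + m - (a + m + 1ℤ)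
              e = solve-∀

    -- Right multiplication keeps positions, so the injection is the identity on pairs. A new
    -- inversion would have values exchanged by `s i`, hence be a translate of (a, b), and these
    -- stand in the wrong order.
    ≻⇒before : f · s i ≻ f → lab i before lab i + 1ℤ in[ f ]
    ≻⇒before f≻ a b e e′ = decidable-stable (a <? b) λ ¬l → ≻⇒no-injection (f · s i) f f≻
      (λ (x , y , p , q) → x , y , p , decidable-stable (_ <? _) λ ¬r →
        <-asym q (swap-mono (≮⇒> ¬r (λ d → <⇒≢ p (sym ($-injective f d)))) λ (c , d) →
          let m , u , v = translate e e′ c d in ¬l (+-cancel-< m (subst₂ _<_ u v p))))
      λ d → Inversion-≡ (f · s i) (cong proj₁ d) (cong (proj₁ ∘ proj₂) d)

    ≻⇒after : f ≻ f · s i → lab i + 1ℤ before lab i in[ f ]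
    ≻⇒after f≻ b a e′ e = decidable-stable (b <? a) λ ¬l → ≻⇒no-injection f (f · s i) f≻
      (λ (x , y , p , q) → x , y , p , swap-mono q λ (c , d) →
          let m , u , v = translate e e′ c d in ¬l (+-cancel-< m (subst₂ _<_ v u p)))
      λ d → Inversion-≡ f (cong proj₁ d) (cong (proj₁ ∘ proj₂) d)

  -- Functions on the integers with given increments

  ℤ-induction : ∀ (Q : ℤ → Set) → Q 0ℤ → (∀ j → Q j → Q (j + 1ℤ)) → (∀ j → Q (j + 1ℤ) → Q j) → ∀ j → Q j
  ℤ-induction Q z f g (+ ℕ.zero)         = z
  ℤ-induction Q z f g (+ ℕ.suc m)        = subst Q (cong +_ (ℕ.+-comm m 1)) (f (+ m) (ℤ-induction Q z f g (+ m)))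
  ℤ-induction Q z f g -[1+ ℕ.zero ]      = g -[1+ 0 ] z
  ℤ-induction Q z f g -[1+ ℕ.suc m ]     = g -[1+ ℕ.suc m ] (ℤ-induction Q z f g -[1+ m ])

  ≤⇒+ : ∀ {a b} → a ≤ b → ∃[ m ] b ≡ a + + m
  ≤⇒+ {a} {b} p = ∣ b - a ∣ , trans (e a b) (cong (_+_ a) (sym (0≤i⇒+∣i∣≡i (i≤j⇒0≤j-i p))))
    where e : ∀ a b → b ≡ a + (b - a)
          e = solve-∀

  +suc : ∀ a m → a + + ℕ.suc m ≡ a + + m + 1ℤ
  +suc a m = e a (+ m)
    where e : ∀ a m → a + (1ℤ + m) ≡ a + m + 1ℤ
          e = solve-∀

  partialSum-+1 : ∀ g j → partialSum g (j + 1ℤ) ≡ partialSum g j + g (j + 1ℤ)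
  partialSum-+1 g (+ m) = cong (λ t → partialSum g t) e ∙ cong (λ t → partialSum g (+ m) + g t) (sym e)
    where
    infixr 5 _∙_
    _∙_ = trans
    e : + m + 1ℤ ≡ + ℕ.suc m
    e = cong +_ (ℕ.+-comm m 1)
  partialSum-+1 g -[1+ ℕ.zero ]  = sym (+-inverseˡ (g 0ℤ))
  partialSum-+1 g -[1+ ℕ.suc m ] = e (partialSum g -[1+ m ]) (g -[1+ m ])
    where e : ∀ a b → a ≡ a - b + b
          e = solve-∀

  partialSum-n : ∀ m g → partialSum g (+ m) ≡ sum {m} (λ i → g (lab i))
  partialSum-n ℕ.zero    g = refl
  partialSum-n (ℕ.suc m) g = trans (cong₂ _+_
      (trans (partialSum-n m g) (sum-cong-≗ {m} λ i → cong (λ t → g (+ ℕ.suc t)) (sym (toℕ-inject₁ i))))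
      (cong (λ t → g (+ ℕ.suc t)) (sym (toℕ-fromℕ m))))
    (sym (sum-init-last (λ (i : Fin (ℕ.suc m)) → g (lab i))))

  module _ (A B : ℤ → ℤ) (eq : ∀ j → A (j + 1ℤ) - A j ≡ B (j + 1ℤ) - B j) where

    same-increments : ∀ j → A j ≡ B j + (A 0ℤ - B 0ℤ)
    same-increments = ℤ-induction _ (e (A 0ℤ) (B 0ℤ))
      (λ j p → trans (e₁ (A (j + 1ℤ)) (A j)) (trans (cong₂ _+_ (eq j) p) (e₂ (B (j + 1ℤ)) (B j) _)))
      (λ j p → trans (e₃ (A (j + 1ℤ)) (A j)) (trans (cong₂ _-_ p (eq j)) (e₄ (B (j + 1ℤ)) (B j) _)))
      where
      e : ∀ a b → a ≡ b + (a - b)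
      e = solve-∀
      e₁ : ∀ a b → a ≡ (a - b) + b
      e₁ = solve-∀
      e₂ : ∀ a b c → (a - b) + (b + c) ≡ a + c
      e₂ = solve-∀
      e₃ : ∀ a b → b ≡ a - (a - b)
      e₃ = solve-∀
      e₄ : ∀ a b c → (a + c) - (a - b) ≡ b + c
      e₄ = solve-∀

  -- Lattice paths

  -- A lattice path is encoded by its height: H d is the ordinate of its point
  -- on the antidiagonal x + y = d.

  record IsPath (k : ℕ) (H : ℤ → ℤ) : Set where
    field
      step     : ∀ d → H (d + 1ℤ) ≡ H d ⊎ H (d + 1ℤ) ≡ H d + 1ℤ
      periodic : ∀ d → H (d + + n) ≡ H d + + k

    private
      periodic⁺ : ∀ m d → H (d + + m * + n) ≡ H d + + m * + k
      periodic⁺ ℕ.zero    d = trans (cong H (+-identityʳ d)) (sym (+-identityʳ (H d)))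
      periodic⁺ (ℕ.suc m) d = trans (cong H (e d (+ m) (+ n))) (trans (periodic _)
        (trans (cong (_+ + k) (periodic⁺ m d)) (sym (e (H d) (+ m) (+ k)))))
        where e : ∀ a m n → a + (1ℤ + m) * n ≡ a + m * n + n
              e = solve-∀

    shift : ∀ m d → H (d + m * + n) ≡ H d + m * + k
    shift (+ m)    d = periodic⁺ m d
    shift -[1+ m ] d = trans (e₁ _ (+ ℕ.suc m * + k)) (trans (cong (_- + ℕ.suc m * + k)
      (trans (sym (periodic⁺ (ℕ.suc m) (d + -[1+ m ] * + n))) (cong H (e₂ d (+ ℕ.suc m) (+ n))))) (e₃ (H d) (+ ℕ.suc m) (+ k)))
      where
      e₁ : ∀ a b → a ≡ a + b - b
      e₁ = solve-∀
      e₂ : ∀ a m n → a + (- m) * n + m * n ≡ a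
      e₂ = solve-∀
      e₃ : ∀ a m n → a - m * n ≡ a + (- m) * n
      e₃ = solve-∀

    step-≥ : ∀ d → H d ≤ H (d + 1ℤ)
    step-≥ d with step d
    ... | inj₁ e = ≤-reflexive (sym e)
    ... | inj₂ e = subst (H d ≤_) (sym e) (<⇒≤ (a<a+1 _))

    step-≤ : ∀ d → H (d + 1ℤ) ≤ H d + 1ℤ
    step-≤ d with step d
    ... | inj₁ e = subst (_≤ H d + 1ℤ) (sym e) (<⇒≤ (a<a+1 _))
    ... | inj₂ e = ≤-reflexive e

    mono : ∀ {a b} → a ≤ b → H a ≤ H b
    mono {a} p with ≤⇒+ p
    ... | m , refl = go m
      where
      go : ∀ m → H a ≤ H (a + + m)
      go ℕ.zero    = ≤-reflexive (cong H (sym (+-identityʳ a)))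
      go (ℕ.suc m) = subst (λ t → H a ≤ H t) (sym (+suc a m)) (≤-trans (go m) (step-≥ _))

    -- The abscissa d - H d is monotone, without subtraction.
    lipschitz : ∀ {a b} → a ≤ b → H b + a ≤ H a + b
    lipschitz {a} p with ≤⇒+ p
    ... | m , refl = go m
      where
      go : ∀ m → H (a + + m) + a ≤ H a + (a + + m)
      go ℕ.zero    = ≤-reflexive (trans (cong (λ t → H t + a) (+-identityʳ a)) (cong (_+_ (H a)) (sym (+-identityʳ a))))
      go (ℕ.suc m) = subst (λ t → H t + a ≤ H a + t) (sym (+suc a m))
        (lin₂ (go m) (step-≤ (a + + m)) (e (H a) a (a + + m) (H (a + + m)) (H (a + + m + 1ℤ))))
        where e : ∀ h a b x y → h + (b + 1ℤ) - (y + a) ≡ (h + b - (x + a)) + (x + 1ℤ - y)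
              e = solve-∀

  module Profile {k : ℕ} (P : 𝒫 k n) where
    open Strip P public
    open 𝒫 P using (endY) renaming (step to stepP)

    at-cong : ∀ {a b} → a ≋ b → P at a ≡ P at b
    at-cong p = cong stepP (residue-cong p)

    py-+1 : ∀ j → py (j + 1ℤ) ≡ py j + dy (P at (j + 1ℤ))
    py-+1 = partialSum-+1 _

    px-+1 : ∀ j → px (j + 1ℤ) ≡ px j + dx (P at (j + 1ℤ))
    px-+1 = partialSum-+1 _

    py-n : py (+ n) ≡ + k
    py-n = trans (partialSum-n n _) (trans (sum-cong-≗ {n} λ i → cong (dy ∘ stepP) (residue-lab i)) endY)

    -- Every step raises x + y by one. This is why, on P itself, the position of an edge is its
    -- label.
    px+py : ∀ j → px j + py j ≡ j
    px+py = ℤ-induction _ refl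
      (λ j p → trans (cong₂ _+_ (px-+1 j) (py-+1 j)) (trans (e (px j) (py j) _ _)
        (cong₂ _+_ p (one (P at (j + 1ℤ))))))
      (λ j p → trans (e′ (px j) (py j) (dx (P at (j + 1ℤ))) (dy (P at (j + 1ℤ))))
        (trans (cong₂ _-_ (trans (cong₂ _+_ (sym (px-+1 j)) (sym (py-+1 j))) p) (one (P at (j + 1ℤ)))) (+1-1 j)))
      where
      one : ∀ s → dx s + dy s ≡ 1ℤ
      one R = refl
      one U = refl
      e : ∀ x y a b → (x + a) + (y + b) ≡ (x + y) + (a + b)
      e = solve-∀
      e′ : ∀ x y a b → x + y ≡ ((x + a) + (y + b)) - (a + b)
      e′ = solve-∀

    px≡ : ∀ j → px j ≡ j - py j
    px≡ j = trans (e (px j) (py j)) (cong (_- py j) (px+py j))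
      where e : ∀ a b → a ≡ a + b - b
            e = solve-∀

    py-path : IsPath k py
    py-path = record { step = step′ ; periodic = periodic′ }
      where
      step′ : ∀ d → py (d + 1ℤ) ≡ py d ⊎ py (d + 1ℤ) ≡ py d + 1ℤ
      step′ d with P at (d + 1ℤ) | py-+1 d
      ... | R | e = inj₁ (trans e (+-identityʳ _))
      ... | U | e = inj₂ e
      increments : ∀ j → py (j + 1ℤ + + n) - py (j + + n) ≡ py (j + 1ℤ) - py j
      increments j = trans (cong (_- py (j + + n)) (trans (cong py (e₁ j (+ n))) (py-+1 (j + + n))))
        (trans (e (py (j + + n)) _) (trans (cong dy (at-cong {j + + n + 1ℤ} {j + 1ℤ} (≋-intro 1ℤ (e₂ j (+ n)))))
        (trans (sym (e (py j) _)) (cong (_- py j) (sym (py-+1 j))))))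
        where
        e₁ : ∀ j n → j + 1ℤ + n ≡ j + n + 1ℤ
        e₁ = solve-∀
        e₂ : ∀ j n → j + n + 1ℤ ≡ j + 1ℤ + 1ℤ * n
        e₂ = solve-∀
        e : ∀ a b → a + b - a ≡ b
        e = solve-∀
      periodic′ : ∀ d → py (d + + n) ≡ py d + + k
      periodic′ d = trans (same-increments (λ j → py (j + + n)) py increments d)
        (cong (_+_ (py d)) (trans (+-identityʳ (py (+ n))) py-n))

    open IsPath py-path public using (mono; lipschitz) renaming (shift to py-shift)

    -- The translate P + (0 , k), on the antidiagonal d.
    N : ℤ → ℤ
    N d = py (d - + k) + + k

    N-path : IsPath k N
    N-path = record { step = λ d → step′ d (IsPath.step py-path (d - + k)) ; periodic = periodic′ }
      where
      c : ∀ d m k → d + m - k ≡ d - k + m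
      c = solve-∀
      step′ : ∀ d → py (d - + k + 1ℤ) ≡ py (d - + k) ⊎ py (d - + k + 1ℤ) ≡ py (d - + k) + 1ℤ → N (d + 1ℤ) ≡ N d ⊎ N (d + 1ℤ) ≡ N d + 1ℤ
      step′ d (inj₁ p) = inj₁ (cong (_+ + k) (trans (cong py (c d 1ℤ (+ k))) p))
      step′ d (inj₂ p) = inj₂ (trans (cong (_+ + k) (trans (cong py (c d 1ℤ (+ k))) p)) (c′ (py (d - + k)) (+ k)))
        where c′ : ∀ a k → a + 1ℤ + k ≡ a + k + 1ℤ
              c′ = solve-∀
      periodic′ : ∀ d → N (d + + n) ≡ N d + + k
      periodic′ d = cong (_+ + k) (trans (cong py (c d (+ n) (+ k))) (IsPath.periodic py-path (d - + k)))

    R⇒ : ∀ j → P at j ≡ R → py j ≡ py (j - 1ℤ)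
    R⇒ j e = trans (cong py (sym (-1+1 j))) (trans (py-+1 (j - 1ℤ))
      (trans (cong (λ t → py (j - 1ℤ) + dy (P at t)) (-1+1 j)) (trans (cong (λ s → py (j - 1ℤ) + dy s) e) (+-identityʳ _))))

    U⇒ : ∀ j → P at j ≡ U → py j ≡ py (j - 1ℤ) + 1ℤ
    U⇒ j e = trans (cong py (sym (-1+1 j))) (trans (py-+1 (j - 1ℤ))
      (trans (cong (λ t → py (j - 1ℤ) + dy (P at t)) (-1+1 j)) (cong (λ s → py (j - 1ℤ) + dy s) e)))

    -- The antidiagonal x + y + 1 holds the corners (x, y + 1) and (x + 1, y) of the box: `L` passes
    -- at or below the second and `H` at or above the first.
    Between : (L H : ℤ → ℤ) → ℤ → ℤ → Set
    Between L H x y = L (x + y + 1ℤ) ≤ y × y < H (x + y + 1ℤ)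

    -- `InStrip` compares heights in a column, `Between` on an antidiagonal. Since y is not below
    -- the R-step j, the antidiagonal d of the box is not before j; abscissae are monotone, so P at
    -- d is at or to the right of x + 1, hence at height at most y. The upper bound is similar.
    inside⇒between : ∀ {x y} → InStrip x y → Between py N x y
    inside⇒between {x} {y} (j , r , refl , l , u) = subst (λ d → py d ≤ y × y < N d) (sym d≡)
      ( lin₂ (lipschitz {j} {d} (lin₁ l (e₁ j h y))) (≤-reflexive (R⇒ j r)) (e₂ j h y (py d) (py j))
      , +1≤⇒< (lin₁ (lipschitz {d - + k} {j - 1ℤ} (lin₁ (<⇒+1≤ u) (e₃ j h y (+ k)))) (e₄ j h y (+ k) (py (d - + k)))))
      where
      h = py (j - 1ℤ)
      d = j - h + y
      e₀ : ∀ j h y → j - 1ℤ - h + y + 1ℤ ≡ j - h + y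
      e₀ = solve-∀
      d≡ : px (j - 1ℤ) + y + 1ℤ ≡ d
      d≡ = trans (cong (λ t → t + y + 1ℤ) (px≡ (j - 1ℤ))) (e₀ j h y)
      e₁ : ∀ j h y → j - h + y - j ≡ y - h
      e₁ = solve-∀
      e₂ : ∀ j h y p q → y - p ≡ (q + (j - h + y) - (p + j)) + (h - q)
      e₂ = solve-∀
      e₃ : ∀ j h y k → j - 1ℤ - (j - h + y - k) ≡ h + k - (y + 1ℤ)
      e₃ = solve-∀
      e₄ : ∀ j h y k p → p + k - (y + 1ℤ) ≡ p + (j - 1ℤ) - (h + (j - h + y - k))
      e₄ = solve-∀

    private
      find : ∀ m e {x} → px e ≤ x → x < px (e + + m) →
             ∃[ j ] (e ≤ j × j + 1ℤ ≤ e + + m × P at (j + 1ℤ) ≡ R × px j ≡ x)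
      find ℕ.zero    e {x} p q = contradiction (<-≤-trans (subst (λ t → x < px t) (+-identityʳ e) q) p) (<-irrefl refl)
      find (ℕ.suc m) e {x} p q with x <? px (e + + m)
      ... | yes q′ with find m e p q′
      ...   | j , a , b , c = j , a , ≤-trans b (+-monoʳ-≤ e (+≤+ (ℕ.n≤1+n m))) , c
      find (ℕ.suc m) e {x} p q | no ¬q′ with P at (e + + m + 1ℤ) in eq | px-+1 (e + + m)
      ... | R | s = e + + m , i≤i+j e (+ m) , ≤-reflexive (sym (+suc e m)) , eq
          , ≤-antisym (≮⇒≥ ¬q′) (lin₁ (<⇒+1≤ (subst (x <_) (trans (cong px (+suc e m)) s) q)) (e₁ (px (e + + m)) x))
        where
        e₁ : ∀ a b → a - b ≡ a + 1ℤ - (b + 1ℤ)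
        e₁ = solve-∀
      ... | U | s = contradiction (subst (x <_) (trans (cong px (+suc e m)) (trans s (+-identityʳ _))) q) ¬q′

    -- With d = x + y + 1 the two bounds say that x lies between the abscissae of P at d - k and at
    -- d. So the R-step of column x is among these k steps, and monotone heights carry the bounds
    -- over to it.
    between⇒inside : ∀ {x y} → Between py N x y → InStrip x y
    between⇒inside {x} {y} (l , u) with find k (d - + k) lo (subst (λ t → x < px t) (sym (e₁ d (+ k))) hi)
      where
      d = x + y + 1ℤ
      e₁ : ∀ d k → d - k + k ≡ d
      e₁ = solve-∀
      e₂ : ∀ x y p k → x - (x + y + 1ℤ - k - p) ≡ p + k - (y + 1ℤ)
      e₂ = solve-∀
      e₃ : ∀ x y p → x + y + 1ℤ - p - (x + 1ℤ) ≡ y - p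
      e₃ = solve-∀
      lo : px (d - + k) ≤ x
      lo = subst (_≤ x) (sym (px≡ (d - + k))) (lin₁ (<⇒+1≤ u) (e₂ x y (py (d - + k)) (+ k)))
      hi : x < px d
      hi = subst (x <_) (sym (px≡ d)) (+1≤⇒< (lin₁ l (e₃ x y (py d))))
    ... | j , a , b , r , e = j + 1ℤ , r , trans (cong px (+1-1 j)) e
      , subst (_≤ y) (cong py (sym (+1-1 j))) (≤-trans (mono (≤-trans (<⇒≤ (a<a+1 j)) (subst (j + 1ℤ ≤_) (e₁ (x + y + 1ℤ) (+ k)) b))) l)
      , <-≤-trans u (+-monoˡ-≤ (+ k) (mono (subst (x + y + 1ℤ - + k ≤_) (sym (+1-1 j)) a)))
      where
      e₁ : ∀ d k → d - k + k ≡ d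
      e₁ = solve-∀

    -- The edge e joins the points with ordinates lo e and hi e on the
    -- antidiagonals pos₀ e and pos e.
    pos₀ pos lo hi : Edge → ℤ
    pos₀ (horizontal x y) = x + y
    pos₀ (vertical x y)   = x + y
    pos e = pos₀ e + 1ℤ
    lo (horizontal x y) = y
    lo (vertical x y)   = y
    hi (horizontal x y) = y
    hi (vertical x y)   = y + 1ℤ

    On : (ℤ → ℤ) → Edge → Set
    On H e = H (pos₀ e) ≡ lo e × H (pos e) ≡ hi e

    private
      px+py-1 : ∀ j → px (j - 1ℤ) + py (j - 1ℤ) + 1ℤ ≡ j
      px+py-1 j = trans (cong (_+ 1ℤ) (px+py (j - 1ℤ))) (-1+1 j)

    pos-south : ∀ j → pos (south j) ≡ j
    pos-south j with P at j
    ... | R = px+py-1 j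
    ... | U = px+py-1 j

    On-south : ∀ j → On py (south j)
    On-south j with P at j in eq
    ... | R = cong py (px+py (j - 1ℤ)) , trans (cong py (px+py-1 j)) (R⇒ j eq)
    ... | U = cong py (px+py (j - 1ℤ)) , trans (cong py (px+py-1 j)) (U⇒ j eq)

    -- Translation by (0, k) adds k to x + y; the shift from i to i + k in the first letter comes
    -- from here.
    pos-north : ∀ j → pos (north j) ≡ j + + k
    pos-north j with P at j
    ... | R = trans (e (px (j - 1ℤ)) (py (j - 1ℤ)) (+ k)) (cong (_+ + k) (px+py-1 j))
      where e : ∀ a b c → a + (b + c) + 1ℤ ≡ a + b + 1ℤ + c
            e = solve-∀
    ... | U = trans (e (px (j - 1ℤ)) (py (j - 1ℤ)) (+ k)) (cong (_+ + k) (px+py-1 j))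
      where e : ∀ a b c → a + (b + c) + 1ℤ ≡ a + b + 1ℤ + c
            e = solve-∀

    On-north : ∀ j → On N (north j)
    On-north j with P at j in eq
    ... | R = cong (_+ + k) (cong py (trans (e₁ (px (j - 1ℤ)) (py (j - 1ℤ)) (+ k)) (px+py (j - 1ℤ))))
            , cong (_+ + k) (trans (cong py (trans (e₂ (px (j - 1ℤ)) (py (j - 1ℤ)) (+ k)) (px+py-1 j))) (R⇒ j eq))
      where e₁ : ∀ a b c → a + (b + c) - c ≡ a + b
            e₁ = solve-∀
            e₂ : ∀ a b c → a + (b + c) + 1ℤ - c ≡ a + b + 1ℤ
            e₂ = solve-∀
    ... | U = cong (_+ + k) (cong py (trans (e₁ (px (j - 1ℤ)) (py (j - 1ℤ)) (+ k)) (px+py (j - 1ℤ))))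
            , trans (cong (_+ + k) (trans (cong py (trans (e₂ (px (j - 1ℤ)) (py (j - 1ℤ)) (+ k)) (px+py-1 j))) (U⇒ j eq)))
                (e₃ (py (j - 1ℤ)) (+ k))
      where e₁ : ∀ a b c → a + (b + c) - c ≡ a + b
            e₁ = solve-∀
            e₂ : ∀ a b c → a + (b + c) + 1ℤ - c ≡ a + b + 1ℤ
            e₂ = solve-∀
            e₃ : ∀ a c → a + 1ℤ + c ≡ a + c + 1ℤ
            e₃ = solve-∀

  -- Flipping the peaks of a path

  flip : Fin n → (ℤ → ℤ) → ℤ → ℤ
  flip j H d with d ≋? lab j
  ... | yes _ = H d - 1ℤ
  ... | no  _ = H d

  module _ (j : Fin n) (H : ℤ → ℤ) {d : ℤ} where

    flip-≋ : d ≋ lab j → flip j H d ≡ H d - 1ℤ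
    flip-≋ p with d ≋? lab j
    ... | yes _ = refl
    ... | no ¬p = contradiction p ¬p

    flip-≋̸ : ¬ d ≋ lab j → flip j H d ≡ H d
    flip-≋̸ ¬p with d ≋? lab j
    ... | yes p = contradiction p ¬p
    ... | no _  = refl

    flip-≤ : flip j H d ≤ H d
    flip-≤ with d ≋? lab j
    ... | yes _ = <⇒≤ (a-1<a (H d))
    ... | no  _ = ≤-refl

  -- A U-step followed by an R-step: the corner that can be pushed down by one box.
  PeakAt : ℤ → (ℤ → ℤ) → Set
  PeakAt d H = H d ≡ H (d - 1ℤ) + 1ℤ × H (d + 1ℤ) ≡ H d

  module _ {k : ℕ} {H : ℤ → ℤ} (path : IsPath k H) where
    open IsPath path

    PeakAt-≋ : ∀ {d e} → d ≋ e → PeakAt e H → PeakAt d H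
    PeakAt-≋ {_} {e} p (a , b) with ≋-elim p
    ... | q , refl = trans (shift q e) (trans (cong (_+ q * + k) a) (trans (e₁ (H (e - 1ℤ)) (q * + k))
                       (cong (_+ 1ℤ) (trans (sym (shift q (e - 1ℤ))) (cong H (e₂ e (q * + n)))))))
                   , trans (cong H (e₃ e (q * + n))) (trans (shift q (e + 1ℤ)) (trans (cong (_+ q * + k) b) (sym (shift q e))))
      where
      e₁ : ∀ a b → a + 1ℤ + b ≡ a + b + 1ℤ
      e₁ = solve-∀
      e₂ : ∀ a b → a - 1ℤ + b ≡ a + b - 1ℤ
      e₂ = solve-∀
      e₃ : ∀ a b → a + b + 1ℤ ≡ a + 1ℤ + b
      e₃ = solve-∀

    module _ (j : Fin n) (peak : PeakAt (lab j) H) where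

      flip-path : IsPath k (flip j H)
      flip-path = record { step = step′ ; periodic = periodic′ }
        where
        step′ : ∀ d → flip j H (d + 1ℤ) ≡ flip j H d ⊎ flip j H (d + 1ℤ) ≡ flip j H d + 1ℤ
        step′ d with d ≋? lab j
        ... | yes p = inj₂ (trans (flip-≋̸ j H (λ q → a+1≋̸a (≋-trans q (≋-sym p))))
                          (trans (proj₂ (PeakAt-≋ p peak)) (sym (-1+1 (H d)))))
        ... | no ¬p with d + 1ℤ ≋? lab j
        ...   | yes q = inj₁ (trans (cong (_- 1ℤ) (trans (proj₁ (PeakAt-≋ q peak)) (cong (λ t → H t + 1ℤ) (+1-1 d)))) (+1-1 (H d)))
        ...   | no ¬q = step d
        periodic′ : ∀ d → flip j H (d + + n) ≡ flip j H d + + k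
        periodic′ d with d ≋? lab j
        ... | yes p = trans (flip-≋ j H (≋-trans (≋-intro 1ℤ (e (+ n) d)) p)) (trans (cong (_- 1ℤ) (periodic d)) (e₂ (H d) (+ k)))
          where e : ∀ n d → d + n ≡ d + 1ℤ * n
                e = solve-∀
                e₂ : ∀ a b → a + b - 1ℤ ≡ a - 1ℤ + b
                e₂ = solve-∀
        ... | no ¬p = trans (flip-≋̸ j H (λ p → ¬p (≋-trans (≋-intro -[1+ 0 ] (e d (+ n))) p))) (periodic d)
          where e : ∀ d n → d ≡ d + n + (- 1ℤ) * n
                e = solve-∀

  -- The end is compared pointwise, because heights are functions on ℤ.
  data Chain : (ℤ → ℤ) → Word → (ℤ → ℤ) → Set where
    []  : ∀ {H K} → (∀ d → H d ≡ K d) → Chain H [] K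
    _∷_ : ∀ {H K j w} → PeakAt (lab j) H → Chain (flip j H) w K → Chain H (j ∷ w) K

  Chain-≤ : ∀ {H w K} → Chain H w K → ∀ d → K d ≤ H d
  Chain-≤ ([] e)  d = ≤-reflexive (sym (e d))
  Chain-≤ {H} (_∷_ {j = j} _ c) d = ≤-trans (Chain-≤ c d) (flip-≤ j H)

  flip-cong : ∀ {H H′} j c → (∀ d → H′ d ≡ H d + c) → ∀ d → flip j H′ d ≡ flip j H d + c
  flip-cong {H} j c p d with d ≋? lab j
  ... | yes _ = trans (cong (_- 1ℤ) (p d)) (e (H d) c)
    where e : ∀ a c → a + c - 1ℤ ≡ a - 1ℤ + c
          e = solve-∀
  ... | no  _ = p d

  PeakAt-+ : ∀ (H : ℤ → ℤ) {H′ d} c → (∀ d → H′ d ≡ H d + c) → PeakAt d H → PeakAt d H′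
  PeakAt-+ H {d = d} c p (a , b) =
    trans (p _) (trans (cong (_+ c) a) (trans (e (H (d - 1ℤ)) c) (cong (_+ 1ℤ) (sym (p _)))))
    , trans (p _) (trans (cong (_+ c) b) (sym (p _)))
    where e : ∀ a c → a + 1ℤ + c ≡ a + c + 1ℤ
          e = solve-∀

  -- Peaks and flips do not see a shift along the antidiagonals. So the word found for the raised
  -- path also serves `i • P`, which is only a translate of it.
  Chain-+ : ∀ {H w K H′ K′} c → (∀ d → H′ d ≡ H d + c) → (∀ d → K′ d ≡ K d + c) → Chain H w K → Chain H′ w K′
  Chain-+ c p q ([] e) = [] λ d → trans (p d) (trans (cong (_+ c) (e d)) (sym (q d)))
  Chain-+ {H} c p q (_∷_ {j = j} a b) = PeakAt-+ H c p a ∷ Chain-+ c (flip-cong j c p) q b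

  Chain-∷ʳ : ∀ {H w K K′} j → Chain H w K → PeakAt (lab j) K → (∀ d → K′ d ≡ flip j K d) → Chain H (w ∷ʳ j) K′
  Chain-∷ʳ {H} {K = K} j ([] e) a p = PeakAt-+ K 0ℤ e′ a ∷ [] (λ d → trans (flip-cong j 0ℤ e′ d) (trans (+-identityʳ _) (sym (p d))))
    where e′ : ∀ d → H d ≡ K d + 0ℤ
          e′ d = trans (e d) (sym (+-identityʳ _))
  Chain-∷ʳ j (b ∷ c) a p = b ∷ Chain-∷ʳ j c a p

  private
    sum-mono : ∀ {m} (f g : Fin m → ℕ) → (∀ i → f i ℕ.≤ g i) → sumℕ f ℕ.≤ sumℕ g
    sum-mono {ℕ.zero}  f g p = ℕ.z≤n
    sum-mono {ℕ.suc m} f g p = ℕ.+-mono-≤ (p zero) (sum-mono (f ∘ suc) (g ∘ suc) (p ∘ suc))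

    sum-mono-< : ∀ {m} (f g : Fin m → ℕ) → (∀ i → f i ℕ.≤ g i) → ∀ j → f j ℕ.< g j → sumℕ f ℕ.< sumℕ g
    sum-mono-< f g p zero    q = ℕ.+-mono-<-≤ q (sum-mono (f ∘ suc) (g ∘ suc) (p ∘ suc))
    sum-mono-< f g p (suc j) q = ℕ.+-mono-≤-< (p zero) (sum-mono-< (f ∘ suc) (g ∘ suc) (p ∘ suc) j q)

    ∣∣-mono-≤ : ∀ {a b} → 0ℤ ≤ a → a ≤ b → ∣ a ∣ ℕ.≤ ∣ b ∣
    ∣∣-mono-≤ (+≤+ _) (+≤+ p) = p

    ∣∣-mono-< : ∀ {a b} → 0ℤ ≤ a → a < b → ∣ a ∣ ℕ.< ∣ b ∣
    ∣∣-mono-< (+≤+ _) (+<+ p) = p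

  -- Existence of a word between two paths

  module _ {k : ℕ} (0<k : 0ℤ < + k) (k<n : + k < + n) {K : ℤ → ℤ} (pathK : IsPath k K) where

    private
      module K = IsPath pathK

      module _ {H : ℤ → ℤ} (path : IsPath k H) where
        open IsPath path

        -- Going left along R-steps keeps `H` constant and cannot raise `K`, so `H` stays strictly
        -- above until a U-step is found.
        rise : ∀ m d → K d < H d → H (d - + m) < H d → ∃[ e ] (K e < H e × H e ≡ H (e - 1ℤ) + 1ℤ)
        rise ℕ.zero    d p q = contradiction (subst (λ t → H t < H d) (+-identityʳ d) q) (<-irrefl refl)
        rise (ℕ.suc m) d p q with step (d - 1ℤ)
        ... | inj₁ e = rise m (d - 1ℤ)
            (≤-<-trans (K.mono (<⇒≤ (a-1<a d))) (subst (K d <_) e′ p))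
            (subst₂ _<_ (cong H (e₁ d (+ m))) e′ q)
          where
          e′ : H d ≡ H (d - 1ℤ)
          e′ = trans (cong H (sym (-1+1 d))) e
          e₁ : ∀ d m → d - (1ℤ + m) ≡ d - 1ℤ - m
          e₁ = solve-∀
        ... | inj₂ e = d , p , trans (cong H (sym (-1+1 d))) e

        -- Going right along U-steps raises `H` by one each time and `K` by at most one, so `H`
        -- stays strictly above until an R-step completes a peak. Over a period the rise k < n
        -- forces such a step.
        peak : ∀ m d → K d < H d → H d ≡ H (d - 1ℤ) + 1ℤ → H (d + + m) < H d + + m → ∃[ e ] (K e < H e × PeakAt e H)
        peak ℕ.zero    d p r q = contradiction (subst₂ (λ t t′ → H t < t′) (+-identityʳ d) (+-identityʳ (H d)) q) (<-irrefl refl)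
        peak (ℕ.suc m) d p r q with step d
        ... | inj₁ e = d , p , r , e
        ... | inj₂ e = peak m (d + 1ℤ)
            (≤-<-trans (K.step-≤ d) (subst (K d + 1ℤ <_) (sym e) (+-monoˡ-< 1ℤ p)))
            (trans e (cong (λ t → H t + 1ℤ) (sym (+1-1 d))))
            (subst₂ _<_ (cong H (sym (+-assoc d 1ℤ (+ m)))) (trans (sym (+-assoc (H d) 1ℤ (+ m))) (cong (_+ + m) (sym e))) q)

        peak-exists : ∀ d → K d < H d → ∃[ j ] (K (lab j) < H (lab j) × PeakAt (lab {n} j) H)
        peak-exists d p with rise n d p (subst (_< H d) (sym (trans (cong H (e₁ d (+ n))) (shift (- 1ℤ) d)))
                               (+1≤⇒< (lin₁ (<⇒+1≤ 0<k) (e₂ (H d) (+ k)))))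
          where
          e₁ : ∀ d n → d - n ≡ d + (- 1ℤ) * n
          e₁ = solve-∀
          e₂ : ∀ h k → h - (h + (- 1ℤ) * k + 1ℤ) ≡ k - (0ℤ + 1ℤ)
          e₂ = solve-∀
        ... | d′ , p′ , r with peak n d′ p′ r (subst (_< H d′ + + n) (sym (periodic d′)) (+-monoʳ-< (H d′) k<n))
        ...   | e , p″ , r′ = residue e , strict (≋-sym (lab-residue e)) , PeakAt-≋ path (≋-sym (lab-residue e)) r′
          where
          strict : ∀ {x} → x ≋ e → K x < H x
          strict c with ≋-elim c
          ... | q , refl = subst₂ _<_ (sym (K.shift q e)) (sym (shift q e)) (+-monoˡ-< (q * + k) p″)

      -- For `H` above `K`, the number of boxes between the two paths modulo translation.
      potential : (ℤ → ℤ) → ℕ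
      potential H = sumℕ {n} (λ i → ∣ H (lab i) - K (lab i) ∣)

      flip-≥ : ∀ {H} j → (∀ d → K d ≤ H d) → (IsPath k H) → K (lab j) < H (lab j) → ∀ d → K d ≤ flip j H d
      flip-≥ {H} j p path q d with d ≋? lab j
      ... | no  _ = p d
      ... | yes c with ≋-elim c
      ...   | m , refl = subst₂ (λ a b → a ≤ b - 1ℤ) (sym (K.shift m (lab j))) (sym (IsPath.shift path m (lab j)))
                           (lin₁ (<⇒+1≤ q) (e (K (lab j)) (H (lab j)) (m * + k)))
        where e : ∀ a b m → b + m - 1ℤ - (a + m) ≡ b - (a + 1ℤ)
              e = solve-∀

      potential-flip : ∀ {H} j → (∀ d → K d ≤ H d) → IsPath k H → K (lab j) < H (lab j) →
                       potential (flip j H) ℕ.< potential H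
      potential-flip {H} j p path q = sum-mono-< {n}
        (λ i → ∣ flip j H (lab i) - K (lab i) ∣) (λ i → ∣ H (lab i) - K (lab i) ∣)
        (λ i → ∣∣-mono-≤ (0≤ i) (+-monoˡ-≤ (- K (lab i)) (flip-≤ j H))) j
        (∣∣-mono-< (0≤ j) (+-monoˡ-< (- K (lab j)) (subst (_< H (lab j)) (sym (flip-≋ j H ≋-refl)) (a-1<a _))))
        where
        0≤ : ∀ (i : Fin n) → 0ℤ ≤ flip j H (lab i) - K (lab i)
        0≤ i = i≤j⇒0≤j-i (flip-≥ j p path q (lab i))

      equal : ∀ {H} → IsPath k H → (∀ d → K d ≤ H d) → ¬ (∃[ i ] K (lab {n} i) < H (lab i)) → ∀ d → H d ≡ K d
      equal {H} path p ¬q d = go (lab-residue d)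
        where
        go : ∀ {i} → d ≋ lab {n} i → H d ≡ K d
        go {i} c = let m , e = ≋-elim c in trans (cong H e) (trans (IsPath.shift path m _) (trans (cong (_+ m * + k)
          (≤-antisym (≮⇒≥ λ l → ¬q (i , l)) (p _))) (trans (sym (K.shift m _)) (cong K (sym e)))))

      -- `N` strictly bounds the number of boxes left and makes the recursion structural; each flip
      -- removes one box.
      chain : ∀ N H → IsPath k H → (∀ d → K d ≤ H d) → potential H ℕ.< N → ∃[ w ] Chain H w K
      descend : ∀ N H → IsPath k H → (∀ d → K d ≤ H d) → potential H ℕ.≤ N →
                ∃[ j ] (K (lab j) < H (lab j) × PeakAt (lab {n} j) H) → ∃[ w ] Chain H w K

      chain (ℕ.suc N) H path p (ℕ.s≤s b) with any? (λ (i : Fin n) → K (lab i) <? H (lab i))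
      ... | no ¬q       = [] , [] (equal path p ¬q)
      ... | yes (i , q) = descend N H path p b (peak-exists path (lab i) q)

      descend N H path p b (j , q , r) =
        let w , c = chain N (flip j H) (flip-path path j r) (flip-≥ j p path q)
                          (ℕ.<-≤-trans (potential-flip j p path q) b)
        in j ∷ w , r ∷ c

    chain-exists : ∀ {H} → IsPath k H → (∀ d → K d ≤ H d) → ∃[ w ] Chain H w K
    chain-exists {H} path p = chain (ℕ.suc (potential H)) H path p (ℕ.n<1+n _)

  -- The initial labelling: position d on the northern boundary belongs to the northern edge d - k.
  translation : ℕ → AffinePerm n
  translation k = record
    { perm     = mk↔ₛ′ (λ d → d - + k) (λ d → d + + k) (λ d → e₁ d (+ k)) (λ d → e₂ d (+ k))
    ; periodic = λ d → e₃ d (+ n) (+ k)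
    }
    where
    e₁ : ∀ d k → d + k - k ≡ d
    e₁ = solve-∀
    e₂ : ∀ d k → d - k + k ≡ d
    e₂ = solve-∀
    e₃ : ∀ d n k → d + n - k ≡ d - k + n
    e₃ = solve-∀

  module Strands {k : ℕ} (P : 𝒫 k n) where

    open Profile P
    open DecMembership (≡-dec _≟_ _≟_) using (_∈?_)

    -- Strands

    private
      common : (xs ys : List (ℤ × ℤ)) → ℕ
      common xs ys = length (filter (_∈? ys) xs)

    common-∷ˡ : ∀ {z} xs {ys} → z ∉ ys → common (z ∷ xs) ys ≡ common xs ys
    common-∷ˡ xs {ys} p = cong length (filter-reject (_∈? ys) p)

    common-∷ʳ : ∀ {z} xs {ys} → z ∉ xs → common xs (z ∷ ys) ≡ common xs ys
    common-∷ʳ []       p = refl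
    common-∷ʳ {z} (w ∷ xs) {ys} p = go (w ∈? ys)
      where
      ih = common-∷ʳ xs {ys} (p ∘ there)
      go : Dec (w ∈ ys) → common (w ∷ xs) (z ∷ ys) ≡ common (w ∷ xs) ys
      go (yes q) = trans (cong length (filter-accept (_∈? (z ∷ ys)) {xs = xs} (there q)))
        (trans (cong ℕ.suc ih) (sym (cong length (filter-accept (_∈? ys) {xs = xs} q))))
      go (no ¬q) = trans (common-∷ˡ xs λ { (here e) → p (here (sym e)) ; (there q) → ¬q q })
        (trans ih (sym (common-∷ˡ xs ¬q)))

    common-∷∷ : ∀ {z} xs ys → z ∉ xs → common (z ∷ xs) (z ∷ ys) ≡ ℕ.suc (common xs ys)
    common-∷∷ {z} xs ys p = trans (cong length (filter-accept (_∈? (z ∷ ys)) {xs = xs} (here refl))) (cong ℕ.suc (common-∷ʳ xs p))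

    between? : ∀ L H x y → Dec (Between L H x y)
    between? L H x y = (_ ≤? _) ×-dec (_ <? _)

    diag : Box → ℤ
    diag b = x b + y b + 1ℤ

    -- The proof stored in a box is irrelevant, but the inequalities are decidable and can be
    -- recomputed from it.
    box-between : ∀ b → Between py N (x b) (y b)
    box-between (box x y inside) = recompute (between? py N x y) (inside⇒between inside)

    On-unique : ∀ {H e e′} → On H e → On H e′ → pos e ≡ pos e′ → e ≡ e′
    On-unique {H} {e} {e′} p q r = go e e′ p q (trans (sym (+1-1 _)) (trans (cong (_- 1ℤ) r) (+1-1 _)))
      where
      cancel : ∀ {x y x′ y′} → x + y ≡ x′ + y′ → y ≡ y′ → x ≡ x′
      cancel {x} {y} {x′} e refl = trans (c x y) (trans (cong (_- y) e) (sym (c x′ y)))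
        where c : ∀ a b → a ≡ a + b - b
              c = solve-∀
      absurd : ∀ {y y′} → y ≡ y′ → y ≢ y′ + 1ℤ
      absurd refl e = <⇒≢ (a<a+1 _) e
      go : ∀ e e′ → On H e → On H e′ → pos₀ e ≡ pos₀ e′ → e ≡ e′
      go (horizontal x y) (horizontal x′ y′) (p , q) (p′ , q′) r =
        let s = trans (sym p) (trans (cong H r) p′) in cong₂ horizontal (cancel r s) s
      go (vertical x y) (vertical x′ y′) (p , q) (p′ , q′) r =
        let s = trans (sym p) (trans (cong H r) p′) in cong₂ vertical (cancel r s) s
      go (horizontal x y) (vertical x′ y′) (p , q) (p′ , q′) r =
        contradiction (trans (sym q) (trans (cong H (cong (_+ 1ℤ) r)) q′)) (absurd (trans (sym p) (trans (cong H r) p′)))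
      go (vertical x y) (horizontal x′ y′) (p , q) (p′ , q′) r =
        contradiction (sym (trans (sym q) (trans (cong H (cong (_+ 1ℤ) r)) q′))) (absurd (sym (trans (sym p) (trans (cong H r) p′))))

    exit-≡ : ∀ t b σ → exit t b σ ≡ right b ⊎ exit t b σ ≡ bottom b
    exit-≡ crossing b left = inj₁ refl
    exit-≡ crossing b top  = inj₂ refl
    exit-≡ elbow    b left = inj₂ refl
    exit-≡ elbow    b top  = inj₁ refl

    private
      sh₁ : ∀ x y → x + (y + 1ℤ) ≡ x + y + 1ℤ
      sh₁ = solve-∀
      sh₂ : ∀ x y → x + 1ℤ + y ≡ x + y + 1ℤ
      sh₂ = solve-∀

    pos-top : ∀ b → pos (entry b top) ≡ diag b + 1ℤ
    pos-top b = cong (_+ 1ℤ) (sh₁ (x b) (y b))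

    pos-right : ∀ b → pos (right b) ≡ diag b + 1ℤ
    pos-right b = cong (_+ 1ℤ) (sh₂ (x b) (y b))

    pos-elbow : ∀ b σ → pos (exit elbow b σ) ≡ pos (entry b σ)
    pos-elbow b left = refl
    pos-elbow b top  = trans (pos-right b) (sym (pos-top b))

    Ordered : ℤ → ℤ → ℤ → ℤ → Set
    Ordered a b p q = (a < b × p < q) ⊎ (b < a × q < p)

    module _ {F : Filling} where

      crossingsOn-crossing : ∀ {a} b σ (v : Strand F a (entry b σ)) → tile F b ≡ crossing →
                             crossingsOn (pass b σ v) ≡ (x b , y b) ∷ crossingsOn v
      crossingsOn-crossing b σ v e with tile F b
      crossingsOn-crossing b σ v refl | crossing = refl

      crossingsOn-elbow : ∀ {a} b σ (v : Strand F a (entry b σ)) → tile F b ≡ elbow →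
                          crossingsOn (pass b σ v) ≡ crossingsOn v
      crossingsOn-elbow b σ v e with tile F b
      crossingsOn-elbow b σ v refl | elbow = refl

    -- The strands of F up to the path H; u sends a position on H to the northern
    -- edge at which the strand through it entered.
    record Invariant (F : Filling) (H : ℤ → ℤ) (u : AffinePerm n) : Set where
      field
        existence  : ∀ e → On H e → Strand F (u $ pos e) e
        uniqueness : ∀ {a e} → Strand F a e → On H e → a ≡ u $ pos e
        above      : ∀ {a e} (v : Strand F a e) → On H e → All (λ z → H (proj₁ z + proj₂ z + 1ℤ) ≤ proj₂ z) (crossingsOn v)
        even       : ∀ {a b e e′} (v : Strand F a e) (w : Strand F b e′) → On H e → On H e′ →
                     Ordered a b (pos e) (pos e′) → 2 ℕ.∣ #crossings v w
        odd        : ∀ {a b e e′} (v : Strand F a e) (w : Strand F b e′) → On H e → On H e′ →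
                     Ordered a b (pos e′) (pos e) → 2 ℕ.∣ ℕ.suc (#crossings v w)

    -- The upper left corner (x, y + 1) of the box is one of the peaks being lowered.
    Flipped : (ℤ → ℤ) → Fin n → ℤ → ℤ → Set
    Flipped H j x y = x + y + 1ℤ ≋ lab j × H (x + y + 1ℤ) ≡ y + 1ℤ

    FlippedBox : (ℤ → ℤ) → Fin n → Box → Set
    FlippedBox H j b = Flipped H j (x b) (y b)

    flipped? : ∀ H j x y → Dec (Flipped H j x y)
    flipped? H j x y = (_ ≋? _) ×-dec (_ ≟ _)

    flipped⇒inside : ∀ H j {x y} → (∀ d → py d ≤ flip j H d) → (∀ d → H d ≤ N d) → Flipped H j x y → InStrip x y
    flipped⇒inside H j {x} {y} low high (p , e) = between⇒inside
      ( subst (py (x + y + 1ℤ) ≤_) (trans (flip-≋ j H p) (trans (cong (_- 1ℤ) e) (+1-1 y))) (low _)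
      , <-≤-trans (subst (y <_) (sym e) (a<a+1 y)) (high _))

    -- Strands across a single flip

    module Flip (F : Filling) {H : ℤ → ℤ} {j : Fin n} (path : IsPath k H) (peak : PeakAt (lab j) H)
                (low : ∀ d → py d ≤ flip j H d) (high : ∀ d → H d ≤ N d) where

      private
        H′ = flip j H

      on-entry : ∀ b σ → FlippedBox H j b → On H (entry b σ)
      on-entry b left (p , e) =
        trans (sym (+1-1 _)) (trans (cong (_- 1ℤ) (trans (cong (λ t → H t + 1ℤ) (sym (+1-1 _)))
          (trans (sym (proj₁ (PeakAt-≋ path p peak))) e))) (+1-1 _)) , e
      on-entry b top (p , e) = trans (cong H (sh₁ (x b) (y b))) e
        , trans (cong H (pos-top b)) (trans (proj₂ (PeakAt-≋ path p peak)) e)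

      Unaffected : ℤ → Set
      Unaffected p = ¬ p ≋ lab j × ¬ p ≋ lab j + 1ℤ

      private
        unaffected : ∀ {e} → ¬ pos e ≋ lab j → ¬ pos₀ e ≋ lab j → Unaffected (pos e)
        unaffected p q = p , λ r → q (≋-+⁻ 1ℤ r)

        on-old : ∀ {e} → On H′ e → ¬ pos e ≋ lab j → ¬ pos₀ e ≋ lab j → On H e
        on-old (o , o′) p q = trans (sym (flip-≋̸ j H q)) o , trans (sym (flip-≋̸ j H p)) o′

        peak-pos : ∀ {e} → pos e ≋ lab j → On H′ e → hi e ≡ lo e
        peak-pos {e} p (o , o′) = trans (sym o′) (trans (flip-≋ j H p) (trans (cong (_- 1ℤ) (trans (proj₁ (PeakAt-≋ path p peak))
          (cong (_+ 1ℤ) (trans (cong H (+1-1 _)) (trans (sym (flip-≋̸ j H λ q → a+1≋̸a (≋-trans p (≋-sym q)))) o))))) (+1-1 _)))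

        peak-pos₀ : ∀ {e} → pos₀ e ≋ lab j → On H′ e → hi e ≡ lo e + 1ℤ
        peak-pos₀ {e} p (o , o′) = trans (sym o′) (trans (flip-≋̸ j H (λ q → a+1≋̸a (≋-trans q (≋-sym p))))
          (trans (proj₂ (PeakAt-≋ path p peak)) (trans (sym (-1+1 _)) (cong (_+ 1ℤ) (trans (sym (flip-≋ j H p)) o)))))

        flipped-pos : ∀ {p y} → p ≋ lab j → H′ p ≡ y → H p ≡ y + 1ℤ
        flipped-pos p e = trans (sym (-1+1 _)) (cong (_+ 1ℤ) (trans (sym (flip-≋ j H p)) e))

      data OnCases (e : Edge) : Set where
        old    : On H e → Unaffected (pos e) → OnCases e
        onBottom : pos e ≋ lab j → hi e ≡ lo e → H (pos e) ≡ hi e + 1ℤ → OnCases e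
        onRight  : pos₀ e ≋ lab j → hi e ≡ lo e + 1ℤ → H (pos₀ e) ≡ lo e + 1ℤ → OnCases e

      on-cases : ∀ e → On H′ e → OnCases e
      on-cases e o = go (pos e ≋? lab j) (pos₀ e ≋? lab j)
        where
        go : Dec (pos e ≋ lab j) → Dec (pos₀ e ≋ lab j) → OnCases e
        go (yes p) _       = onBottom p (peak-pos {e} p o) (flipped-pos p (proj₂ o))
        go (no ¬p) (yes q) = onRight q (peak-pos₀ {e} q o) (flipped-pos q (proj₁ o))
        go (no ¬p) (no ¬q) = old (on-old {e} o ¬p ¬q) (unaffected {e} ¬p ¬q)

      right-cases : ∀ b → On H′ (right b) → (On H (right b) × Unaffected (pos (right b))) ⊎ FlippedBox H j b
      right-cases b o with on-cases (right b) o
      ... | old p q      = inj₁ (p , q)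
      ... | onBottom _ e _ = contradiction (sym e) (<⇒≢ (a<a+1 (y b)))
      ... | onRight p _ e  = inj₂ (subst (_≋ lab j) (sh₂ (x b) (y b)) p , trans (cong H (sym (sh₂ (x b) (y b)))) e)

      bottom-cases : ∀ b → On H′ (bottom b) → (On H (bottom b) × Unaffected (pos (bottom b))) ⊎ FlippedBox H j b
      bottom-cases b o with on-cases (bottom b) o
      ... | old p q      = inj₁ (p , q)
      ... | onBottom p _ e = inj₂ (p , e)
      ... | onRight _ e _  = contradiction e (<⇒≢ (a<a+1 (y b)))

      exit-cases : ∀ t b σ → On H′ (exit t b σ) → (On H (exit t b σ) × Unaffected (pos (exit t b σ))) ⊎ FlippedBox H j b
      exit-cases crossing b left = right-cases b
      exit-cases crossing b top  = bottom-cases b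
      exit-cases elbow    b left = bottom-cases b
      exit-cases elbow    b top  = right-cases b

      -- `H` is squeezed between its flip and `N`, so where these two agree it agrees with both, and
      -- nothing was lowered there.
      north-old : ∀ a → On H′ (north a) → On H (north a) × Unaffected (pos (north a))
      north-old a o = (trans e₁ (proj₁ o) , trans e₂ (proj₂ o)) , unaffected {north a} (λ p → not p e₂) (λ p → not p e₁)
        where
        not : ∀ {d} → d ≋ lab j → H d ≢ H′ d
        not p e = <⇒≢ (a-1<a _) (trans (sym (flip-≋ j H p)) (sym e))
        squeeze : ∀ {d z} → N d ≡ z → H′ d ≡ z → H d ≡ H′ d
        squeeze {d} p q = ≤-antisym (subst (H d ≤_) (trans p (sym q)) (high d)) (flip-≤ j H)
        e₁ = squeeze (proj₁ (On-north a)) (proj₁ o)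
        e₂ = squeeze (proj₂ (On-north a)) (proj₂ o)

      -- A strand ending on the flipped path either ended on `H` already, away from the flipped
      -- corners, or has just left a flipped box. Uniqueness and all crossing counts rest on this
      -- split.
      data Last {a : ℤ} : ∀ {e} → Strand F a e → Set where
        early : ∀ {e} {v : Strand F a e} → On H e → Unaffected (pos e) → Last v
        late  : ∀ b σ (v : Strand F a (entry b σ)) → FlippedBox H j b → Last (pass b σ v)

      last : ∀ {a e} (v : Strand F a e) → On H′ e → Last v
      last {a} enter o with north-old a o
      ... | p , q = early p q
      last (pass b σ v) o with exit-cases (tile F b) b σ o
      ... | inj₁ (p , q) = early p q
      ... | inj₂ p       = late b σ v p

      -- The boxes crossed so far lie above `H`, while a box about to be flipped lies just below it.
      fresh : ∀ {u a e} → Invariant F H u → ∀ b → FlippedBox H j b → (v : Strand F a e) → On H e → (x b , y b) ∉ crossingsOn v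
      fresh inv b (_ , eq) v o m =
        contradiction (subst (_≤ y b) eq (All.lookup (Invariant.above inv v o) m)) (<⇒≱ (a<a+1 (y b)))

      new-edge : ∀ e → On H′ e → (On H e × Unaffected (pos e)) ⊎ (∃[ b ] FlippedBox H j b × (e ≡ right b ⊎ e ≡ bottom b))
      new-edge e o with on-cases e o
      new-edge e o | old p q = inj₁ (p , q)
      new-edge (horizontal x y) o | onBottom p e h = inj₂ (box x y (flipped⇒inside H j low high (p , h)) , (p , h) , inj₂ refl)
      new-edge (vertical x y)   o | onBottom p e h = contradiction (sym e) (<⇒≢ (a<a+1 y))
      new-edge (horizontal x y) o | onRight p e h = contradiction e (<⇒≢ (a<a+1 y))
      new-edge (vertical x y)   o | onRight p e h =
        inj₂ (box (x - 1ℤ) y (flipped⇒inside H j low high fl) , fl , inj₁ (cong (λ t → vertical t y) (sym (-1+1 x))))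
        where
        sh : ∀ x y → x + y ≡ x - 1ℤ + y + 1ℤ
        sh = solve-∀
        fl : Flipped H j (x - 1ℤ) y
        fl = subst (_≋ lab j) (sh x y) p , trans (cong H (sym (sh x y))) h

      module _ {u : AffinePerm n} (inv : Invariant F H u) where
        open Invariant inv

        module Crossing (same : ∀ b → FlippedBox H j b → tile F b ≡ crossing) where

          private
            σ = swapAt n (lab j)

            pos-crossing : ∀ b s → FlippedBox H j b → σ (pos (exit crossing b s)) ≡ pos (entry b s)
            pos-crossing b left (p , _) = trans (cong σ (pos-right b))
              (trans (swap-down (≋-+ 1ℤ p)) (+1-1 (diag b)))
            pos-crossing b top (p , _) = trans (swap-up p) (sym (pos-top b))

            pos-crossing′ : ∀ b s → FlippedBox H j b → pos (exit crossing b s) ≡ σ (pos (entry b s))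
            pos-crossing′ b s p = trans (sym (swap-involutive (lab j) _)) (cong σ (pos-crossing b s p))

            pass-crossing : ∀ {a} b s → FlippedBox H j b → Strand F a (entry b s) → Strand F a (exit crossing b s)
            pass-crossing {a} b s p v = subst (λ t → Strand F a (exit t b s)) (same b p) (pass b s v)

            existence′ : ∀ e → On H′ e → Strand F (u $ σ (pos e)) e
            existence′ e o with new-edge e o
            ... | inj₁ (o′ , p , q) = subst (λ t → Strand F (u $ t) e) (sym (swap-stay p q)) (existence e o′)
            ... | inj₂ (b , p , inj₁ refl) = subst (λ t → Strand F (u $ t) (right b)) (sym (pos-crossing b left p))
              (pass-crossing b left p (existence _ (on-entry b left p)))
            ... | inj₂ (b , p , inj₂ refl) = subst (λ t → Strand F (u $ t) (bottom b)) (sym (pos-crossing b top p))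
              (pass-crossing b top p (existence _ (on-entry b top p)))

            uniqueness′ : ∀ {a e} (v : Strand F a e) → On H′ e → a ≡ u $ σ (pos e)
            uniqueness′ v o with last v o
            ... | early o′ (p , q) = trans (uniqueness v o′) (cong (u $_) (sym (swap-stay p q)))
            ... | late b s v′ p = trans (uniqueness v′ (on-entry b s p))
              (cong (u $_) (sym (trans (cong (λ t → σ (pos (exit t b s))) (same b p)) (pos-crossing b s p))))

            above′ : ∀ {a e} (v : Strand F a e) → On H′ e → All (λ z → H′ (proj₁ z + proj₂ z + 1ℤ) ≤ proj₂ z) (crossingsOn v)
            above′ v o with last v o
            ... | early o′ _ = All.map (≤-trans (flip-≤ j H)) (above v o′)
            ... | late b s v′ p = subst (All _) (sym (crossingsOn-crossing b s v′ (same b p)))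
              (≤-reflexive (trans (flip-≋ j H (proj₁ p)) (trans (cong (_- 1ℤ) (proj₂ p)) (+1-1 (y b))))
               ∷ All.map (≤-trans (flip-≤ j H)) (above v′ (on-entry b s p)))

            data Touch (p : ℤ) (cs cs′ : List (ℤ × ℤ)) : Set where
              untouched : Unaffected p → cs ≡ cs′ → Touch p cs cs′
              touched   : ∀ b s → FlippedBox H j b → p ≡ pos (entry b s) → cs ≡ (x b , y b) ∷ cs′ → Touch p cs cs′

            record Back {a e} (v : Strand F a e) : Set where
              constructor back
              field
                {e⁻}  : Edge
                v⁻    : Strand F a e⁻
                on⁻   : On H e⁻
                pos⁻  : pos e ≡ σ (pos e⁻)
                touch : Touch (pos e⁻) (crossingsOn v) (crossingsOn v⁻)

            go-back : ∀ {a e} (v : Strand F a e) → On H′ e → Back v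
            go-back v o with last v o
            ... | early o′ (p , q) = back v o′ (sym (swap-stay p q)) (untouched (p , q) refl)
            ... | late b s v′ p = back v′ (on-entry b s p)
              (trans (cong (λ t → pos (exit t b s)) (same b p)) (pos-crossing′ b s p))
              (touched b s p refl (crossingsOn-crossing b s v′ (same b p)))

            Adjacent : ℤ → ℤ → Set
            Adjacent p q = p ≋ lab j × q ≡ p + 1ℤ

            data Compare (p q : ℤ) (m m⁻ : ℕ) : Set where
              apart  : ¬ Adjacent p q → ¬ Adjacent q p → m ≡ m⁻ → Compare p q m m⁻
              met    : Adjacent p q ⊎ Adjacent q p → m ≡ ℕ.suc m⁻ → Compare p q m m⁻
              equal  : p ≡ q → Compare p q m m⁻

            entry-≋ : ∀ b s → FlippedBox H j b → pos (entry b s) ≋ lab j → pos (entry b s) ≡ diag b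
            entry-≋ b left _ _ = refl
            entry-≋ b top (p , _) q = contradiction
              (≋-trans (subst (_≋ lab j) (pos-top b) q) (≋-sym p)) a+1≋̸a

            entry-≋+1 : ∀ b s → FlippedBox H j b → pos (entry b s) ≋ lab j + 1ℤ → pos (entry b s) ≡ diag b + 1ℤ
            entry-≋+1 b top _ _ = pos-top b
            entry-≋+1 b left (p , _) q = contradiction (≋-trans (≋-sym q) p) a+1≋̸a

            not-adjacent : ∀ {b s b′ s′} → FlippedBox H j b → FlippedBox H j b′ → diag b ≢ diag b′ →
                           ¬ Adjacent (pos (entry b s)) (pos (entry b′ s′))
            not-adjacent {b} {s} {b′} {s′} p p′ d (q , e) = d (trans (sym (+1-1 (diag b))) (trans (cong (_- 1ℤ)
              (trans (sym (cong (_+ 1ℤ) (entry-≋ b s p q))) (trans (sym e)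
                (entry-≋+1 b′ s′ p′ (subst (_≋ lab j + 1ℤ) (sym e) (≋-+ 1ℤ q)))))) (+1-1 (diag b′))))

            same-box : ∀ b b′ → FlippedBox H j b → FlippedBox H j b′ → diag b ≡ diag b′ → (x b , y b) ≡ (x b′ , y b′)
            same-box b b′ (_ , p) (_ , q) d = cong₂ _,_ (trans (c (x b) (y b)) (trans (cong₂ (λ t t′ → t - t′ - 1ℤ) d y≡) (sym (c (x b′) (y b′))))) y≡
              where
              y≡ : y b ≡ y b′
              y≡ = trans (sym (+1-1 (y b))) (trans (cong (_- 1ℤ) (trans (sym p) (trans (cong H d) q))) (+1-1 (y b′)))
              c : ∀ a b → a ≡ a + b + 1ℤ - b - 1ℤ
              c = solve-∀

            -- A new box counts only if both strands have just left it. From different sides, they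
            -- met there; from the same side, they are at one position, the case `equal` that a
            -- strict `Ordered` excludes. Freshness keeps a box touched by only one of them out of
            -- the count.
            compare : ∀ {a b e e′} (v : Strand F a e) (w : Strand F b e′) (V : Back v) (W : Back w) →
                      Compare (pos (Back.e⁻ V)) (pos (Back.e⁻ W)) (#crossings v w) (#crossings (Back.v⁻ V) (Back.v⁻ W))
            compare v w (back v⁻ on₁ _ (untouched (p , _) c)) (back w⁻ on₂ _ (untouched (q , _) d)) =
              apart (p ∘ proj₁) (q ∘ proj₁) (cong₂ common c d)
            compare v w (back v⁻ on₁ _ (touched b s f e c)) (back w⁻ on₂ _ (untouched (q , q′) d)) =
              apart (λ (r , r′) → q′ (subst (_≋ lab j + 1ℤ) (sym r′) (≋-+ 1ℤ r))) (q ∘ proj₁)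
                (trans (cong₂ common c d) (common-∷ˡ (crossingsOn v⁻) (fresh inv b f w⁻ on₂)))
            compare v w (back v⁻ on₁ _ (untouched (p , p′) c)) (back w⁻ on₂ _ (touched b s f e d)) =
              apart (p ∘ proj₁) (λ (r , r′) → p′ (subst (_≋ lab j + 1ℤ) (sym r′) (≋-+ 1ℤ r)))
                (trans (cong₂ common c d) (common-∷ʳ (crossingsOn v⁻) (fresh inv b f v⁻ on₁)))
            compare v w (back v⁻ on₁ _ (touched b s f e c)) (back w⁻ on₂ _ (touched b′ s′ f′ e′ d)) with diag b ≟ diag b′
            ... | no ¬p = apart
                (subst₂ (λ p q → ¬ Adjacent p q) (sym e) (sym e′) (not-adjacent {b} {s} {b′} {s′} f f′ ¬p))
                (subst₂ (λ p q → ¬ Adjacent p q) (sym e′) (sym e) (not-adjacent {b′} {s′} {b} {s} f′ f (¬p ∘ sym)))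
                (trans (cong₂ common c d) (trans
                  (common-∷ˡ (crossingsOn v⁻) (λ { (here r) → ¬p (cong (λ z → proj₁ z + proj₂ z + 1ℤ) r)
                                                 ; (there r) → fresh inv b f w⁻ on₂ r }))
                  (common-∷ʳ (crossingsOn v⁻) (fresh inv b′ f′ v⁻ on₁))))
            ... | yes p = sides s s′ e e′
              where
              count : #crossings v w ≡ ℕ.suc (#crossings v⁻ w⁻)
              count = trans (cong₂ common c (trans d (cong (_∷ crossingsOn w⁻) (sym (same-box b b′ f f′ p)))))
                            (common-∷∷ (crossingsOn v⁻) (crossingsOn w⁻) (fresh inv b f v⁻ on₁))
              sides : ∀ {p q} s s′ → p ≡ pos (entry b s) → q ≡ pos (entry b′ s′) →
                      Compare p q (#crossings v w) (#crossings v⁻ w⁻)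
              sides left left refl refl = equal p
              sides top  top  refl refl = equal (trans (pos-top b) (trans (cong (_+ 1ℤ) p) (sym (pos-top b′))))
              sides left top  refl refl = met (inj₁ (proj₁ f , trans (pos-top b′) (cong (_+ 1ℤ) (sym p)))) count
              sides top  left refl refl = met (inj₂ (proj₁ f′ , trans (pos-top b) (cong (_+ 1ℤ) p))) count

            <-transfer : ∀ {p q} → ¬ Adjacent q p → σ p < σ q → p < q
            <-transfer {p} {q} ¬m l = go (p <? q) (p ≟ q)
              where
              go : Dec (p < q) → Dec (p ≡ q) → p < q
              go (yes r) _          = r
              go (no _)  (yes refl) = contradiction l (<-irrefl refl)
              go (no ¬r) (no ¬e)    = contradiction (swap-mono (≮⇒> ¬r ¬e) ¬m) (<-asym l)

            Ordered-transfer : ∀ {a b p q} → ¬ Adjacent p q → ¬ Adjacent q p → Ordered a b (σ p) (σ q) → Ordered a b p q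
            Ordered-transfer m m′ = map (λ (l , l′) → l , <-transfer m′ l′) (λ (l , l′) → l , <-transfer m l′)

            Adjacent-swap : ∀ {p q} → Adjacent p q → σ p ≡ q × σ q ≡ p
            Adjacent-swap {p} (r , refl) = swap-up r , trans (swap-down (≋-+ 1ℤ r)) (+1-1 p)

            met-swap : ∀ {p q} → Adjacent p q ⊎ Adjacent q p → σ p ≡ q × σ q ≡ p
            met-swap (inj₁ m) = Adjacent-swap m
            met-swap (inj₂ m) = let e , e′ = Adjacent-swap m in e′ , e

            ordered-irrefl : ∀ {a b p q} → p ≡ q → ¬ Ordered a b p q
            ordered-irrefl refl (inj₁ (_ , l)) = <-irrefl refl l
            ordered-irrefl refl (inj₂ (_ , l)) = <-irrefl refl l

            even′ : ∀ {a b e e′} (v : Strand F a e) (w : Strand F b e′) → On H′ e → On H′ e′ →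
                    Ordered a b (pos e) (pos e′) → 2 ℕ.∣ #crossings v w
            even′ {a} {b} v w o o′ r with go-back v o | go-back w o′
            ... | V | W with compare v w V W
            ...   | apart m m′ c = subst (2 ℕ.∣_) (sym c) (even (Back.v⁻ V) (Back.v⁻ W) (Back.on⁻ V) (Back.on⁻ W)
                      (Ordered-transfer m m′ (subst₂ (Ordered a b) (Back.pos⁻ V) (Back.pos⁻ W) r)))
            -- The crossing exchanged the positions and added one to the count, so evenness now is
            -- the earlier `odd`.
            ...   | met m c = subst (2 ℕ.∣_) (sym c) (odd (Back.v⁻ V) (Back.v⁻ W) (Back.on⁻ V) (Back.on⁻ W)
                      (subst₂ (Ordered a b) (trans (Back.pos⁻ V) (proj₁ (met-swap m))) (trans (Back.pos⁻ W) (proj₂ (met-swap m))) r))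
            ...   | equal p = contradiction r (ordered-irrefl (trans (Back.pos⁻ V) (trans (cong σ p) (sym (Back.pos⁻ W)))))

            odd′ : ∀ {a b e e′} (v : Strand F a e) (w : Strand F b e′) → On H′ e → On H′ e′ →
                   Ordered a b (pos e′) (pos e) → 2 ℕ.∣ ℕ.suc (#crossings v w)
            odd′ {a} {b} v w o o′ r with go-back v o | go-back w o′
            ... | V | W with compare v w V W
            ...   | apart m m′ c = subst (λ t → 2 ℕ.∣ ℕ.suc t) (sym c) (odd (Back.v⁻ V) (Back.v⁻ W) (Back.on⁻ V) (Back.on⁻ W)
                      (Ordered-transfer m′ m (subst₂ (Ordered a b) (Back.pos⁻ W) (Back.pos⁻ V) r)))
            ...   | met m c = subst (λ t → 2 ℕ.∣ ℕ.suc t) (sym c) (ℕ.∣m∣n⇒∣m+n ℕ.∣-refl (even (Back.v⁻ V) (Back.v⁻ W) (Back.on⁻ V) (Back.on⁻ W)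
                      (subst₂ (Ordered a b) (trans (Back.pos⁻ W) (proj₂ (met-swap m))) (trans (Back.pos⁻ V) (proj₁ (met-swap m))) r)))
            ...   | equal p = contradiction r (ordered-irrefl (trans (Back.pos⁻ W) (trans (cong σ (sym p)) (sym (Back.pos⁻ V)))))

          invariant : Invariant F H′ (s j · u)
          invariant = record { existence = existence′ ; uniqueness = uniqueness′ ; above = above′ ; even = even′ ; odd = odd′ }

        module Elbow (same : ∀ b → FlippedBox H j b → tile F b ≡ elbow) where

          private
            record Back {a e} (v : Strand F a e) : Set where
              constructor back
              field
                {e⁻}   : Edge
                v⁻     : Strand F a e⁻
                on⁻    : On H e⁻
                pos⁻   : pos e ≡ pos e⁻
                cross⁻ : crossingsOn v ≡ crossingsOn v⁻

            go-back : ∀ {a e} (v : Strand F a e) → On H′ e → Back v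
            go-back v o with last v o
            ... | early o′ _ = back v o′ refl refl
            ... | late b s v′ p = back v′ (on-entry b s p)
              (trans (cong (λ t → pos (exit t b s)) (same b p)) (pos-elbow b s)) (crossingsOn-elbow b s v′ (same b p))

            pass-elbow : ∀ {a} b s → FlippedBox H j b → Strand F a (entry b s) → Strand F a (exit elbow b s)
            pass-elbow {a} b s p v = subst (λ t → Strand F a (exit t b s)) (same b p) (pass b s v)

            existence′ : ∀ e → On H′ e → Strand F (u $ pos e) e
            existence′ e o with new-edge e o
            ... | inj₁ (o′ , _) = existence e o′
            ... | inj₂ (b , p , inj₁ refl) = subst (λ t → Strand F (u $ t) (right b)) (sym (pos-elbow b top))
              (pass-elbow b top p (existence _ (on-entry b top p)))
            ... | inj₂ (b , p , inj₂ refl) = pass-elbow b left p (existence _ (on-entry b left p))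

            uniqueness′ : ∀ {a e} (v : Strand F a e) → On H′ e → a ≡ u $ pos e
            uniqueness′ v o = let V = go-back v o in
              trans (uniqueness (Back.v⁻ V) (Back.on⁻ V)) (cong (u $_) (sym (Back.pos⁻ V)))

            above′ : ∀ {a e} (v : Strand F a e) → On H′ e → All (λ z → H′ (proj₁ z + proj₂ z + 1ℤ) ≤ proj₂ z) (crossingsOn v)
            above′ v o = let V = go-back v o in
              subst (All _) (sym (Back.cross⁻ V)) (All.map (≤-trans (flip-≤ j H)) (above (Back.v⁻ V) (Back.on⁻ V)))

            even′ : ∀ {a b e e′} (v : Strand F a e) (w : Strand F b e′) → On H′ e → On H′ e′ →
                    Ordered a b (pos e) (pos e′) → 2 ℕ.∣ #crossings v w
            even′ {a} {b} v w o o′ r = let V = go-back v o ; W = go-back w o′ in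
              subst (2 ℕ.∣_) (sym (cong₂ common (Back.cross⁻ V) (Back.cross⁻ W)))
                (even (Back.v⁻ V) (Back.v⁻ W) (Back.on⁻ V) (Back.on⁻ W) (subst₂ (Ordered a b) (Back.pos⁻ V) (Back.pos⁻ W) r))

            odd′ : ∀ {a b e e′} (v : Strand F a e) (w : Strand F b e′) → On H′ e → On H′ e′ →
                   Ordered a b (pos e′) (pos e) → 2 ℕ.∣ ℕ.suc (#crossings v w)
            odd′ {a} {b} v w o o′ r = let V = go-back v o ; W = go-back w o′ in
              subst (λ t → 2 ℕ.∣ ℕ.suc t) (sym (cong₂ common (Back.cross⁻ V) (Back.cross⁻ W)))
                (odd (Back.v⁻ V) (Back.v⁻ W) (Back.on⁻ V) (Back.on⁻ W) (subst₂ (Ordered a b) (Back.pos⁻ W) (Back.pos⁻ V) r))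

          invariant : Invariant F H′ u
          invariant = record { existence = existence′ ; uniqueness = uniqueness′ ; above = above′ ; even = even′ ; odd = odd′ }

    ascent-≋ : ∀ (u : AffinePerm n) {d e} → (u $ e) < (u $ (e + 1ℤ)) → d ≋ e → (u $ d) < (u $ (d + 1ℤ))
    ascent-≋ u {_} {e} l r with ≋-elim r
    ... | m , refl = subst₂ _<_ (sym ($-shift u e m)) (sym (trans (cong (u $_) (c e (m * + n))) ($-shift u (e + 1ℤ) m)))
                       (+-monoˡ-< (m * + n) l)
      where c : ∀ a b → a + b + 1ℤ ≡ a + 1ℤ + b
            c = solve-∀

    module _ (F : Filling) where

      private
        -- Both exits end or begin at the lower right corner of the box, where `N` is strictly
        -- higher.
        below-north : ∀ t b σ → ¬ On N (exit t b σ)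
        below-north t b σ o = go (exit-≡ t b σ) o
          where
          go : ∀ {e} → e ≡ right b ⊎ e ≡ bottom b → ¬ On N e
          go (inj₁ refl) (o , _) = <⇒≢ (proj₂ (box-between b)) (trans (sym o) (cong N (c (x b) (y b))))
            where c : ∀ x y → x + 1ℤ + y ≡ x + y + 1ℤ
                  c = solve-∀
          go (inj₂ refl) (_ , o) = <⇒≢ (proj₂ (box-between b)) (sym o)

        north-shift : ∀ a → pos (north a) - + k ≡ a
        north-shift a = trans (cong (_- + k) (pos-north a)) (e a (+ k))
          where e : ∀ d k → d + k - k ≡ d
                e = solve-∀

        unordered : ∀ {a b p q} → p - + k ≡ a → q - + k ≡ b → ¬ Ordered a b q p
        unordered {p = p} {q} refl refl (inj₁ (l , l′)) = <-asym l (+-monoˡ-< (- + k) l′)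
        unordered {p = p} {q} refl refl (inj₂ (l , l′)) = <-asym l (+-monoˡ-< (- + k) l′)

      -- A strand ending on the northern boundary has passed no box. Labels are positions minus k,
      -- so no two strands are out of order and `odd` is vacuous.
      north-invariant : Invariant F N (translation k)
      north-invariant = record { existence = existence ; uniqueness = uniqueness ; above = above ; even = even ; odd = odd }
        where
        existence : ∀ e → On N e → Strand F (pos e - + k) e
        existence e o = subst (Strand F (pos e - + k))
          (On-unique {N} (On-north (pos e - + k)) o (trans (pos-north (pos e - + k)) (c (pos e) (+ k)))) enter
          where c : ∀ d k → d - k + k ≡ d
                c = solve-∀
        uniqueness : ∀ {a e} → Strand F a e → On N e → a ≡ pos e - + k
        uniqueness {a} enter o = sym (north-shift a)
        uniqueness (pass b σ v) o = contradiction o (below-north (tile F b) b σ)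
        above : ∀ {a e} (v : Strand F a e) → On N e → All (λ z → N (proj₁ z + proj₂ z + 1ℤ) ≤ proj₂ z) (crossingsOn v)
        above enter o = []
        above (pass b σ v) o = contradiction o (below-north (tile F b) b σ)
        even : ∀ {a b e e′} (v : Strand F a e) (w : Strand F b e′) → On N e → On N e′ →
               Ordered a b (pos e) (pos e′) → 2 ℕ.∣ #crossings v w
        even enter w o o′ r = 2 ℕ.∣0
        even (pass b σ v) w o o′ r = contradiction o (below-north (tile F b) b σ)
        odd : ∀ {a b e e′} (v : Strand F a e) (w : Strand F b e′) → On N e → On N e′ →
              Ordered a b (pos e′) (pos e) → 2 ℕ.∣ ℕ.suc (#crossings v w)
        odd v w o o′ r = contradiction r (unordered (sym (uniqueness v o)) (sym (uniqueness w o′)))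

    -- Fillings along a chain

    -- The box flipped at the position lab j itself; the others are its translates.
    representative : ∀ (H : ℤ → ℤ) (j : Fin n) → (∀ d → py d ≤ flip j H d) → (∀ d → H d ≤ N d) → Box
    representative H j low high = box (lab j - H (lab j)) (H (lab j) - 1ℤ) (flipped⇒inside H j low high flipped)
      where
      e : ∀ a b → a - b + (b - 1ℤ) + 1ℤ ≡ a
      e = solve-∀
      flipped : Flipped H j (lab j - H (lab j)) (H (lab j) - 1ℤ)
      flipped = ≋-reflexive (e (lab j) (H (lab j))) , trans (cong H (e (lab j) (H (lab j)))) (sym (-1+1 _))

    module _ (H : ℤ → ℤ) (j : Fin n) (low : ∀ d → py d ≤ flip j H d) (high : ∀ d → H d ≤ N d) where

      private
        rep = representative H j low high

        e₀ : ∀ a b → a - b + (b - 1ℤ) + 1ℤ ≡ a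
        e₀ = solve-∀

      diag-representative : diag rep ≡ lab j
      diag-representative = e₀ (lab j) (H (lab j))

      representative-flipped : FlippedBox H j rep
      representative-flipped = ≋-reflexive diag-representative , trans (cong H diag-representative) (sym (-1+1 _))

      flipped⇒∼ : IsPath k H → ∀ b → FlippedBox H j b → b ∼ rep
      flipped⇒∼ path b (p , e) with ≋-elim (≋-sym p)
      ... | m , e′ = m , trans (cong₂ _-_ e′ height) (e₁ (x b) (y b) m (+ n) (+ k)) , trans (cong (_- 1ℤ) height) (e₂ (y b) m (+ k))
        where
        height : H (lab j) ≡ y b + 1ℤ + m * + k
        height = trans (cong H e′) (trans (IsPath.shift path m (diag b)) (cong (_+ m * + k) e))
        e₁ : ∀ x y m n k → x + y + 1ℤ + m * n - (y + 1ℤ + m * k) ≡ x + m * (n - k)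
        e₁ = solve-∀
        e₂ : ∀ y m k → y + 1ℤ + m * k - 1ℤ ≡ y + m * k
        e₂ = solve-∀

      Flipped-∼ : IsPath k H → ∀ {b c} → b ∼ c → FlippedBox H j b → FlippedBox H j c
      Flipped-∼ path {b} {c} (m , e , e′) (p , q) =
        subst (_≋ lab j) (sym d≡) (≋-trans (≋-shift (diag b) m) p)
        , trans (cong H d≡) (trans (IsPath.shift path m (diag b)) (trans (cong (_+ m * + k) q)
            (trans (e₂ (y b) (m * + k)) (cong (_+ 1ℤ) (sym e′)))))
        where
        e₁ : ∀ x y m n k → x + m * (n - k) + (y + m * k) + 1ℤ ≡ x + y + 1ℤ + m * n
        e₁ = solve-∀
        d≡ : diag c ≡ diag b + m * + n
        d≡ = trans (cong₂ (λ a b → a + b + 1ℤ) e e′) (e₁ (x b) (y b) m (+ n) (+ k))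
        e₂ : ∀ a b → a + 1ℤ + b ≡ a + b + 1ℤ
        e₂ = solve-∀

      below-flip : ∀ b → y b < H (diag b) → ¬ FlippedBox H j b → y b < flip j H (diag b)
      below-flip b l ¬p = go (diag b ≋? lab j)
        where
        go : Dec (diag b ≋ lab j) → y b < flip j H (diag b)
        go (no ¬q) = subst (y b <_) (sym (flip-≋̸ j H ¬q)) l
        go (yes q) = subst (y b <_) (sym (flip-≋ j H q)) (≤∧≢⇒< (lin₁ (<⇒+1≤ l) (e (y b) (H (diag b))))
                       λ e′ → ¬p (q , trans (sym (-1+1 _)) (cong (_+ 1ℤ) (sym e′))))
          where e : ∀ a b → b - 1ℤ - a ≡ b - (a + 1ℤ)
                e = solve-∀

      flipped⇒≮flip : ∀ b → FlippedBox H j b → ¬ y b < flip j H (diag b)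
      flipped⇒≮flip b (p , e) l = <-irrefl refl
        (subst (y b <_) (trans (flip-≋ j H p) (trans (cong (_- 1ℤ) e) (+1-1 (y b)))) l)

    -- The state while a word is read: boxes above `H` are done, those below correspond to the
    -- remaining letters.
    record Descent (H : ℤ → ℤ) (w : Word) : Set where
      constructor descent
      field
        path  : IsPath k H
        high  : ∀ d → H d ≤ N d
        chain : Chain H w py

    open Descent

    module _ {H : ℤ → ℤ} {j : Fin n} {w : Word} where

      head : Descent H (j ∷ w) → PeakAt (lab j) H
      head (descent _ _ (p ∷ _)) = p

      tail : Descent H (j ∷ w) → Descent (flip j H) w
      tail (descent path high (p ∷ c)) = descent (flip-path path j p) (λ d → ≤-trans (flip-≤ j H) (high d)) c

      low : Descent H (j ∷ w) → ∀ d → py d ≤ flip j H d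
      low c = Chain-≤ (chain (tail c))

      firstBox : Descent H (j ∷ w) → Box
      firstBox c = representative H j (low c) (high c)

    end : ∀ {H} → Descent H [] → ∀ d → H d ≡ py d
    end (descent _ _ ([] e)) = e

    not-below-end : ∀ {H} → Descent H [] → ∀ b → ¬ y b < H (diag b)
    not-below-end c b l = <⇒≱ l (subst (_≤ y b) (sym (end c (diag b))) (proj₁ (box-between b)))

    read : ∀ {H} w → Descent H w → Filling → Vec Tile (length w)
    read []      c F = []
    read (j ∷ w) c F = tile F (firstBox c) ∷ read w (tail c) F

    read-cong : ∀ {H} w (c : Descent H w) {F G} → (∀ b → tile F b ≡ tile G b) → read w c F ≡ read w c G
    read-cong []      c p = refl
    read-cong (j ∷ w) c p = cong₂ _∷_ (p _) (read-cong w (tail c) p)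

    module _ (F : Filling) {H : ℤ → ℤ} {j : Fin n} {w : Word} (c : Descent H (j ∷ w)) where

      same-tile : ∀ b → FlippedBox H j b → tile F b ≡ tile F (firstBox c)
      same-tile b p = periodic F b (firstBox c) (flipped⇒∼ H j (low c) (high c) (path c) b p)

    -- Valid tiles and the conditions on a Deogram

    module _ (F : Filling) (f : AffinePerm n) where

      -- `Distinguished` for the boxes still to be read; for `N` these are all the boxes of the
      -- strip.
      EvenBelow : (ℤ → ℤ) → Set
      EvenBelow H = ∀ a b (c : Box) → y c < H (diag c) → tile F c ≡ elbow →
        (v : Strand F a (entry c left)) (w : Strand F b (entry c top)) → 2 ℕ.∣ #crossings v w

      -- Each elbow is examined at the flip of its box. Both entries then lie on `H`, and uniqueness
      -- identifies any two strands there by their labels, so the ascent becomes evenness.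
      valid⇒ : ∀ {H u} w (c : Descent H w) → Invariant F H u → Valid u w (read w c F) f →
               HasStrandPermutation F f × EvenBelow H
      valid⇒ {H} {u} [] c inv v = (λ a → subst (λ t → Strand F t (south (f $ a)))
          (trans (cong (u $_) (pos-south (f $ a))) (v a))
          (existence (south (f $ a)) (trans (end c _) (proj₁ (On-south (f $ a))) , trans (end c _) (proj₂ (On-south (f $ a))))))
        , λ a b c′ l → contradiction l (not-below-end c c′)
        where open Invariant inv
      valid⇒ {H} {u} (j ∷ w) c inv v = go (tile F (firstBox c)) refl v
        where
        open Flip F (path c) (head c) (low c) (high c)
        go : ∀ t → tile F (firstBox c) ≡ t → Valid u (j ∷ w) (t ∷ read w (tail c) F) f → HasStrandPermutation F f × EvenBelow H
        go crossing e v = p , λ a b c′ l e′ → q a b c′ (below-flip H j (low c) (high c) c′ l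
            λ r → contradiction (trans (sym e) (trans (sym (same-tile F c c′ r)) e′)) λ ()) e′
          where
          ih = valid⇒ w (tail c) (Crossing.invariant inv λ b r → trans (same-tile F c b r) e) v
          p = proj₁ ih
          q = proj₂ ih
        go elbow e (l , v) = p , λ a b c′ m e′ V W → even-here a b c′ m e′ V W (flipped? H j (x c′) (y c′))
          where
          ih = valid⇒ w (tail c) (Elbow.invariant inv λ b r → trans (same-tile F c b r) e) v
          p = proj₁ ih
          q = proj₂ ih
          even-here : ∀ a b (c′ : Box) → y c′ < H (diag c′) → tile F c′ ≡ elbow →
                 (V : Strand F a (entry c′ left)) (W : Strand F b (entry c′ top)) → Dec (FlippedBox H j c′) → 2 ℕ.∣ #crossings V W
          even-here a b c′ m e′ V W (no ¬r) = q a b c′ (below-flip H j (low c) (high c) c′ m ¬r) e′ V W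
          even-here a b c′ m e′ V W (yes r) = Invariant.even inv V W (on-entry c′ left r) (on-entry c′ top r)
            (inj₁ ( subst₂ _<_ (sym (Invariant.uniqueness inv V (on-entry c′ left r)))
                      (sym (trans (Invariant.uniqueness inv W (on-entry c′ top r)) (cong (u $_) (pos-top c′)))) (ascent-≋ u l (proj₁ r))
                  , subst (diag c′ <_) (sym (pos-top c′)) (a<a+1 _)))

      -- At an elbow the invariant supplies actual strands through both entries. If their labels did
      -- not ascend, their crossings would be odd in number, against `Distinguished`.
      ⇒valid : ∀ {H u} w (c : Descent H w) → Invariant F H u → HasStrandPermutation F f → Distinguished F →
               Valid u w (read w c F) f
      ⇒valid {H} {u} [] c inv p d a = sym (trans
          (Invariant.uniqueness inv (p a) (trans (end c _) (proj₁ (On-south (f $ a))) , trans (end c _) (proj₂ (On-south (f $ a)))))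
          (cong (u $_) (pos-south (f $ a))))
      ⇒valid {H} {u} (j ∷ w) c inv p d = go (tile F (firstBox c)) refl
        where
        open Flip F (path c) (head c) (low c) (high c)
        b = firstBox c
        r = representative-flipped H j (low c) (high c)
        go : ∀ t → tile F (firstBox c) ≡ t → Valid u (j ∷ w) (t ∷ read w (tail c) F) f
        go crossing e = ⇒valid w (tail c) (Crossing.invariant inv λ b r → trans (same-tile F c b r) e) p d
        go elbow    e = ascent
          , ⇒valid w (tail c) (Elbow.invariant inv λ b r → trans (same-tile F c b r) e) p d
          where
          posˡ : pos (entry b left) ≡ lab j
          posˡ = diag-representative H j (low c) (high c)
          posʳ : pos (entry b top) ≡ lab j + 1ℤ
          posʳ = trans (pos-top b) (cong (_+ 1ℤ) (diag-representative H j (low c) (high c)))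
          V : Strand F (u $ pos (entry b left)) (entry b left)
          V = Invariant.existence inv (entry b left) (on-entry b left r)
          W : Strand F (u $ pos (entry b top)) (entry b top)
          W = Invariant.existence inv (entry b top) (on-entry b top r)
          two∤ : ∀ {m} → 2 ℕ.∣ m → ¬ 2 ℕ.∣ ℕ.suc m
          two∤ {m} h h′ = contradiction (ℕ.∣1⇒≡1 (ℕ.∣m+n∣m⇒∣n (subst (2 ℕ.∣_) (ℕ.+-comm 1 m) h′) h)) λ ()
          ascent : (u $ lab j) < (u $ (lab j + 1ℤ))
          ascent = subst₂ (λ s t → (u $ s) < (u $ t)) posˡ posʳ (lemma (_ <? _))
            where
            lemma : Dec ((u $ pos (entry b left)) < (u $ pos (entry b top))) → (u $ pos (entry b left)) < (u $ pos (entry b top))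
            lemma (yes l) = l
            lemma (no ¬l) = contradiction
              (Invariant.odd inv V W (on-entry b left r) (on-entry b top r) (inj₂
                (≮⇒> ¬l (λ e′ → <⇒≢ (a<a+1 (lab j)) (trans (sym posˡ) (trans ($-injective u e′) posʳ)))
                , subst₂ _<_ (sym posˡ) (sym posʳ) (a<a+1 (lab j)))))
              (two∤ (d _ _ b e V W))

    -- The filling with prescribed tiles

    choose : ∀ {A : Set} → Dec A → Tile → Tile → Tile
    choose (yes _) s t = s
    choose (no _)  s t = t

    choose-yes : ∀ {A : Set} (d : Dec A) {s t} → A → choose d s t ≡ s
    choose-yes (yes _) _ = refl
    choose-yes (no ¬a) a = contradiction a ¬a

    choose-no : ∀ {A : Set} (d : Dec A) {s t} → ¬ A → choose d s t ≡ t
    choose-no (yes a) ¬a = contradiction a ¬a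
    choose-no (no _)  _  = refl

    choose-cong : ∀ {A B : Set} (d : Dec A) (e : Dec B) {s t t′} → (A → B) → (B → A) → t ≡ t′ → choose d s t ≡ choose e s t′
    choose-cong (yes _) (yes _) f g p = refl
    choose-cong (no _)  (no _)  f g p = p
    choose-cong (yes a) (no ¬b) f g p = contradiction (f a) ¬b
    choose-cong (no ¬a) (yes b) f g p = contradiction (g b) ¬a

    fillTile : (H : ℤ → ℤ) (w : Word) → Vec Tile (length w) → ℤ → ℤ → Tile
    -- A default value: every box of the strip is claimed by some letter before the word ends.
    fillTile H []      []       x y = crossing
    fillTile H (j ∷ w) (t ∷ ts) x y = choose (flipped? H j x y) t (fillTile (flip j H) w ts x y)

    ∼-sym : ∀ {b c} → b ∼ c → c ∼ b
    ∼-sym {b} {c} (m , p , q) = - m , back (x b) (x c) m (+ n - + k) p , back (y b) (y c) m (+ k) q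
      where
      e : ∀ u m t → u ≡ u + m * t + - m * t
      e = solve-∀
      back : ∀ u v m t → v ≡ u + m * t → u ≡ v + - m * t
      back u v m t refl = e u m t

    fillTile-∼ : ∀ {H} w (c : Descent H w) (ts : Vec Tile (length w)) a b → a ∼ b →
                 fillTile H w ts (x a) (y a) ≡ fillTile H w ts (x b) (y b)
    fillTile-∼ []          c []       a b p = refl
    fillTile-∼ {H} (j ∷ w) c (t ∷ ts) a b p = choose-cong (flipped? H j (x a) (y a)) (flipped? H j (x b) (y b))
      (Flipped-∼ H j (low c) (high c) (path c) {a} {b} p)
      (Flipped-∼ H j (low c) (high c) (path c) {b} {a} (∼-sym {a} {b} p))
      (fillTile-∼ w (tail c) ts a b p)

    fill : ∀ {H} w → Descent H w → Vec Tile (length w) → Filling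
    fill {H} w c ts = record { tile = λ b → fillTile H w ts (x b) (y b) ; periodic = fillTile-∼ w c ts }

    -- Agreement is assumed only below `H`, which is what survives the induction: a box below the
    -- flipped path is not claimed by the current letter, so its tile comes from the remaining ones.
    read-fillTile : ∀ {H} w (c : Descent H w) (ts : Vec Tile (length w)) F → (∀ b → y b < H (diag b) → tile F b ≡ fillTile H w ts (x b) (y b)) →
                    read w c F ≡ ts
    read-fillTile []          c []       F p = refl
    read-fillTile {H} (j ∷ w) c (t ∷ ts) F p = cong₂ _∷_
      (trans (p (firstBox c) below) (choose-yes (flipped? H j (x (firstBox c)) (y (firstBox c))) r))
      (read-fillTile w (tail c) ts F λ b l → trans (p b (<-≤-trans l (flip-≤ j H)))
        (choose-no (flipped? H j (x b) (y b)) λ r → flipped⇒≮flip H j (low c) (high c) b r l))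
      where
      r : FlippedBox H j (firstBox c)
      r = representative-flipped H j (low c) (high c)
      below : y (firstBox c) < H (diag (firstBox c))
      below = subst (y (firstBox c) <_) (sym (proj₂ r)) (a<a+1 _)

    fillTile-read : ∀ {H} w (c : Descent H w) F b → y b < H (diag b) → fillTile H w (read w c F) (x b) (y b) ≡ tile F b
    fillTile-read []          c F b l = contradiction l (not-below-end c b)
    fillTile-read {H} (j ∷ w) c F b l = go (flipped? H j (x b) (y b))
      where
      go : (d : Dec (FlippedBox H j b)) → choose d (tile F (firstBox c)) (fillTile (flip j H) w (read w (tail c) F) (x b) (y b)) ≡ tile F b
      go (yes r) = sym (same-tile F c b r)
      go (no ¬r) = fillTile-read w (tail c) F b (below-flip H j (low c) (high c) b l ¬r)

    -- Counting elbows modulo translation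

    module _ (F : Filling) where

      private
        module E = Setoid (Elbows F)

      ElbowBelow : (ℤ → ℤ) → Set
      ElbowBelow H = Σ[ b ∈ Box ] tile F b ≡ elbow × y b < H (diag b)

      private
        elbowBox : ∀ {H} → ElbowBelow H → E.Carrier
        elbowBox (b , e , _) = b , e

      record Enumeration (H : ℤ → ℤ) (m : ℕ) : Set where
        field
          at        : Fin m → ElbowBelow H
          index     : ElbowBelow H → Fin m
          injective : ∀ i i′ → proj₁ (at i) ∼ proj₁ (at i′) → i ≡ i′
          at-index  : ∀ b → proj₁ (at (index b)) ∼ proj₁ b

      -- The boxes flipped by one letter form a single class. A crossing there contributes no elbow;
      -- an elbow contributes one new class, because a translate of a flipped box is flipped too and
      -- so cannot lie below the flipped path.
      enumerate : ∀ {H} w (c : Descent H w) → Enumeration H (#elbows (read w c F))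
      enumerate [] c = record
        { at        = λ ()
        ; index     = λ (b , _ , l) → contradiction l (not-below-end c b)
        ; injective = λ ()
        ; at-index  = λ (b , _ , l) → contradiction l (not-below-end c b)
        }
      enumerate {H} (j ∷ w) c = go (tile F (firstBox c)) refl (enumerate w (tail c))
        where
        first-flipped : FlippedBox H j (firstBox c)
        first-flipped = representative-flipped H j (low c) (high c)
        weaken : ElbowBelow (flip j H) → ElbowBelow H
        weaken (b , e , l) = b , e , <-≤-trans l (flip-≤ j H)
        go : ∀ t {ts : Vec Tile (length w)} → tile F (firstBox c) ≡ t →
             Enumeration (flip j H) (#elbows ts) → Enumeration H (#elbows (t ∷ ts))
        go crossing e r = record
          { at        = weaken ∘ at
          ; index     = λ b → index (strengthen b)
          ; injective = injective
          ; at-index  = λ b → at-index (strengthen b)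
          }
          where
          open Enumeration r
          strengthen : ElbowBelow H → ElbowBelow (flip j H)
          strengthen (b , e′ , l) = b , e′ , below-flip H j (low c) (high c) b l
            λ p → contradiction (trans (sym e) (trans (sym (same-tile F c b p)) e′)) λ ()
        go elbow {ts} e r = record
          { at        = at′
          ; index     = λ b → index′ b (flipped? H j (x (proj₁ b)) (y (proj₁ b)))
          ; injective = injective′
          ; at-index  = λ b → at-index′ b (flipped? H j (x (proj₁ b)) (y (proj₁ b)))
          }
          where
          open Enumeration r
          at′ : Fin (ℕ.suc (#elbows ts)) → ElbowBelow H
          at′ zero    = firstBox c , e , subst (y (firstBox c) <_) (sym (proj₂ first-flipped)) (a<a+1 _)
          at′ (suc i) = weaken (at i)
          strengthen : (b : ElbowBelow H) → ¬ FlippedBox H j (proj₁ b) → ElbowBelow (flip j H)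
          strengthen (b , e′ , l) ¬p = b , e′ , below-flip H j (low c) (high c) b l ¬p
          index′ : (b : ElbowBelow H) → Dec (FlippedBox H j (proj₁ b)) → Fin (ℕ.suc (#elbows ts))
          index′ b (yes _) = zero
          index′ b (no ¬p) = suc (index (strengthen b ¬p))
          apart : ∀ (b : ElbowBelow (flip j H)) → ¬ firstBox c ∼ proj₁ b
          apart (b , _ , l) p = flipped⇒≮flip H j (low c) (high c) b
            (Flipped-∼ H j (low c) (high c) (path c) {firstBox c} {b} p first-flipped) l
          injective′ : ∀ i i′ → proj₁ (at′ i) ∼ proj₁ (at′ i′) → i ≡ i′
          injective′ zero    zero     p = refl
          injective′ zero    (suc i′) p = contradiction p (apart (at i′))
          injective′ (suc i) zero     p = contradiction (∼-sym {proj₁ (at i)} {firstBox c} p) (apart (at i))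
          injective′ (suc i) (suc i′) p = cong suc (injective i i′ p)
          at-index′ : ∀ b d → proj₁ (at′ (index′ b d)) ∼ proj₁ b
          at-index′ (b , _) (yes p) = ∼-sym {b} {firstBox c} (flipped⇒∼ H j (low c) (high c) (path c) b p)
          at-index′ b       (no ¬p) = at-index (strengthen b ¬p)

      module _ {w} (c : Descent N w) where

        open Enumeration (enumerate w c)

        private
          below : E.Carrier → ElbowBelow N
          below (b , e) = b , e , proj₂ (box-between b)

        hasElbows : HasElbows F (#elbows (read w c F))
        hasElbows = mk≃ nth (index ∘ below) (λ { {i} refl → E.refl {nth i} })
          (λ {b} {b′} p → injective _ _ (E.trans {nth (index (below b))} {b} {nth (index (below b′))} (at-index (below b))
            (E.trans {b} {b′} {nth (index (below b′))} p (E.sym {nth (index (below b′))} {b′} (at-index (below b′))))))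
          (λ b → at-index (below b))
          (λ i → injective _ _ (at-index (below (nth i))))
          where
          nth : Fin (#elbows (read w c F)) → E.Carrier
          nth i = elbowBox {N} (at i)

        -- A Deogram comes with its own count, which has to agree with the one read off the word.
        #elbows-unique : ∀ {m} → HasElbows F m → m ≡ #elbows (read w c F)
        #elbows-unique h = ↔⇒≡ (h ⨾ ≃-sym hasElbows)

    -- Deograms as distinguished subwords

    𝒜≃𝒟 : ∀ {w} → Descent N w → ∀ f r → 𝒜 r f P ≃ 𝒟 (translation k) w f r
    𝒜≃𝒟 {w} c f r = mk≃ to from
      (λ p → read-cong w c p) (λ { {subword ts _ _} {subword _ _ _} refl b → refl })
      (λ (subword ts _ _) → read-fill ts)
      (λ D b → fillTile-read w c (Deogram.filling D) b (proj₂ (box-between b)))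
      where
      read-fill : ∀ ts → read w c (fill w c ts) ≡ ts
      read-fill ts = read-fillTile w c ts (fill w c ts) (λ _ _ → refl)
      to : Deogram r f P → Subword (translation k) w f r
      to D = subword (read w c filling) (⇒valid filling f w c (north-invariant filling) strandPerm distinguished)
        (trans (proj₁ (proj₂ elbows)) (cong +_ (#elbows-unique filling c (proj₂ (proj₂ elbows)))))
        where open Deogram D
      from : Subword (translation k) w f r → Deogram r f P
      from (subword ts v e) = record
        { filling       = F
        ; strandPerm    = proj₁ valid
        ; distinguished = λ a b d → proj₂ valid a b d (proj₂ (box-between d))
        ; elbows        = #elbows ts , e , subst (HasElbows F) (cong #elbows (read-fill ts)) (hasElbows F c)
        }
        where
        F = fill w c ts
        valid = valid⇒ F f w c (north-invariant F) (subst (λ t → Valid (translation k) w t f) (sym (read-fill ts)) v)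

  -- Exchanging two steps of a path

  module _ {m : ℕ} (i j : Fin m) where

    transpose-i : Fin.transpose i j i ≡ j
    transpose-i rewrite dec-true (i Fin.≟ i) refl = refl

    transpose-j : Fin.transpose i j j ≡ i
    transpose-j with j Fin.≟ i
    ... | yes e = e
    ... | no _ rewrite dec-true (j Fin.≟ j) refl = refl

    transpose-other : ∀ {q} → q ≢ i → q ≢ j → Fin.transpose i j q ≡ q
    transpose-other {q} a b rewrite dec-false (q Fin.≟ i) a | dec-false (q Fin.≟ j) b = refl

  swap-translate : ∀ i c a → swapAt n (i + c) a - c ≡ swapAt n i (a - c)
  swap-translate i c a with swapAt n (i + c) a | swapView (i + c) a
  ... | _ | up p   = trans (e a c) (sym (swap-up (subst (a - c ≋_) (e′ i c) (≋-+ (- c) p))))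
    where e : ∀ a c → a + 1ℤ - c ≡ a - c + 1ℤ
          e = solve-∀
          e′ : ∀ i c → i + c - c ≡ i
          e′ = solve-∀
  ... | _ | down p = trans (e a c) (sym (swap-down (subst (a - c ≋_) (e′ i c) (≋-+ (- c) p))))
    where e : ∀ a c → a - 1ℤ - c ≡ a - c - 1ℤ
          e = solve-∀
          e′ : ∀ i c → i + c + 1ℤ - c ≡ i + 1ℤ
          e′ = solve-∀
  ... | _ | stay p q = sym (swap-stay (λ r → p (subst (_≋ i + c) (e a c) (≋-+ c r)))
                                      (λ r → q (subst₂ _≋_ (e a c) (e′ i c) (≋-+ c r))))
    where e : ∀ a c → a - c + c ≡ a
          e = solve-∀
          e′ : ∀ i c → i + 1ℤ + c ≡ i + c + 1ℤ
          e′ = solve-∀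

  -- The strips of P and of s_i P

  module Corner {k : ℕ} (P : 𝒫 k n) (i : Fin n) (PR : P at lab i ≡ R) (PU : P at (lab i + 1ℤ) ≡ U) where

    open Profile P using (py; py-path; py-+1; at-cong; R⇒; U⇒; N; N-path; lipschitz; mono; py-shift)
    module P′ = Profile (i • P)

    private
      i⁺ = residue {n} (lab i + 1ℤ)

    swapped-i : ∀ {j} → j ≋ lab i → (i • P) at j ≡ U
    swapped-i {j} p = trans (cong (λ q → 𝒫.step P (Fin.transpose i i⁺ q)) (trans (residue-cong p) (residue-lab i)))
      (trans (cong (𝒫.step P) (transpose-i i i⁺)) PU)

    swapped-i+1 : ∀ {j} → j ≋ lab i + 1ℤ → (i • P) at j ≡ R
    swapped-i+1 {j} p = trans (cong (λ q → 𝒫.step P (Fin.transpose i i⁺ q)) (residue-cong p))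
      (trans (cong (𝒫.step P) (transpose-j i i⁺)) (trans (cong (𝒫.step P) (sym (residue-lab i))) PR))

    swapped-other : ∀ {j} → ¬ j ≋ lab i → ¬ j ≋ lab i + 1ℤ → (i • P) at j ≡ P at j
    swapped-other {j} p q = cong (𝒫.step P) (transpose-other i i⁺
      (λ e → p (≋-trans (lab-residue j) (≋-reflexive (cong lab e))))
      (λ e → q (≋-trans (lab-residue j) (≋-trans (≋-reflexive (cong lab e)) (≋-sym (lab-residue (lab i + 1ℤ)))))))

    -- The path P with its corner at i moved up by one box; a translate of s i P.
    raise : ∀ {d} → Dec (d ≋ lab i) → ℤ
    raise {d} (yes _) = py d + 1ℤ
    raise {d} (no  _) = py d

    M : ℤ → ℤ
    M d = raise (d ≋? lab i)

    M-≋ : ∀ {d} → d ≋ lab i → M d ≡ py d + 1ℤ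
    M-≋ {d} p with d ≋? lab i
    ... | yes _ = refl
    ... | no ¬p = contradiction p ¬p

    M-≋̸ : ∀ {d} → ¬ d ≋ lab i → M d ≡ py d
    M-≋̸ {d} ¬p with d ≋? lab i
    ... | yes p = contradiction p ¬p
    ... | no _  = refl

    flip-M : ∀ d → py d ≡ flip i M d
    flip-M d = go (d ≋? lab i)
      where
      go : Dec (d ≋ lab i) → py d ≡ flip i M d
      go (yes p) = sym (trans (flip-≋ i M p) (trans (cong (_- 1ℤ) (M-≋ p)) (+1-1 (py d))))
      go (no ¬p) = sym (trans (flip-≋̸ i M ¬p) (M-≋̸ ¬p))

    private
      +1≋̸ : ∀ {d} → d ≋ lab i → ¬ d + 1ℤ ≋ lab i
      +1≋̸ p q = a+1≋̸a (≋-trans q (≋-sym p))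

      py-R : ∀ {d} → d ≋ lab i → py d ≡ py (d - 1ℤ)
      py-R {d} p = R⇒ d (trans (at-cong p) PR)

      py-U : ∀ {d} → d ≋ lab i → py (d + 1ℤ) ≡ py d + 1ℤ
      py-U {d} p = trans (U⇒ (d + 1ℤ) (trans (at-cong (≋-+ 1ℤ p)) PU)) (cong (λ t → py t + 1ℤ) (+1-1 d))

    -- Raising the corner exchanges its R and its U, so `M` has the steps of `i • P`; the heights
    -- may still differ by a constant.
    increments : ∀ d → P′.py (d + 1ℤ) - P′.py d ≡ M (d + 1ℤ) - M d
    increments d = trans (cong (_- P′.py d) (P′.py-+1 d)) (trans (c (P′.py d) _) (go (d ≋? lab i) (d + 1ℤ ≋? lab i)))
      where
      c : ∀ a b → a + b - a ≡ b
      c = solve-∀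
      c₁ : ∀ a → 1ℤ ≡ a + 1ℤ - a
      c₁ = solve-∀
      go : Dec (d ≋ lab i) → Dec (d + 1ℤ ≋ lab i) → dy ((i • P) at (d + 1ℤ)) ≡ M (d + 1ℤ) - M d
      go (yes p) _ = trans (cong dy (swapped-i+1 (≋-+ 1ℤ p))) (sym (trans (cong₂ _-_ (M-≋̸ (+1≋̸ p)) (M-≋ p))
        (i≡j⇒i-j≡0 (py-U p))))
      go (no ¬p) (yes q) = trans (cong dy (swapped-i q)) (trans (c₁ (py d)) (sym (cong₂ _-_
        (trans (M-≋ q) (cong (_+ 1ℤ) (trans (py-R q) (cong py (+1-1 d))))) (M-≋̸ ¬p))))
      go (no ¬p) (no ¬q) = trans (cong dy (swapped-other ¬q (¬p ∘ ≋-+⁻ 1ℤ))) (sym (trans (cong₂ _-_ (M-≋̸ ¬q) (M-≋̸ ¬p))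
        (trans (cong (_- py d) (py-+1 d)) (c (py d) _))))

    -- Zero unless `lab i` is `+ n`: then position 0 is itself raised, while `i • P` starts at the
    -- origin, and the value is -1.
    offset : ℤ
    offset = P′.py 0ℤ - M 0ℤ

    py′≡ : ∀ d → P′.py d ≡ M d + offset
    py′≡ = same-increments P′.py M increments

    M-path : IsPath k M
    M-path = record
      { step     = λ d → step′ d (IsPath.step P′.py-path d)
      ; periodic = λ d → trans (M≡ (d + + n)) (trans (cong (_- offset) (IsPath.periodic P′.py-path d))
          (trans (c (P′.py d) (+ k) offset) (cong (_+ + k) (sym (M≡ d)))))
      }
      where
      e : ∀ a b → a ≡ a + b - b
      e = solve-∀
      c : ∀ a b o → a + b - o ≡ a - o + b
      c = solve-∀
      M≡ : ∀ d → M d ≡ P′.py d - offset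
      M≡ d = trans (e (M d) offset) (cong (_- offset) (sym (py′≡ d)))
      step′ : ∀ d → P′.py (d + 1ℤ) ≡ P′.py d ⊎ P′.py (d + 1ℤ) ≡ P′.py d + 1ℤ → M (d + 1ℤ) ≡ M d ⊎ M (d + 1ℤ) ≡ M d + 1ℤ
      step′ d (inj₁ p) = inj₁ (trans (M≡ _) (trans (cong (_- offset) p) (sym (M≡ d))))
      step′ d (inj₂ p) = inj₂ (trans (M≡ _) (trans (cong (_- offset) p) (trans (c (P′.py d) 1ℤ offset) (cong (_+ 1ℤ) (sym (M≡ d))))))

    M-peak : ∀ {d} → d ≋ lab i → PeakAt d M
    M-peak {d} p = trans (M-≋ p) (cong (_+ 1ℤ) (trans (py-R p) (sym (M-≋̸ λ q → +1≋̸ q (subst (_≋ lab i) (sym (-1+1 d)) p)))))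
      , trans (M-≋̸ (+1≋̸ p)) (trans (py-U p) (sym (M-≋ p)))

    -- One period of P contains the U-step i + 1. Together with `k<n` this ensures that there is
    -- always a peak to flip.
    0<k : 0ℤ < + k
    0<k = +1≤⇒< (lin₂ (mono {lab i + 1ℤ} {lab i + + n} (+-monoʳ-≤ (lab i) (+≤+ (ℕ.>-nonZero⁻¹ n))))
      (≤-reflexive (IsPath.periodic py-path (lab i))) (trans (c (py (lab i)) (+ k) (py (lab i + + n)))
        (cong (λ t → (py (lab i + + n) - t) + (py (lab i) + + k - py (lab i + + n))) (sym (py-U ≋-refl)))))
      where c : ∀ a k b → k - (0ℤ + 1ℤ) ≡ (b - (a + 1ℤ)) + (a + k - b)
            c = solve-∀

    k<n : + k < + n
    -- The n - 1 steps from position i to i - 1 + n rise by k, since the remaining step i of the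
    -- period is R.
    k<n = +1≤⇒< (lin₂ (lipschitz {lab i} {lab i - 1ℤ + + n} (lin₁ 1≤n (c₀ (lab i) (+ n))))
      (≤-reflexive (py-R {lab i} ≋-refl))
      (trans (c (lab i) (py (lab i)) (+ n) (+ k) (py (lab i - 1ℤ)))
        (cong (λ t → (py (lab i) + (lab i - 1ℤ + + n) - (t + lab i)) + (py (lab i - 1ℤ) - py (lab i)))
         (sym (IsPath.periodic py-path (lab i - 1ℤ))))))
      where
      1≤n : 1ℤ ≤ + n
      1≤n = +≤+ (ℕ.>-nonZero⁻¹ n)
      c₀ : ∀ i n → i - 1ℤ + n - i ≡ n - 1ℤ
      c₀ = solve-∀
      c : ∀ i h n k h′ → n - (k + 1ℤ) ≡ (h + (i - 1ℤ + n) - (h′ + k + i)) + (h′ - h)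
      c = solve-∀

    -- P rises by at most k over k steps, so it stays below `N`. At a raised corner there is room
    -- for one more box, because the last of these k steps is R.
    M≤N : ∀ d → M d ≤ N d
    M≤N d = go (d ≋? lab i)
      where
      c₁ : ∀ d k → d - 1ℤ - (d - k) ≡ k - (0ℤ + 1ℤ)
      c₁ = solve-∀
      c₂ : ∀ h d k h′ → h + k - (h′ + 1ℤ) ≡ h + (d - 1ℤ) - (h′ + (d - k))
      c₂ = solve-∀
      c₃ : ∀ d k → d - (d - k) ≡ k - 0ℤ
      c₃ = solve-∀
      c₄ : ∀ h d k h′ → h + k - h′ ≡ h + d - (h′ + (d - k))
      c₄ = solve-∀
      go : Dec (d ≋ lab i) → M d ≤ N d
      go (yes p) = subst (_≤ N d) (sym (trans (M-≋ p) (cong (_+ 1ℤ) (py-R p))))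
        (lin₁ (lipschitz {d - + k} {d - 1ℤ} (lin₁ (<⇒+1≤ 0<k) (c₁ d (+ k)))) (c₂ (py (d - + k)) d (+ k) (py (d - 1ℤ))))
      go (no ¬p) = subst (_≤ N d) (sym (M-≋̸ ¬p))
        (lin₁ (lipschitz {d - + k} {d} (lin₁ (<⇒≤ 0<k) (c₃ d (+ k)))) (c₄ (py (d - + k)) d (+ k) (py d)))

    word : Word
    word = proj₁ (chain-exists 0<k k<n M-path N-path M≤N)

    private
      chain₀ : Chain N word M
      chain₀ = proj₂ (chain-exists 0<k k<n M-path N-path M≤N)

      i′ = residue {n} (lab i + + k)

      ≋i′ : ∀ {d} → d ≋ lab i′ → d - + k ≋ lab i
      ≋i′ {d} p = ≋-+⁻ (+ k) (subst (_≋ lab i + + k) (sym (c d (+ k))) (≋-trans p (≋-sym (lab-residue (lab i + + k)))))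
        where c : ∀ d k → d - k + k ≡ d
              c = solve-∀

      i′≋ : ∀ {d} → d - + k ≋ lab i → d ≋ lab i′
      i′≋ {d} p = ≋-trans (subst (_≋ lab i + + k) (c d (+ k)) (≋-+ (+ k) p)) (lab-residue (lab i + + k))
        where c : ∀ d k → d - k + k ≡ d
              c = solve-∀

      N′≡ : ∀ d → P′.N d ≡ M (d - + k) + + k + offset
      N′≡ d = trans (cong (_+ + k) (py′≡ (d - + k))) (c (M (d - + k)) (+ k) offset)
        where c : ∀ a b o → a + o + b ≡ a + b + o
              c = solve-∀

      -- `M` and P differ by the corner at i, so their translates by (0, k) differ by the corner at
      -- i + k; lowering it gives back `N` up to the common shift.
      flip-N′ : ∀ d → flip i′ P′.N d ≡ N d + offset
      flip-N′ d = go (d ≋? lab i′)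
        where
        c : ∀ a b o → a + 1ℤ + b + o - 1ℤ ≡ a + b + o
        c = solve-∀
        go : Dec (d ≋ lab i′) → flip i′ P′.N d ≡ N d + offset
        go (yes p) = trans (flip-≋ i′ P′.N p) (trans (cong (_- 1ℤ) (trans (N′≡ d) (cong (λ t → t + + k + offset) (M-≋ (≋i′ p)))))
          (c (py (d - + k)) (+ k) offset))
        go (no ¬p) = trans (flip-≋̸ i′ P′.N ¬p) (trans (N′≡ d) (cong (λ t → t + + k + offset) (M-≋̸ (¬p ∘ i′≋))))

      peak-N′ : ∀ d → d ≋ lab i′ → PeakAt d P′.N
      peak-N′ d p = let a , b = M-peak (≋i′ p) in
          trans (N′≡ d) (trans (cong (λ t → t + + k + offset) (trans a (cong (λ t → M t + 1ℤ) (c₂ d (+ k)))))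
            (trans (c₁ (M (d - 1ℤ - + k)) (+ k) offset) (cong (_+ 1ℤ) (sym (N′≡ (d - 1ℤ))))))
        , trans (N′≡ (d + 1ℤ)) (trans (cong (λ t → t + + k + offset) (trans (cong M (c₃ d (+ k))) b)) (sym (N′≡ d)))
        where
        c₁ : ∀ a b o → a + 1ℤ + b + o ≡ a + b + o + 1ℤ
        c₁ = solve-∀
        c₂ : ∀ a k → a - k - 1ℤ ≡ a - 1ℤ - k
        c₂ = solve-∀
        c₃ : ∀ a k → a + 1ℤ - k ≡ a - k + 1ℤ
        c₃ = solve-∀

    descent-P : Strands.Descent P N (word ∷ʳ i)
    descent-P = Strands.descent N-path (λ _ → ≤-refl) (Chain-∷ʳ i chain₀ (M-peak ≋-refl) flip-M)

    descent-s•P : Strands.Descent (i • P) P′.N (i′ ∷ word)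
    descent-s•P = Strands.descent P′.N-path (λ _ → ≤-refl) (peak-N′ (lab i′) ≋-refl ∷ Chain-+ offset flip-N′ py′≡ chain₀)

    private
      u₀ = translation k

      u₀-comm : s i′ · u₀ ≗ₚ u₀ · s i
      u₀-comm a = trans (cong (_- + k) (swap-cong (≋-sym (lab-residue (lab i + + k))) a)) (swap-translate (lab i) (+ k) a)

      u₀-< : (u₀ $ lab i′) < (u₀ $ (lab i′ + 1ℤ))
      u₀-< = +-monoˡ-< (- + k) (a<a+1 (lab i′))

      u₀-up : Up i u₀
      u₀-up a b p q = +1≤⇒< (≤-reflexive (trans (c a (+ k)) (trans (cong (λ t → t + 1ℤ + + k) p)
                        (trans (cong (_+ + k) (sym q)) (c′ b (+ k))))))
        where
        c : ∀ a k → a + 1ℤ ≡ a - k + 1ℤ + k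
        c = solve-∀
        c′ : ∀ a k → a - k + k ≡ a
        c′ = solve-∀

    -- The initial labels increase, so both tiles are allowed at the first letter. At `s i · g` the
    -- result is the right-hand side of the left recursion for `g`.
    first-letter : ∀ g r → 𝒜 r g (i • P) ≃ 𝒟 (u₀ · s i) word g r ⊎ₛ 𝒟 u₀ word g (r - 1ℤ)
    first-letter g r = Strands.𝒜≃𝒟 (i • P) descent-s•P g r ⨾ 𝒟-∷-< u₀ u₀-<
      ⨾ (𝒟-cong u₀-comm (λ _ → refl) ⊎-inverse ≃-refl)

    recursion : ∀ g → (g $ lab i) < (g $ (lab i + 1ℤ)) → ∀ r →
                𝒟 u₀ word g r ≃ 𝒜 r (s i · g) (i • P)
    recursion g g↑ r = left-recursion i g g↑ u₀ word r u₀-up ⨾ ≃-sym (first-letter (s i · g) r)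

    -- If s i exchanged f i and f (i + 1), then f i would lie strictly between i and i + n,
    -- because s i f is bounded too, but be congruent to i.
    no-exchange : ∀ {f} → 𝐁 k n f → 𝐁 k n (s i · f) → ¬ ((f $ lab i) ≋ lab i × (f $ (lab i + 1ℤ)) ≡ (f $ lab i) + 1ℤ)
    no-exchange {f} b b′ (p , e) = contradiction (lin₂ {x = 1ℤ} {0ℤ} (gap (≋-sym p) i<fi) fi+1≤i+n (c (lab i) (f $ lab i) (+ n))) λ { (+≤+ ()) }
      where
      c : ∀ i a n → 0ℤ - 1ℤ ≡ (a - (i + n)) + (i + n - (a + 1ℤ))
      c = solve-∀
      i<fi : lab i < (f $ lab i)
      i<fi = <-≤-trans (a<a+1 (lab i)) (subst (λ t → lab i + 1ℤ ≤ (f $ t))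
        (trans (swap-down {lab i} ≋-refl) (+1-1 (lab i))) (𝐁.lower b′ (lab i + 1ℤ)))
      fi+1≤i+n : (f $ lab i) + 1ℤ ≤ lab i + + n
      fi+1≤i+n = subst (_≤ lab i + + n) (trans (cong (f $_) (swap-up {lab i} ≋-refl)) e) (𝐁.upper b′ (lab i))

    module _ (f : AffinePerm n) (f↑ : (f $ lab i) < (f $ (lab i + 1ℤ)))
             (¬e : ¬ ((f $ lab i) ≋ lab i × (f $ (lab i + 1ℤ)) ≡ (f $ lab i) + 1ℤ)) (r : ℤ) where

      private
        -- The left recursion for `f · s i`: `¬e` ensures that this product still increases from i
        -- to i + 1. The middle line only reassociates.
        fs-part : 𝒟 u₀ word (f · s i) r ≃ 𝒜 r (s i · f · s i) (i • P)
        fs-part = left-recursion i (f · s i) (swap-mono f↑ ¬e) u₀ word r u₀-up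
          ⨾ (𝒟-cong (λ _ → refl) (λ _ → refl) ⊎-inverse 𝒟-cong (λ _ → refl) (λ _ → refl))
          ⨾ ≃-sym (first-letter (s i · f · s i) r)

      descent-case : lab i + 1ℤ before lab i in[ f ] → 𝒜 r f P ≃ 𝒜 r (s i · f · s i) (i • P)
      descent-case l = Strands.𝒜≃𝒟 P descent-P f r ⨾ 𝒟-∷ʳ-> f i u₀ word l ⨾ fs-part

      ascent-case : lab i before lab i + 1ℤ in[ f ] →
                    𝒜 r f P ≃ 𝒜 (r - 1ℤ) (s i · f) (i • P) ⊎ₛ 𝒜 r (s i · f · s i) (i • P)
      ascent-case l = Strands.𝒜≃𝒟 P descent-P f r ⨾ 𝒟-∷ʳ-< f i u₀ word l
        ⨾ (fs-part ⊎-inverse recursion f f↑ (r - 1ℤ)) ⨾ ⊎-comm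

open import Data.Nat.Base using (_≤_)

lemma3p24 : (n k : ℕ) .{{_ : NonTrivial n}} → k ≤ n →
    (i : Fin n) (f : AffinePerm n) →
    𝐁 k n f → 𝐁 k n (s i · f) → 𝐁 k n (f · s i) → 𝐁 k n (s i · f · s i) →
    s i · f ≻ f →
    (P : 𝒫 k n) → P at lab i ≡ R → P at (lab i + 1ℤ) ≡ U →
    (r : ℤ) →
    (f ≻ f · s i →
    Inverse (𝒜 r f P) (𝒜 r (s i · f · s i) (i • P)))
    × (f · s i ≻ f →
    Inverse (𝒜 r f P) (𝒜 (r - 1ℤ) (s i · f) (i • P) ⊎ₛ 𝒜 r (s i · f · s i) (i • P)))
lemma3p24 n k _ i f b sb _ _ sf≻f P PR PU r =
    (λ f≻fs → descent-case f f↑ (no-exchange {f} b sb) r (≻⇒after {f} {i} f≻fs))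
  , (λ fs≻f → ascent-case f f↑ (no-exchange {f} b sb) r (≻⇒before {f} {i} fs≻f))
  where
  open Affine n
  open Corner P i PR PU
  f↑ = ≻⇒<ˡ {f} {i} sf≻f
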